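{- Let $n\ge2$. For all $w,v\in S_n$, $$c(w;v)=\psi\bigl(w*\mathfrak S_v(\theta)\bigr),$$ where $c(w;v)$ is the coefficient of $[X(v)]$ in the Chern--Schwartz--MacPherson class $c_{SM}(X(w)^\circ)=\sum_{v\in S_n}c(w;v)[X(v)]$ of the Schubert cell $X(w)^\circ$ in the type $A$ flag variety, $\mathfrak S_v(\theta)\in FK_n$ is the Schubert polynomial evaluated at the Dunkl elements, $*$ is the extended Bruhat action of $FK_n$ on $\mathbb Z[S_n]$, and $\psi:\mathbb Z[S_n]\to\mathbb Z$ is the ring homomorphism with $\psi(u)=1$ for all $u\in S_n$.
   Context: Fomin--Kirillov algebra: $FK_n$ is the associative unital algebra generated by $[ij]$, $1\le i<j\le n$, with the convention $[ji]=-[ij]$, subject to: $[ij]^2=0$; $[ij][kl]=[kl][ij]$ for distinct $i,j,k,l$; $[ij][jk]=[jk][ik]+[ik][ij]$ and $[jk][ij]=[ik][jk]+[ij][ik]$ for distinct $i,j,k$. The Dunkl elements are $\theta_i=\sum_{j\ne i}[ij]$, $1\le i\le n$; they commute pairwise. The extended Bruhat action is the right action of $FK_n$ on $\mathbb Z[S_n]$ given, for $i<j$ and $w\in S_n$, by $w*[ij]=wt_{ij}$ if $\ell(wt_{ij})<\ell(w)$ and $w*[ij]=0$ otherwise, where $t_{ij}$ is the transposition $(i\ j)$ and $\ell$ is the length function; so $w*(ab)=(w*a)*b$. Schubert polynomials: $\mathfrak S_{w_0}=x_1^{n-1}x_2^{n-2}\cdots x_{n-1}$ for the longest element $w_0\in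 S_n$, and $\mathfrak S_{ws_k}=\partial_k\mathfrak S_w$ if $\ell(ws_k)<\ell(w)$, where $\partial_kf=(f-s_kf)/(x_k-x_{k+1})$ and $s_k=(k\ k{+}1)$. $\mathfrak S_v(\theta)$ is obtained by substituting $x_i\mapsto\theta_i$. CSM classes: let $X=SL_n(\mathbb C)/B$, with $B$ the upper triangular matrices, $X(w)^\circ=BwB/B$ and $X(w)=\overline{BwB/B}$. The classes $[X(w)]$, $w\in S_n$, form a basis of $H_*(X)$. The CSM class is $c_{SM}(X(w)^\circ)=c_*(\mathbb 1_{X(w)^\circ})\in H_*(X)$, with $c_*$ MacPherson's natural transformation from constructible functions to homology. It is known (Aluffi--Mihalcea) that these classes are determined by $c_{SM}(X(e)^\circ)=[X(e)]$ and $T_k(c_{SM}(X(w)^\circ))=c_{SM}(X(ws_k)^\circ)$ for all $w\in S_n$, $1\le k\le n-1$, where $T_k=\partial_k-s_k$ on $H_*(X)$; here $\partial_k[X(w)]=[X(ws_k)]$ if $\ell(ws_k)>\ell(w)$ and $0$ otherwise, $s_k=\mathrm{id}-c_1(\mathcal L_{\alpha_k})\partial_k$, and $c_1(\mathcal L_\lambda)\cdot[X(w)]=\sum_\beta\langle\lambda,\beta^\vee\rangle[X(ws_\beta)]$, summed over positive roots $\beta$ with $\ell(ws_\beta)=\ell(w)-1$. The simple roots are $\alpha_k=\varepsilon_k-\varepsilon_{k+1}$, and for $\beta=\varepsilon_a-\varepsilon_b$ with $a<b$, $s_\beta=t_{ab}$. -}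

module Defs where

open import Algebra.Bundles using (Ring)
open import Data.Bool.Base using (if_then_else_)
open import Data.Fin.Base using (Fin; toℕ) renaming (_<_ to _<ᶠ_)
open import Data.Fin.Permutation
  using (Permutation′; _⟨$⟩ʳ_; _∘ₚ_; transpose; reverse) renaming (_≈_ to _≈ₚ_; id to idₚ)
open import Data.Fin.Properties using (_≟_; <-cmp; all?) renaming (_<?_ to _<ᶠ?_)
open import Data.Integer.Base as ℤ using (ℤ; 0ℤ; 1ℤ; -1ℤ)
open import Data.List.Base
  using (List; []; _∷_; [_]; _++_; map; concatMap; filter; foldr; length; allFin; cartesianProduct)
open import Data.List.Relation.Unary.Unique.Propositional using (Unique)
open import Data.Nat.Base as ℕ using (ℕ; zero; suc; _∸_)
import Data.Nat.Properties as ℕ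
open import Data.Product.Base using (_×_; _,_; uncurry)
open import Level using (0ℓ)
open import Relation.Binary.Core using (Rel)
open import Relation.Binary.Definitions using (Tri; tri<; tri≈; tri>)
open import Relation.Binary.PropositionalEquality.Core using (_≡_; _≢_)
open import Relation.Nullary.Decidable.Core using (Dec; does; ¬?)

------------------------------------------------------------------------
-- Rings given by generators and relations

infixl 6 _+_
infixl 7 _*_
infix  8 -_

data Term (X : Set) : Set where
  var     : X → Term X
  0# 1#   : Term X
  _+_ _*_ : Term X → Term X → Term X
  -_      : Term X → Term X

-- The smallest ring congruence on terms that contains R.
data Congruence {X : Set} (R : Rel (Term X) 0ℓ) : Rel (Term X) 0ℓ where
  rel         : ∀ {a b} → R a b → Congruence R a b
  refl        : ∀ {a} → Congruence R a a
  sym         : ∀ {a b} → Congruence R a b → Congruence R b a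
  trans       : ∀ {a b c} → Congruence R a b → Congruence R b c → Congruence R a c
  +-cong      : ∀ {a b c d} → Congruence R a b → Congruence R c d → Congruence R (a + c) (b + d)
  *-cong      : ∀ {a b c d} → Congruence R a b → Congruence R c d → Congruence R (a * c) (b * d)
  neg-cong    : ∀ {a b} → Congruence R a b → Congruence R (- a) (- b)
  +-assoc     : ∀ a b c → Congruence R ((a + b) + c) (a + (b + c))
  +-comm      : ∀ a b → Congruence R (a + b) (b + a)
  +-identityˡ : ∀ a → Congruence R (0# + a) a
  +-identityʳ : ∀ a → Congruence R (a + 0#) a
  +-inverseˡ  : ∀ a → Congruence R (- a + a) 0#
  +-inverseʳ  : ∀ a → Congruence R (a + - a) 0#
  *-assoc     : ∀ a b c → Congruence R ((a * b) * c) (a * (b * c))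
  *-identityˡ : ∀ a → Congruence R (1# * a) a
  *-identityʳ : ∀ a → Congruence R (a * 1#) a
  distribˡ    : ∀ a b c → Congruence R (a * (b + c)) (a * b + a * c)
  distribʳ    : ∀ a b c → Congruence R ((b + c) * a) (b * a + c * a)

⟨_∣_⟩ : (X : Set) → Rel (Term X) 0ℓ → Ring 0ℓ 0ℓ
⟨ X ∣ R ⟩ = record
  { Carrier = Term X
  ; _≈_     = Congruence R
  ; _+_     = _+_
  ; _*_     = _*_
  ; -_      = -_
  ; 0#      = 0#
  ; 1#      = 1#
  ; isRing  = record
    { +-isAbelianGroup = record
      { isGroup = record
        { isMonoid = record
          { isSemigroup = record
            { isMagma = record
              { isEquivalence = record { refl = refl ; sym = sym ; trans = trans }
              ; ∙-cong        = +-cong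
              }
            ; assoc = +-assoc
            }
          ; identity = +-identityˡ , +-identityʳ
          }
        ; inverse = +-inverseˡ , +-inverseʳ
        ; ⁻¹-cong = neg-cong
        }
      ; comm = +-comm
      }
    ; *-cong     = *-cong
    ; *-assoc    = *-assoc
    ; *-identity = *-identityˡ , *-identityʳ
    ; distrib    = distribˡ , distribʳ
    }
  }

module _ {X : Set} where

  infixl 6 _-_
  infixr 9 _^_

  _-_ : Term X → Term X → Term X
  a - b = a + - b

  _^_ : Term X → ℕ → Term X
  a ^ zero  = 1#
  a ^ suc m = a * a ^ m

  ∑ ∏ : {A : Set} → List A → (A → Term X) → Term X
  ∑ is f = foldr (λ i a → f i + a) 0# is
  ∏ is f = foldr (λ i a → f i * a) 1# is

substitute : {X Y : Set} → (X → Term Y) → Term X → Term Y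
substitute σ (var x) = σ x
substitute σ 0#      = 0#
substitute σ 1#      = 1#
substitute σ (a + b) = substitute σ a + substitute σ b
substitute σ (a * b) = substitute σ a * substitute σ b
substitute σ (- a)   = - substitute σ a

------------------------------------------------------------------------
-- Permutations

infixl 7 _·_

-- Product in S_n as composition of functions, (u · v)(i) = u(v(i));
-- the library's _∘ₚ_ composes in the opposite order.
_·_ : ∀ {n} → Permutation′ n → Permutation′ n → Permutation′ n
u · v = v ∘ₚ u

_≈ₚ?_ : ∀ {n} (u v : Permutation′ n) → Dec (u ≈ₚ v)
u ≈ₚ? v = all? λ i → (u ⟨$⟩ʳ i) ≟ (v ⟨$⟩ʳ i)

-- All pairs a < b, i.e. the positive roots ε_a - ε_b.
pairs : (n : ℕ) → List (Fin n × Fin n)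
pairs n = filter (uncurry _<ᶠ?_) (cartesianProduct (allFin n) (allFin n))

-- Number of inversions.
ℓ : ∀ {n} → Permutation′ n → ℕ
ℓ {n} w = length (filter (λ (a , b) → (w ⟨$⟩ʳ b) <ᶠ? (w ⟨$⟩ʳ a)) (pairs n))

-- The simple reflections are the transpose k l with Consecutive k l.
Consecutive : ∀ {n} → Fin n → Fin n → Set
Consecutive k l = toℕ l ≡ suc (toℕ k)

------------------------------------------------------------------------
-- Formal ℤ-linear combinations of permutations.  They serve both as
-- ℤ[S_n] and as H_*(X), where w stands for the basis element [X(w)].
-- The same permutation may occur several times in the list.

Comb : ℕ → Set
Comb n = List (ℤ × Permutation′ n)

module _ {n : ℕ} where

  basis : Permutation′ n → Comb n
  basis w = [ (1ℤ , w) ]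

  scale : ℤ → Comb n → Comb n
  scale c = map λ (d , u) → (c ℤ.* d , u)

  _⊖_ : Comb n → Comb n → Comb n
  x ⊖ y = x ++ scale -1ℤ y

  linear : (Permutation′ n → Comb n) → Comb n → Comb n
  linear f = concatMap λ (c , u) → scale c (f u)

  coeff : Permutation′ n → Comb n → ℤ
  coeff v = foldr (λ (c , u) s → if does (u ≈ₚ? v) then c ℤ.+ s else s) 0ℤ

  -- The augmentation of ℤ[S_n]: the additive map with ψ(u) = 1 on S_n.
  ψ : Comb n → ℤ
  ψ = foldr (λ (c , _) s → c ℤ.+ s) 0ℤ

------------------------------------------------------------------------
-- The Fomin–Kirillov algebra

data Generator (n : ℕ) : Set where
  gen : (i j : Fin n) → i <ᶠ j → Generator n

-- [ji] = -[ij]; the value 0 for i = j is a dummy and is never used.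
bracket : ∀ {n} → Fin n → Fin n → Term (Generator n)
bracket i j with <-cmp i j
... | tri< i<j _ _ = var (gen i j i<j)
... | tri≈ _ _ _   = 0#
... | tri> _ _ j<i = - var (gen j i j<i)

data FKRelation {n : ℕ} : Rel (Term (Generator n)) 0ℓ where
  square    : ∀ {i j} → i ≢ j → FKRelation (bracket i j * bracket i j) 0#
  commute   : ∀ {i j k l} → Unique (i ∷ j ∷ k ∷ l ∷ []) →
              FKRelation (bracket i j * bracket k l) (bracket k l * bracket i j)
  triangle₁ : ∀ {i j k} → Unique (i ∷ j ∷ k ∷ []) →
              FKRelation (bracket i j * bracket j k)
                         (bracket j k * bracket i k + bracket i k * bracket i j)
  triangle₂ : ∀ {i j k} → Unique (i ∷ j ∷ k ∷ []) →
              FKRelation (bracket j k * bracket i j)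
                         (bracket i k * bracket j k + bracket i j * bracket i k)

FK : ℕ → Ring 0ℓ 0ℓ
FK n = ⟨ Generator n ∣ FKRelation ⟩

module FK {n : ℕ} = Ring (FK n)

θ : ∀ {n} → Fin n → FK.Carrier {n}
θ {n} i = ∑ (filter (λ j → ¬? (j ≟ i)) (allFin n)) (bracket i)

-- The extended Bruhat action.
infixl 7 _⋆_

_⋆_ : ∀ {n} → Comb n → FK.Carrier {n} → Comb n
x ⋆ var (gen i j _) = linear act x
  where
  act : Permutation′ _ → Comb _
  act w = if does (ℓ (w · transpose i j) ℕ.<? ℓ w) then basis (w · transpose i j) else []
x ⋆ 0#      = []
x ⋆ 1#      = x
x ⋆ (a + b) = (x ⋆ a) ++ (x ⋆ b)
x ⋆ (a * b) = (x ⋆ a) ⋆ b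
x ⋆ (- a)   = scale -1ℤ (x ⋆ a)

------------------------------------------------------------------------
-- Schubert polynomials

data Commutativity {n : ℕ} : Rel (Term (Fin n)) 0ℓ where
  comm : ∀ i j → Commutativity (var i * var j) (var j * var i)

-- ℤ[x_1, …, x_n]; var i is x_{toℕ i + 1}.
ℤ[x] : ℕ → Ring 0ℓ 0ℓ
ℤ[x] n = ⟨ Fin n ∣ Commutativity ⟩

module ℤ[x] {n : ℕ} = Ring (ℤ[x] n)

swap : ∀ {n} → Fin n → Fin n → ℤ[x].Carrier {n} → ℤ[x].Carrier {n}
swap k l = substitute λ i → var (transpose k l ⟨$⟩ʳ i)

-- g = (f - s f) / (x_k - x_l), where s exchanges x_k and x_l.  As ℤ[x]
-- is an integral domain, g is determined by f up to _≈_.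
IsDividedDifference : ∀ {n} → Fin n → Fin n → Rel (ℤ[x].Carrier {n}) 0ℓ
IsDividedDifference k l f g = (var k - var l) * g ℤ[x].≈ f - swap k l f

-- IsSchubert w f: the polynomial represented by f is 𝔖_w.  Every w is
-- reached, since 𝔖_w results from any chain of descents from w₀ to w.
data IsSchubert {n : ℕ} : Permutation′ n → ℤ[x].Carrier {n} → Set where
  longest : ∀ {w f} → w ≈ₚ reverse →
            f ℤ[x].≈ ∏ (allFin n) (λ i → var i ^ (n ∸ suc (toℕ i))) →
            IsSchubert w f
  descend : ∀ {w v f g} (k l : Fin n) → Consecutive k l →
            IsSchubert w f →
            ℓ (w · transpose k l) ℕ.< ℓ w →
            v ≈ₚ w · transpose k l →
            IsDividedDifference k l f g →
            IsSchubert v g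

evalθ : ∀ {n} → ℤ[x].Carrier {n} → FK.Carrier {n}
evalθ = substitute θ

------------------------------------------------------------------------
-- Chern–Schwartz–MacPherson classes of Schubert cells

-- A weight Σᵢ λᵢ εᵢ is given by its coordinates.
Weight : ℕ → Set
Weight n = Fin n → ℤ

-- ε_a - ε_b
root : ∀ {n} → Fin n → Fin n → Weight n
root a b i = δ a ℤ.- δ b
  where
  δ : Fin _ → ℤ
  δ c = if does (i ≟ c) then 1ℤ else 0ℤ

-- ⟨ λ , β^∨ ⟩ for β = ε_a - ε_b
pairing : ∀ {n} → Weight n → Fin n → Fin n → ℤ
pairing μ a b = μ a ℤ.- μ b

module _ {n : ℕ} where

  -- Multiplication by c₁(L_μ).
  c₁ : Weight n → Comb n → Comb n
  c₁ μ = linear λ w → concatMap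
    (λ (a , b) → if does (suc (ℓ (w · transpose a b)) ℕ.≟ ℓ w)
                 then scale (pairing μ a b) (basis (w · transpose a b))
                 else [])
    (pairs n)

  -- For Consecutive k l these are ∂_k, s_k and T_k on H_*(X).
  ∂ᴴ sᴴ T : Fin n → Fin n → Comb n → Comb n
  ∂ᴴ k l = linear λ w →
    if does (ℓ w ℕ.<? ℓ (w · transpose k l)) then basis (w · transpose k l) else []
  sᴴ k l x = x ⊖ c₁ (root k l) (∂ᴴ k l x)
  T  k l x = ∂ᴴ k l x ⊖ sᴴ k l x

-- IsCSM w c: the combination c represents c_SM(X(w)°).  MacPherson's
-- transformation is replaced by the Aluffi–Mihalcea recursion, which
-- determines the classes: start from [X(id)] and apply the T_k along
-- any (not necessarily reduced) word for w.
data IsCSM {n : ℕ} : Permutation′ n → Comb n → Set where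
  point : ∀ {w} → w ≈ₚ idₚ → IsCSM w (basis idₚ)
  step  : ∀ {w v c} (k l : Fin n) → Consecutive k l →
          IsCSM w c → v ≈ₚ w · transpose k l → IsCSM v (T k l c)

-- Let G(w, f) = ψ(w * f(θ)), and let H(w, f) be the analogue in which [ij] acts only by
-- covers w t_ij ⋖ w and ψ is replaced by the coefficient of the identity.  Both actions satisfy a
-- commutation rule of degenerate Hecke type between θ_i and right multiplication by s = s_k
-- (restricted to ascents for H).  By induction on f it yields
--   G(w s, f) = G(w, s f) + G(w, ∂ f)   and   [w s > w] H(w s, f) = H(w, ∂ f)   for ∂ = ∂_k.
-- The second rule also shows, by induction on w, that the θ_i commute in the covering action, so that
-- H(w, -) is defined on ℤ[x].  Now H(u, 𝔖_v) = δ_uv: this descends along ∂_k from 𝔖_{w₀}, where degrees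
-- force u = w₀ and a single chain of covers contributes.  By definition c₁(L_λ) is dual under H to
-- multiplication by λ, hence T_k = ∂_k - s_k on homology is dual to s_k + ∂_k on polynomials.  So the
-- recursion of the CSM classes is that of G, and c(w; v) = H(c_SM(X(w)°), 𝔖_v) = G(w, 𝔖_v).

module Submission where

open import Defs hiding (refl; sym; trans)
open import Algebra.Bundles using (Ring; CommutativeRing)
open import Data.Fin.Base using (Fin; zero; suc; toℕ; fromℕ<; opposite) renaming (_<_ to _<ᶠ_)
open import Data.Fin.Permutation
  using (Permutation′; _⟨$⟩ʳ_; _⟨$⟩ˡ_; inverseˡ; inverseʳ; transpose; reverse) renaming (_≈_ to _≈ₚ_; id to idₚ)
open import Data.Fin.Properties as Fin using (_≟_; <-cmp; toℕ-injective; any?) renaming (_<?_ to _<ᶠ?_)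
open import Data.Integer.Base as ℤ using (ℤ; 0ℤ; 1ℤ; -1ℤ)
import Data.Integer.Properties as ℤ
open import Data.Integer.Tactic.RingSolver using (solve-∀)
open import Data.List.Base
  using (List; []; _∷_; _++_; map; concatMap; filter; foldr; length; allFin; tabulate; cartesianProduct)
import Data.List.Properties as List
open import Data.List.Membership.Propositional.Properties using (∈-filter⁺; ∈-cartesianProduct⁺; ∈-allFin)
open import Data.List.Relation.Unary.All as All using (All; []; _∷_)
open import Data.List.Relation.Unary.All.Properties using (all-filter; ¬All⇒Any¬)
open import Data.List.Relation.Unary.AllPairs using ([]; _∷_)
open import Data.Nat.Base as ℕ using (ℕ; zero; suc; _∸_; _≤_; s≤s; z≤n)
import Data.Nat.Properties as ℕ
open import Data.Product.Base using (_×_; _,_; proj₁; proj₂; uncurry; ∃; ∃₂)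
open import Data.Sum.Base using (_⊎_; inj₁; inj₂)
open import Data.Bool.Base using (if_then_else_)
open import Function.Base using (_∘_; _$_)
open import Level using (0ℓ)
open import Relation.Binary.Definitions using (Tri; tri<; tri≈; tri>)
open import Relation.Binary.PropositionalEquality
  using (_≡_; _≢_; refl; sym; trans; cong; cong₂; subst; subst₂; ≢-sym; module ≡-Reasoning)
open import Relation.Nullary.Decidable using (Dec; yes; no; does; ¬?; _×-dec_; dec-true; dec-false)
open import Relation.Nullary.Negation using (¬_; contradiction)
open import Relation.Unary using (Decidable)

open import Algebra.Properties.Semiring.Sum ℤ.+-*-semiring
  using (sum; sum-cong-≗; ∑-comm; ∑-distrib-+; ∑-permute; *-distribˡ-sum; sum-syntax; sum-replicate-zero)

-- Both actions are transposed to functions on S_n: the right action of a term on combinations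
-- becomes a left action `▷` on functions φ. Every claim about formal combinations, where a
-- permutation may occur several times, then reduces to an identity between values at single
-- permutations, and no list is ever brought to a normal form. Polynomials stay terms as long as
-- possible. The operator ∂_k is a twisted derivation on terms, so its commutation with θ is an
-- induction on the syntax of f, carried out once for both actions. Relations of ℤ[x] enter in two
-- ways: H must respect them, and a divided difference, given only by an equation with the factor
-- x_k - x_l, must be shown to be unique. The relations of FK_n enter because 𝔖_v(θ) may be given by
-- any representative; they are checked on the Bruhat action through signs of positions and of
-- values.

private variable
  n : ℕ
  P Q : Set

-- Indicators and finite sums

𝟙 : Dec P → ℤ
𝟙 p? = if does p? then 1ℤ else 0ℤ

𝟙-yes : (p? : Dec P) → P → 𝟙 p? ≡ 1ℤ
𝟙-yes p? p rewrite dec-true p? p = refl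

𝟙-no : (p? : Dec P) → ¬ P → 𝟙 p? ≡ 0ℤ
𝟙-no p? ¬p rewrite dec-false p? ¬p = refl

𝟙-cong : (p? : Dec P) (q? : Dec Q) → (P → Q) → (Q → P) → 𝟙 p? ≡ 𝟙 q?
𝟙-cong p? (yes q) to from = 𝟙-yes p? (from q)
𝟙-cong p? (no ¬q) to from = 𝟙-no p? (¬q ∘ to)

𝟙-holds : (p? : Dec P) → 𝟙 p? ≡ 1ℤ → P
𝟙-holds (yes p) _ = p

-- The factors need not correspond one by one; only the conjunctions are equivalent. This is the
-- situation for covers, where each condition on one side may depend on both conditions on the
-- other.
𝟙-×-cong : {P Q P′ Q′ : Set} (p? : Dec P) (q? : Dec Q) (p′? : Dec P′) (q′? : Dec Q′) →
  (P → Q → P′ × Q′) → (P′ → Q′ → P × Q) → 𝟙 p? ℤ.* 𝟙 q? ≡ 𝟙 p′? ℤ.* 𝟙 q′?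
𝟙-×-cong (yes p) (yes q) p′? q′? to from with to p q
... | p′ , q′ = sym (cong₂ ℤ._*_ (𝟙-yes p′? p′) (𝟙-yes q′? q′))
𝟙-×-cong (no ¬p) q? (yes p′) (yes q′) to from = contradiction (proj₁ (from p′ q′)) ¬p
𝟙-×-cong (yes p) (no ¬q) (yes p′) (yes q′) to from = contradiction (proj₂ (from p′ q′)) ¬q
𝟙-×-cong (no _)  _      (no _)  _      to from = refl
𝟙-×-cong (no _)  _      (yes _) (no _) to from = refl
𝟙-×-cong (yes _) (no _) (no _)  _      to from = refl
𝟙-×-cong (yes _) (no _) (yes _) (no _) to from = refl

interchange : ∀ a b c d → a ℤ.+ b ℤ.+ (c ℤ.+ d) ≡ a ℤ.+ c ℤ.+ (b ℤ.+ d)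
interchange = solve-∀

sum-0 : (f : Fin n → ℤ) → (∀ i → f i ≡ 0ℤ) → sum f ≡ 0ℤ
sum-0 {n} f f≡0 = trans (sum-cong-≗ f≡0) (sum-replicate-zero n)

sum-single : (f : Fin n → ℤ) (k : Fin n) → (∀ i → i ≢ k → f i ≡ 0ℤ) → sum f ≡ f k
sum-single f zero    f≡0 =
  trans (cong (ℤ._+_ (f zero)) (sum-0 (f ∘ suc) λ i → f≡0 (suc i) λ ())) (ℤ.+-identityʳ _)
sum-single f (suc k) f≡0 = trans
  (cong₂ ℤ._+_ (f≡0 zero λ ()) (sum-single (f ∘ suc) k λ i i≢k → f≡0 (suc i) (i≢k ∘ Fin.suc-injective)))
  (ℤ.+-identityˡ _)

sum-neg : (f : Fin n → ℤ) → sum (λ i → ℤ.- f i) ≡ ℤ.- sum f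
sum-neg {zero}  f = refl
sum-neg {suc n} f = trans (cong (ℤ._+_ (ℤ.- f zero)) (sum-neg (f ∘ suc))) (sym (ℤ.neg-distrib-+ (f zero) _))

sum-sub : (f g : Fin n → ℤ) → sum (λ i → f i ℤ.- g i) ≡ sum f ℤ.- sum g
sum-sub f g = trans (∑-distrib-+ f (λ i → ℤ.- g i)) (cong (ℤ._+_ (sum f)) (sum-neg g))

sumᴸ : {A : Set} → List A → (A → ℤ) → ℤ
sumᴸ xs f = foldr (λ x s → f x ℤ.+ s) 0ℤ xs

module _ {A : Set} where

  sumᴸ-cong : (xs : List A) {f g : A → ℤ} → (∀ x → f x ≡ g x) → sumᴸ xs f ≡ sumᴸ xs g
  sumᴸ-cong []       f≡g = refl
  sumᴸ-cong (x ∷ xs) f≡g = cong₂ ℤ._+_ (f≡g x) (sumᴸ-cong xs f≡g)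

  sumᴸ-++ : (xs ys : List A) (f : A → ℤ) → sumᴸ (xs ++ ys) f ≡ sumᴸ xs f ℤ.+ sumᴸ ys f
  sumᴸ-++ []       ys f = sym (ℤ.+-identityˡ _)
  sumᴸ-++ (x ∷ xs) ys f = trans (cong (ℤ._+_ (f x)) (sumᴸ-++ xs ys f)) (sym (ℤ.+-assoc (f x) _ _))

  sumᴸ-map : {B : Set} (h : B → A) (xs : List B) (f : A → ℤ) → sumᴸ (map h xs) f ≡ sumᴸ xs (f ∘ h)
  sumᴸ-map h []       f = refl
  sumᴸ-map h (x ∷ xs) f = cong (ℤ._+_ (f (h x))) (sumᴸ-map h xs f)

  sumᴸ-concatMap : {B : Set} (h : B → List A) (xs : List B) (f : A → ℤ) →
                   sumᴸ (concatMap h xs) f ≡ sumᴸ xs (λ x → sumᴸ (h x) f)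
  sumᴸ-concatMap h []       f = refl
  sumᴸ-concatMap h (x ∷ xs) f = trans (sumᴸ-++ (h x) (concatMap h xs) f)
                                      (cong (ℤ._+_ (sumᴸ (h x) f)) (sumᴸ-concatMap h xs f))

  sumᴸ-scale : (c : ℤ) (xs : List A) (f : A → ℤ) → sumᴸ xs (λ x → c ℤ.* f x) ≡ c ℤ.* sumᴸ xs f
  sumᴸ-scale c []       f = sym (ℤ.*-zeroʳ c)
  sumᴸ-scale c (x ∷ xs) f = trans (cong (ℤ._+_ (c ℤ.* f x)) (sumᴸ-scale c xs f)) (sym (ℤ.*-distribˡ-+ c (f x) _))

  sumᴸ-+ : (xs : List A) (f g : A → ℤ) → sumᴸ xs (λ x → f x ℤ.+ g x) ≡ sumᴸ xs f ℤ.+ sumᴸ xs g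
  sumᴸ-+ []       f g = refl
  sumᴸ-+ (x ∷ xs) f g = trans (cong (ℤ._+_ (f x ℤ.+ g x)) (sumᴸ-+ xs f g)) (interchange (f x) (g x) (sumᴸ xs f) (sumᴸ xs g))
  sumᴸ-filter : {R : A → Set} (R? : Decidable R) (xs : List A) (f : A → ℤ) →
                sumᴸ (filter R? xs) f ≡ sumᴸ xs (λ x → 𝟙 (R? x) ℤ.* f x)
  sumᴸ-filter R? []       f = refl
  sumᴸ-filter R? (x ∷ xs) f with R? x
  ... | yes _ = cong₂ ℤ._+_ (sym (ℤ.*-identityˡ (f x))) (sumᴸ-filter R? xs f)
  ... | no  _ = trans (sumᴸ-filter R? xs f) (sym (ℤ.+-identityˡ _))

  length-sumᴸ : (xs : List A) → ℤ.+ length xs ≡ sumᴸ xs (λ _ → 1ℤ)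
  length-sumᴸ []       = refl
  length-sumᴸ (x ∷ xs) = cong (ℤ._+_ 1ℤ) (length-sumᴸ xs)

sumᴸ-tabulate : {A : Set} (h : Fin n → A) (f : A → ℤ) → sumᴸ (tabulate h) f ≡ sum (f ∘ h)
sumᴸ-tabulate {zero}  h f = refl
sumᴸ-tabulate {suc n} h f = cong (ℤ._+_ (f (h zero))) (sumᴸ-tabulate (h ∘ suc) f)

sumᴸ-allFin : (f : Fin n → ℤ) → sumᴸ (allFin n) f ≡ sum f
sumᴸ-allFin = sumᴸ-tabulate λ i → i

sumᴸ-cartesianProduct : {A B : Set} (xs : List A) (ys : List B) (f : A × B → ℤ) →
  sumᴸ (cartesianProduct xs ys) f ≡ sumᴸ xs (λ x → sumᴸ ys (λ y → f (x , y)))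
sumᴸ-cartesianProduct []       ys f = refl
sumᴸ-cartesianProduct (x ∷ xs) ys f = trans (sumᴸ-++ (map (x ,_) ys) _ f)
  (cong₂ ℤ._+_ (sumᴸ-map (x ,_) ys f) (sumᴸ-cartesianProduct xs ys f))

sumᴸ-pairs : (f : Fin n × Fin n → ℤ) →
  sumᴸ (pairs n) f ≡ ∑[ a < n ] ∑[ b < n ] (𝟙 (a <ᶠ? b) ℤ.* f (a , b))
sumᴸ-pairs {n} f = begin
  sumᴸ (pairs n) f
    ≡⟨ sumᴸ-filter (uncurry _<ᶠ?_) (cartesianProduct (allFin n) (allFin n)) f ⟩
  sumᴸ (cartesianProduct (allFin n) (allFin n)) (λ (a , b) → 𝟙 (a <ᶠ? b) ℤ.* f (a , b))
    ≡⟨ sumᴸ-cartesianProduct (allFin n) (allFin n) (λ (a , b) → 𝟙 (a <ᶠ? b) ℤ.* f (a , b)) ⟩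
  sumᴸ (allFin n) (λ a → sumᴸ (allFin n) (λ b → 𝟙 (a <ᶠ? b) ℤ.* f (a , b)))
    ≡⟨ sumᴸ-allFin (λ a → sumᴸ (allFin n) (λ b → 𝟙 (a <ᶠ? b) ℤ.* f (a , b))) ⟩
  ∑[ a < n ] sumᴸ (allFin n) (λ b → 𝟙 (a <ᶠ? b) ℤ.* f (a , b))
    ≡⟨ sum-cong-≗ (λ a → sumᴸ-allFin (λ b → 𝟙 (a <ᶠ? b) ℤ.* f (a , b))) ⟩
  ∑[ a < n ] ∑[ b < n ] (𝟙 (a <ᶠ? b) ℤ.* f (a , b)) ∎
  where open ≡-Reasoning

-- Transpositions

injective : (w : Permutation′ n) {i j : Fin n} → w ⟨$⟩ʳ i ≡ w ⟨$⟩ʳ j → i ≡ j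
injective w eq = trans (sym (inverseˡ w)) (trans (cong (w ⟨$⟩ˡ_) eq) (inverseˡ w))

transpose-matchˡ : (i j : Fin n) → transpose i j ⟨$⟩ʳ i ≡ j
transpose-matchˡ i j rewrite dec-true (i ≟ i) refl = refl

transpose-matchʳ : (i j : Fin n) → transpose i j ⟨$⟩ʳ j ≡ i
transpose-matchʳ i j with j ≟ i
... | yes j≡i = j≡i
... | no  _ rewrite dec-true (j ≟ j) refl = refl

transpose-mismatch : {i j k : Fin n} → k ≢ i → k ≢ j → transpose i j ⟨$⟩ʳ k ≡ k
transpose-mismatch {i = i} {j} {k} k≢i k≢j
  rewrite dec-false (k ≟ i) k≢i | dec-false (k ≟ j) k≢j = refl

transpose-comm : (i j : Fin n) → transpose i j ≈ₚ transpose j i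
transpose-comm i j k = case (k ≟ i) (k ≟ j)
  where
  case : Dec (k ≡ i) → Dec (k ≡ j) → transpose i j ⟨$⟩ʳ k ≡ transpose j i ⟨$⟩ʳ k
  case (yes refl) _ = trans (transpose-matchˡ k j) (sym (transpose-matchʳ j k))
  case _ (yes refl) = trans (transpose-matchʳ i k) (sym (transpose-matchˡ k i))
  case (no k≢i) (no k≢j) = trans (transpose-mismatch k≢i k≢j) (sym (transpose-mismatch k≢j k≢i))

transpose-involutive : (i j k : Fin n) → transpose i j ⟨$⟩ʳ (transpose i j ⟨$⟩ʳ k) ≡ k
transpose-involutive i j k =
  trans (cong (transpose i j ⟨$⟩ʳ_) (transpose-comm i j k)) (inverseʳ (transpose i j))

conjugate-transpose : (σ : Permutation′ n) (i j : Fin n) →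
  σ · transpose i j ≈ₚ transpose (σ ⟨$⟩ʳ i) (σ ⟨$⟩ʳ j) · σ
conjugate-transpose σ i j k = sym (case (k ≟ i) (k ≟ j))
  where
  case : Dec (k ≡ i) → Dec (k ≡ j) →
         transpose (σ ⟨$⟩ʳ i) (σ ⟨$⟩ʳ j) ⟨$⟩ʳ (σ ⟨$⟩ʳ k) ≡ σ ⟨$⟩ʳ (transpose i j ⟨$⟩ʳ k)
  case (yes refl) _ = trans (transpose-matchˡ (σ ⟨$⟩ʳ i) (σ ⟨$⟩ʳ j)) (cong (σ ⟨$⟩ʳ_) (sym (transpose-matchˡ i j)))
  case _ (yes refl) = trans (transpose-matchʳ (σ ⟨$⟩ʳ i) (σ ⟨$⟩ʳ j)) (cong (σ ⟨$⟩ʳ_) (sym (transpose-matchʳ i j)))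
  case (no k≢i) (no k≢j) = trans (transpose-mismatch (k≢i ∘ injective σ) (k≢j ∘ injective σ))
                                 (cong (σ ⟨$⟩ʳ_) (sym (transpose-mismatch k≢i k≢j)))

·-congʳ : (w : Permutation′ n) {u v : Permutation′ n} → u ≈ₚ v → w · u ≈ₚ w · v
·-congʳ w u≈v i = cong (w ⟨$⟩ʳ_) (u≈v i)

·-congˡ : {u v : Permutation′ n} (w : Permutation′ n) → u ≈ₚ v → u · w ≈ₚ v · w
·-congˡ w u≈v i = u≈v (w ⟨$⟩ʳ i)

·-transpose-involutive : (w : Permutation′ n) (i j : Fin n) → w · transpose i j · transpose i j ≈ₚ w
·-transpose-involutive w i j k = cong (w ⟨$⟩ʳ_) (transpose-involutive i j k)

-- Length

δ : Fin n → Fin n → ℤ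
δ i j = 𝟙 (i ≟ j)

δ-refl : (i : Fin n) → δ i i ≡ 1ℤ
δ-refl i = 𝟙-yes (i ≟ i) refl

δ-≢ : {i j : Fin n} → i ≢ j → δ i j ≡ 0ℤ
δ-≢ {i = i} {j} = 𝟙-no (i ≟ j)

sum-δ : (k : Fin n) (f : Fin n → ℤ) → ∑[ i < n ] (δ i k ℤ.* f i) ≡ f k
sum-δ {n} k f = trans
  (sum-single (λ i → δ i k ℤ.* f i) k λ i i≢k → cong (ℤ._* f i) (δ-≢ i≢k))
  (trans (cong (ℤ._* f k) (δ-refl k)) (ℤ.*-identityˡ (f k)))

-- A sum over all ordered pairs, unlike the list of inversions, can be reindexed by a permutation of
-- the positions, and values in ℤ allow negative corrections.
ℓ-as-sum : (w : Permutation′ n) →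
  ℤ.+ ℓ w ≡ ∑[ a < n ] ∑[ b < n ] (𝟙 (a <ᶠ? b) ℤ.* 𝟙 ((w ⟨$⟩ʳ b) <ᶠ? (w ⟨$⟩ʳ a)))
ℓ-as-sum {n} w = begin
  ℤ.+ ℓ w
    ≡⟨ length-sumᴸ (filter inv? (pairs n)) ⟩
  sumᴸ (filter inv? (pairs n)) (λ _ → 1ℤ)
    ≡⟨ sumᴸ-filter inv? (pairs n) (λ _ → 1ℤ) ⟩
  sumᴸ (pairs n) (λ p → 𝟙 (inv? p) ℤ.* 1ℤ)
    ≡⟨ sumᴸ-cong (pairs n) (λ p → ℤ.*-identityʳ (𝟙 (inv? p))) ⟩
  sumᴸ (pairs n) (λ p → 𝟙 (inv? p))
    ≡⟨ sumᴸ-pairs (λ p → 𝟙 (inv? p)) ⟩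
  ∑[ a < n ] ∑[ b < n ] (𝟙 (a <ᶠ? b) ℤ.* 𝟙 ((w ⟨$⟩ʳ b) <ᶠ? (w ⟨$⟩ʳ a))) ∎
  where
  open ≡-Reasoning
  inv? : Decidable (λ ((a , b) : Fin n × Fin n) → (w ⟨$⟩ʳ b) <ᶠ (w ⟨$⟩ʳ a))
  inv? (a , b) = (w ⟨$⟩ʳ b) <ᶠ? (w ⟨$⟩ʳ a)

ℓ-cong : {u v : Permutation′ n} → u ≈ₚ v → ℓ u ≡ ℓ v
ℓ-cong {n} {u} {v} u≈v = ℤ.+-injective $ trans (ℓ-as-sum u) $ trans
  (sum-cong-≗ λ a → sum-cong-≗ λ b →
    cong₂ (λ x y → 𝟙 (a <ᶠ? b) ℤ.* 𝟙 (x <ᶠ? y)) (u≈v b) (u≈v a))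
  (sym (ℓ-as-sum v))

-- The exchange of two neighbours k, l reverses the order of no other pair.
simple-order : {k l : Fin n} → Consecutive k l → (a b : Fin n) →
  𝟙 ((transpose k l ⟨$⟩ʳ a) <ᶠ? (transpose k l ⟨$⟩ʳ b))
    ≡ 𝟙 (a <ᶠ? b) ℤ.+ (δ a l ℤ.* δ b k ℤ.- δ a k ℤ.* δ b l)
simple-order {n} {k} {l} k⋖l a b = go (a ≟ k) (a ≟ l) (b ≟ k) (b ≟ l)
  where
  s = transpose k l
  k<l : k <ᶠ l
  k<l = ℕ.≤-reflexive (sym k⋖l)
  k≢l : k ≢ l
  k≢l refl = ℕ.<-irrefl refl k<l
  <k⇒<l : {c : Fin n} → c <ᶠ k → c <ᶠ l
  <k⇒<l c<k = ℕ.<-trans c<k k<l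
  <l⇒<k : {c : Fin n} → c ≢ k → c <ᶠ l → c <ᶠ k
  <l⇒<k c≢k c<l = ℕ.≤∧≢⇒< (ℕ.s≤s⁻¹ (subst (suc _ ≤_) k⋖l c<l)) (c≢k ∘ toℕ-injective)
  l<⇒k< : {c : Fin n} → l <ᶠ c → k <ᶠ c
  l<⇒k< = ℕ.<-trans k<l
  k<⇒l< : {c : Fin n} → c ≢ l → k <ᶠ c → l <ᶠ c
  k<⇒l< c≢l k<c = ℕ.≤∧≢⇒< (subst (_≤ _) (sym k⋖l) k<c) (c≢l ∘ sym ∘ toℕ-injective)
  Goal : Fin n → Fin n → ℤ → Set
  Goal a b e = 𝟙 ((s ⟨$⟩ʳ a) <ᶠ? (s ⟨$⟩ʳ b)) ≡ 𝟙 (a <ᶠ? b) ℤ.+ e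
  same : {a b a′ b′ : Fin n} → s ⟨$⟩ʳ a ≡ a′ → s ⟨$⟩ʳ b ≡ b′ →
         (a′ <ᶠ b′ → a <ᶠ b) → (a <ᶠ b → a′ <ᶠ b′) → Goal a b 0ℤ
  same {a} {b} {a′} {b′} sa≡ sb≡ to from = trans (cong₂ (λ x y → 𝟙 (x <ᶠ? y)) sa≡ sb≡)
    (trans (𝟙-cong (a′ <ᶠ? b′) (a <ᶠ? b) to from) (sym (ℤ.+-identityʳ _)))
  sk = transpose-matchˡ k l
  sl = transpose-matchʳ k l
  go : Dec (a ≡ k) → Dec (a ≡ l) → Dec (b ≡ k) → Dec (b ≡ l) → Goal a b (δ a l ℤ.* δ b k ℤ.- δ a k ℤ.* δ b l)
  go (yes refl) (yes k≡l) _ _ = contradiction k≡l k≢l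
  go _ _ (yes refl) (yes k≡l) = contradiction k≡l k≢l
  go (yes refl) (no a≢l) (yes refl) (no b≢l)
    rewrite δ-≢ a≢l | δ-refl k = same {a} {a} refl refl (contradiction refl ∘ ℕ.<⇒≢) (contradiction refl ∘ ℕ.<⇒≢)
  go (yes refl) (no a≢l) (no b≢k) (yes refl)
    rewrite δ-≢ a≢l | δ-refl k | δ-refl l | sk | sl
          | 𝟙-no (l <ᶠ? k) (ℕ.<-asym k<l) | 𝟙-yes (k <ᶠ? l) k<l = refl
  go (yes refl) (no a≢l) (no b≢k) (no b≢l)
    rewrite δ-≢ a≢l | δ-≢ b≢l | δ-refl k = same sk (transpose-mismatch b≢k b≢l) l<⇒k< (k<⇒l< b≢l)
  go (no a≢k) (yes refl) (yes refl) (no b≢l)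
    rewrite δ-≢ a≢k | δ-refl k | δ-refl l | sk | sl
          | 𝟙-no (l <ᶠ? k) (ℕ.<-asym k<l) | 𝟙-yes (k <ᶠ? l) k<l = refl
  go (no a≢k) (yes refl) (no b≢k) (yes refl)
    rewrite δ-≢ a≢k | δ-refl l = same {a} {a} refl refl (contradiction refl ∘ ℕ.<⇒≢) (contradiction refl ∘ ℕ.<⇒≢)
  go (no a≢k) (yes refl) (no b≢k) (no b≢l)
    rewrite δ-≢ a≢k | δ-≢ b≢k | δ-refl l = same sl (transpose-mismatch b≢k b≢l) (k<⇒l< b≢l) l<⇒k<
  go (no a≢k) (no a≢l) (yes refl) (no b≢l)
    rewrite δ-≢ a≢k | δ-≢ a≢l = same (transpose-mismatch a≢k a≢l) sk (<l⇒<k a≢k) <k⇒<l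
  go (no a≢k) (no a≢l) (no b≢k) (yes refl)
    rewrite δ-≢ a≢k | δ-≢ a≢l = same (transpose-mismatch a≢k a≢l) sl <k⇒<l (<l⇒<k a≢k)
  go (no a≢k) (no a≢l) (no b≢k) (no b≢l)
    rewrite δ-≢ a≢k | δ-≢ a≢l = same (transpose-mismatch a≢k a≢l) (transpose-mismatch b≢k b≢l) (λ p → p) (λ p → p)

ℓ-simple : (w : Permutation′ n) {k l : Fin n} → Consecutive k l →
  ℤ.+ ℓ (w · transpose k l)
    ≡ ℤ.+ ℓ w ℤ.+ (𝟙 ((w ⟨$⟩ʳ k) <ᶠ? (w ⟨$⟩ʳ l)) ℤ.- 𝟙 ((w ⟨$⟩ʳ l) <ᶠ? (w ⟨$⟩ʳ k)))
ℓ-simple {n} w {k} {l} k⋖l = begin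
  ℤ.+ ℓ (w · s)
    ≡⟨ ℓ-as-sum (w · s) ⟩
  ∑[ a < n ] ∑[ b < n ] (𝟙 (a <ᶠ? b) ℤ.* inv (s ⟨$⟩ʳ a) (s ⟨$⟩ʳ b))
    -- Replacing a by s(s a) and b by s(s b) makes the summand a function of (s a, s b), so that
    -- both sums can be reindexed by s. The order test then falls on (s a, s b), where
    -- `simple-order` applies.
    ≡⟨ sum-cong-≗ (λ a → sum-cong-≗ λ b → cong₂ (λ x y → 𝟙 (x <ᶠ? y) ℤ.* inv (s ⟨$⟩ʳ a) (s ⟨$⟩ʳ b))
         (sym (transpose-involutive k l a)) (sym (transpose-involutive k l b))) ⟩
  ∑[ a < n ] ∑[ b < n ] F (s ⟨$⟩ʳ a) (s ⟨$⟩ʳ b)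
    ≡⟨ sum-cong-≗ (λ a → ∑-permute (F (s ⟨$⟩ʳ a)) s) ⟨
  ∑[ a < n ] ∑[ b < n ] F (s ⟨$⟩ʳ a) b
    ≡⟨ ∑-permute (λ a → ∑[ b < n ] F a b) s ⟨
  ∑[ a < n ] ∑[ b < n ] F a b
    ≡⟨ sum-cong-≗ (λ a → sum-cong-≗ λ b → trans (cong (ℤ._* inv a b) (simple-order k⋖l a b))
         (expand (𝟙 (a <ᶠ? b)) (δ a l) (δ b k) (δ a k) (δ b l) (inv a b))) ⟩
  ∑[ a < n ] ∑[ b < n ] (𝟙 (a <ᶠ? b) ℤ.* inv a b ℤ.+
                         (δ b k ℤ.* (δ a l ℤ.* inv a b) ℤ.- δ b l ℤ.* (δ a k ℤ.* inv a b)))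
    ≡⟨ sum-cong-≗ (λ a → trans (∑-distrib-+ (λ b → 𝟙 (a <ᶠ? b) ℤ.* inv a b) _)
         (cong (ℤ._+_ (∑[ b < n ] (𝟙 (a <ᶠ? b) ℤ.* inv a b)))
           (trans (sum-sub (λ b → δ b k ℤ.* (δ a l ℤ.* inv a b)) _)
             (cong₂ ℤ._-_ (sum-δ k (λ b → δ a l ℤ.* inv a b)) (sum-δ l (λ b → δ a k ℤ.* inv a b)))))) ⟩
  ∑[ a < n ] (∑[ b < n ] (𝟙 (a <ᶠ? b) ℤ.* inv a b) ℤ.+ (δ a l ℤ.* inv a k ℤ.- δ a k ℤ.* inv a l))
    ≡⟨ trans (∑-distrib-+ (λ a → ∑[ b < n ] (𝟙 (a <ᶠ? b) ℤ.* inv a b)) _)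
         (cong₂ ℤ._+_ (sym (ℓ-as-sum w))
           (trans (sum-sub (λ a → δ a l ℤ.* inv a k) _)
             (cong₂ ℤ._-_ (sum-δ l (λ a → inv a k)) (sum-δ k (λ a → inv a l))))) ⟩
  ℤ.+ ℓ w ℤ.+ (inv l k ℤ.- inv k l) ∎
  where
  open ≡-Reasoning
  s = transpose k l
  inv : Fin n → Fin n → ℤ
  inv a b = 𝟙 ((w ⟨$⟩ʳ b) <ᶠ? (w ⟨$⟩ʳ a))
  F : Fin n → Fin n → ℤ
  F a b = 𝟙 ((s ⟨$⟩ʳ a) <ᶠ? (s ⟨$⟩ʳ b)) ℤ.* inv a b
  expand : ∀ p al bk ak bl x → (p ℤ.+ (al ℤ.* bk ℤ.- ak ℤ.* bl)) ℤ.* x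
         ≡ p ℤ.* x ℤ.+ (bk ℤ.* (al ℤ.* x) ℤ.- bl ℤ.* (ak ℤ.* x))
  expand = solve-∀

ℓ-simple-up : (w : Permutation′ n) {k l : Fin n} → Consecutive k l →
  (w ⟨$⟩ʳ k) <ᶠ (w ⟨$⟩ʳ l) → ℓ (w · transpose k l) ≡ suc (ℓ w)
ℓ-simple-up w {k} {l} k⋖l wk<wl = ℤ.+-injective $ begin
  ℤ.+ ℓ (w · transpose k l)
    ≡⟨ ℓ-simple w k⋖l ⟩
  ℤ.+ ℓ w ℤ.+ (𝟙 ((w ⟨$⟩ʳ k) <ᶠ? (w ⟨$⟩ʳ l)) ℤ.- 𝟙 ((w ⟨$⟩ʳ l) <ᶠ? (w ⟨$⟩ʳ k)))
    ≡⟨ cong₂ (λ x y → ℤ.+ ℓ w ℤ.+ (x ℤ.- y)) (𝟙-yes (_ <ᶠ? _) wk<wl) (𝟙-no (_ <ᶠ? _) (ℕ.<-asym wk<wl)) ⟩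
  ℤ.+ ℓ w ℤ.+ 1ℤ
    ≡⟨ ℤ.+-comm (ℤ.+ ℓ w) 1ℤ ⟩
  ℤ.+ suc (ℓ w) ∎
  where open ≡-Reasoning

ℓ-simple-down : (w : Permutation′ n) {k l : Fin n} → Consecutive k l →
  (w ⟨$⟩ʳ l) <ᶠ (w ⟨$⟩ʳ k) → suc (ℓ (w · transpose k l)) ≡ ℓ w
ℓ-simple-down w {k} {l} k⋖l wl<wk = trans
  (sym (ℓ-simple-up (w · transpose k l) k⋖l
    (subst₂ _<ᶠ_ (cong (w ⟨$⟩ʳ_) (sym (transpose-matchˡ k l)))
                 (cong (w ⟨$⟩ʳ_) (sym (transpose-matchʳ k l))) wl<wk)))
  (ℓ-cong {u = w · transpose k l · transpose k l} {v = w} (·-transpose-involutive w k l))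

ℓ-simple-≤ : (w : Permutation′ n) {k l : Fin n} → Consecutive k l → ℓ (w · transpose k l) ≤ suc (ℓ w)
ℓ-simple-≤ w {k} {l} k⋖l with <-cmp (w ⟨$⟩ʳ k) (w ⟨$⟩ʳ l)
... | tri< wk<wl _ _ = ℕ.≤-reflexive (ℓ-simple-up w k⋖l wk<wl)
... | tri> _ _ wl<wk = ℕ.m≤n⇒m≤1+n (ℕ.<⇒≤ (ℕ.≤-reflexive (ℓ-simple-down w k⋖l wl<wk)))
... | tri≈ _ wk≡wl _ = contradiction (cong toℕ (injective w wk≡wl)) (ℕ.<⇒≢ (ℕ.≤-reflexive (sym k⋖l)))

-- Length under an arbitrary transposition

distance : {i j : Fin n} → i <ᶠ j → ∃ λ d → toℕ j ≡ suc (d ℕ.+ toℕ i)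
distance {i = i} {j} i<j = toℕ j ∸ suc (toℕ i) ,
  trans (sym (ℕ.m∸n+n≡m i<j)) (ℕ.+-suc (toℕ j ∸ suc (toℕ i)) (toℕ i))

successor : {d : ℕ} (i : Fin n) {j : Fin n} → toℕ j ≡ suc (suc d ℕ.+ toℕ i) →
            ∃ λ i′ → Consecutive i i′ × toℕ j ≡ suc (d ℕ.+ toℕ i′)
successor {d = d} i {j} j≡ = fromℕ< i+1<n , i′≡ , trans j≡
  (cong suc (trans (sym (ℕ.+-suc d (toℕ i))) (cong (d ℕ.+_) (sym i′≡))))
  where
  i+1<n = ℕ.≤-<-trans (subst (suc (toℕ i) ≤_) (sym j≡) (s≤s (ℕ.m≤n+m (toℕ i) _))) (Fin.toℕ<n j)
  i′≡ = Fin.toℕ-fromℕ< i+1<n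

-- An exchange at distance d + 2 is a neighbour exchange s, an exchange t′ at distance d + 1, and s again.
module Conjugation (w : Permutation′ n) {i i′ j : Fin n} (i⋖i′ : Consecutive i i′) (i′<j : i′ <ᶠ j) where

  i<i′ : i <ᶠ i′
  i<i′ = ℕ.≤-reflexive (sym i⋖i′)

  private
    s = transpose i i′
    j≢i : j ≢ i
    j≢i refl = ℕ.<-asym i<i′ i′<j
    j≢i′ : j ≢ i′
    j≢i′ refl = ℕ.<-irrefl refl i′<j
    i≢i′ : i ≢ i′
    i≢i′ refl = ℕ.<-irrefl refl i<i′
    sj : s ⟨$⟩ʳ j ≡ j
    sj = transpose-mismatch j≢i j≢i′

  ws w′ : Permutation′ n
  ws = w · s
  w′ = ws · transpose i′ j

  ws-i′ : ws ⟨$⟩ʳ i′ ≡ w ⟨$⟩ʳ i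
  ws-i′ = cong (w ⟨$⟩ʳ_) (transpose-matchʳ i i′)

  ws-j : ws ⟨$⟩ʳ j ≡ w ⟨$⟩ʳ j
  ws-j = cong (w ⟨$⟩ʳ_) sj

  w′-i : w′ ⟨$⟩ʳ i ≡ w ⟨$⟩ʳ i′
  w′-i = trans (cong (ws ⟨$⟩ʳ_) (transpose-mismatch i≢i′ (≢-sym j≢i))) (cong (w ⟨$⟩ʳ_) (transpose-matchˡ i i′))

  w′-i′ : w′ ⟨$⟩ʳ i′ ≡ w ⟨$⟩ʳ j
  w′-i′ = trans (cong (ws ⟨$⟩ʳ_) (transpose-matchˡ i′ j)) ws-j

  conjugate : ℓ (w · transpose i j) ≡ ℓ (w′ · s)
  conjugate = ℓ-cong {u = w · transpose i j} {v = w′ · s} λ m → cong (w ⟨$⟩ʳ_) (sym (begin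
    s ⟨$⟩ʳ (transpose i′ j ⟨$⟩ʳ (s ⟨$⟩ʳ m))
      ≡⟨ conjugate-transpose s i′ j (s ⟨$⟩ʳ m) ⟩
    transpose (s ⟨$⟩ʳ i′) (s ⟨$⟩ʳ j) ⟨$⟩ʳ (s ⟨$⟩ʳ (s ⟨$⟩ʳ m))
      ≡⟨ cong₂ (λ a b → transpose a b ⟨$⟩ʳ (s ⟨$⟩ʳ (s ⟨$⟩ʳ m))) (transpose-matchʳ i i′) sj ⟩
    transpose i j ⟨$⟩ʳ (s ⟨$⟩ʳ (s ⟨$⟩ʳ m))
      ≡⟨ cong (transpose i j ⟨$⟩ʳ_) (transpose-involutive i i′ m) ⟩
    transpose i j ⟨$⟩ʳ m ∎))
    where open ≡-Reasoning

  up-down : (w ⟨$⟩ʳ j) <ᶠ (w ⟨$⟩ʳ i′) → suc (ℓ (w · transpose i j)) ≡ ℓ w′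
  up-down p = trans (cong suc conjugate) (ℓ-simple-down w′ i⋖i′ (subst₂ _<ᶠ_ (sym w′-i′) (sym w′-i) p))

  down-up : (w ⟨$⟩ʳ i′) <ᶠ (w ⟨$⟩ʳ j) → ℓ (w · transpose i j) ≡ suc (ℓ w′)
  down-up p = trans conjugate (ℓ-simple-up w′ i⋖i′ (subst₂ _<ᶠ_ (sym w′-i) (sym w′-i′) p))

-- Induction on j - i. If w(i) < w(i′), the first s raises the length by one and the last s lowers
-- it by one. Otherwise the first s lowers it by one, and the last s regains at most that much.
ℓ-drop : (w : Permutation′ n) {i j : Fin n} → i <ᶠ j → (w ⟨$⟩ʳ j) <ᶠ (w ⟨$⟩ʳ i) →
         ℓ (w · transpose i j) ℕ.< ℓ w
ℓ-drop {n} w {i} {j} i<j = go _ w i (proj₂ (distance i<j))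
  where
  go : ∀ d (w : Permutation′ n) i → toℕ j ≡ suc (d ℕ.+ toℕ i) → (w ⟨$⟩ʳ j) <ᶠ (w ⟨$⟩ʳ i) →
       ℓ (w · transpose i j) ℕ.< ℓ w
  go zero    w i j≡ wj<wi = ℕ.≤-reflexive (ℓ-simple-down w j≡ wj<wi)
  go (suc d) w i j≡ wj<wi with successor i j≡
  ... | i′ , i⋖i′ , j≡′ with ih ← go d (w · transpose i i′) i′ j≡′
                          | <-cmp (w ⟨$⟩ʳ i) (w ⟨$⟩ʳ i′)
  ... | tri≈ _ wi≡wi′ _ = contradiction (cong toℕ (injective w wi≡wi′)) (ℕ.<⇒≢ (ℕ.≤-reflexive (sym i⋖i′)))
  ... | tri< wi<wi′ _ _ = ℕ.s≤s⁻¹ (ℕ.≤-trans (s≤s (ℕ.≤-reflexive (up-down (ℕ.<-trans wj<wi wi<wi′))))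
          (subst (ℓ w′ ℕ.<_) (ℓ-simple-up w i⋖i′ wi<wi′) (ih (subst₂ _<ᶠ_ (sym ws-j) (sym ws-i′) wj<wi))))
    where open Conjugation w i⋖i′ (subst (toℕ i′ ℕ.<_) (sym j≡′) (s≤s (ℕ.m≤n+m _ d)))
  ... | tri> _ _ wi′<wi = begin-strict
          ℓ (w · transpose i j)        ≡⟨ conjugate ⟩
          ℓ (w′ · transpose i i′)      ≤⟨ ℓ-simple-≤ w′ i⋖i′ ⟩
          suc (ℓ w′)                   ≤⟨ ih (subst₂ _<ᶠ_ (sym ws-j) (sym ws-i′) wj<wi) ⟩
          ℓ ws                         <⟨ ℕ.≤-reflexive (ℓ-simple-down w i⋖i′ wi′<wi) ⟩
          ℓ w                          ∎
    where
    open ℕ.≤-Reasoning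
    open Conjugation w i⋖i′ (subst (toℕ i′ ℕ.<_) (sym j≡′) (s≤s (ℕ.m≤n+m _ d)))

-- No position holds a value strictly between w(j) and w(i), so the exchange is a cover. This
-- provides the one surviving term in `between-step`.
ℓ-drop-adjacent : (w : Permutation′ n) {i j : Fin n} → i <ᶠ j → toℕ (w ⟨$⟩ʳ i) ≡ suc (toℕ (w ⟨$⟩ʳ j)) →
                  suc (ℓ (w · transpose i j)) ≡ ℓ w
ℓ-drop-adjacent {n} w {i} {j} i<j = go _ w i (proj₂ (distance i<j))
  where
  go : ∀ d (w : Permutation′ n) i → toℕ j ≡ suc (d ℕ.+ toℕ i) → toℕ (w ⟨$⟩ʳ i) ≡ suc (toℕ (w ⟨$⟩ʳ j)) →
       suc (ℓ (w · transpose i j)) ≡ ℓ w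
  go zero    w i j≡ wi≡ = ℓ-simple-down w j≡ (ℕ.≤-reflexive (sym wi≡))
  go (suc d) w i j≡ wi≡ with successor i j≡
  ... | i′ , i⋖i′ , j≡′ with ih ← go d (w · transpose i i′) i′ j≡′
                          | <-cmp (w ⟨$⟩ʳ i) (w ⟨$⟩ʳ i′)
  ... | tri≈ _ wi≡wi′ _ = contradiction (cong toℕ (injective w wi≡wi′)) (ℕ.<⇒≢ (ℕ.≤-reflexive (sym i⋖i′)))
  ... | tri< wi<wi′ _ _ = ℕ.suc-injective (trans (cong suc (up-down (ℕ.<-trans (ℕ.≤-reflexive (sym wi≡)) wi<wi′)))
          (trans (ih (trans (cong toℕ ws-i′) (trans wi≡ (cong (suc ∘ toℕ) (sym ws-j))))) (ℓ-simple-up w i⋖i′ wi<wi′)))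
    where open Conjugation w i⋖i′ (subst (toℕ i′ ℕ.<_) (sym j≡′) (s≤s (ℕ.m≤n+m _ d)))
  ... | tri> _ _ wi′<wi = begin
          suc (ℓ (w · transpose i j))  ≡⟨ cong suc (down-up wi′<wj) ⟩
          suc (suc (ℓ w′))             ≡⟨ cong suc (ih (trans (cong toℕ ws-i′) (trans wi≡ (cong (suc ∘ toℕ) (sym ws-j))))) ⟩
          suc (ℓ ws)                   ≡⟨ ℓ-simple-down w i⋖i′ wi′<wi ⟩
          ℓ w                          ∎
    where
    open ≡-Reasoning
    i′<j = subst (toℕ i′ ℕ.<_) (sym j≡′) (s≤s (ℕ.m≤n+m _ d))
    open Conjugation w i⋖i′ i′<j
    -- Adjacency enters here: w(i′) is below w(i) = w(j) + 1 and differs from w(j), so it lies below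
    -- w(j). Hence the last s raises the length again, exactly undoing the first.
    wi′<wj : (w ⟨$⟩ʳ i′) <ᶠ (w ⟨$⟩ʳ j)
    wi′<wj = ℕ.≤∧≢⇒< (ℕ.s≤s⁻¹ (subst (toℕ (w ⟨$⟩ʳ i′) ℕ.<_) wi≡ wi′<wi))
                     (ℕ.<⇒≢ i′<j ∘ cong toℕ ∘ injective w ∘ toℕ-injective)

ℓ-rise : (w : Permutation′ n) {i j : Fin n} → i <ᶠ j → (w ⟨$⟩ʳ i) <ᶠ (w ⟨$⟩ʳ j) →
         ℓ w ℕ.< ℓ (w · transpose i j)
ℓ-rise w {i} {j} i<j wi<wj = subst (ℕ._< ℓ (w · transpose i j))
  (ℓ-cong {u = w · transpose i j · transpose i j} {v = w} (·-transpose-involutive w i j))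
  (ℓ-drop (w · transpose i j) i<j
    (subst₂ _<ᶠ_ (cong (w ⟨$⟩ʳ_) (sym (transpose-matchʳ i j))) (cong (w ⟨$⟩ʳ_) (sym (transpose-matchˡ i j))) wi<wj))

-- Permutations and their descents

increasing-≥ : (f : Fin n → Fin n) → (∀ {i j} → i <ᶠ j → f i <ᶠ f j) → ∀ i → toℕ i ≤ toℕ (f i)
increasing-≥ {n} f f< i = go (toℕ i) i refl
  where
  go : ∀ m (i : Fin n) → toℕ i ≡ m → m ≤ toℕ (f i)
  go zero    i i≡ = z≤n
  go (suc m) i i≡ = ℕ.≤-<-trans (go m i₋ i₋≡) (f< (subst₂ ℕ._<_ (sym i₋≡) (sym i≡) ℕ.≤-refl))
    where
    m<n = ℕ.<-trans (ℕ.n<1+n m) (subst (ℕ._< n) i≡ (Fin.toℕ<n i))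
    i₋  = fromℕ< m<n
    i₋≡ = Fin.toℕ-fromℕ< m<n

-- The inverse is increasing as well, and i ≤ f(i) is applied to both w and its inverse.
increasing⇒id : (w : Permutation′ n) → (∀ {i j} → i <ᶠ j → (w ⟨$⟩ʳ i) <ᶠ (w ⟨$⟩ʳ j)) → w ≈ₚ idₚ
increasing⇒id {n} w w< i = toℕ-injective (ℕ.≤-antisym
  (subst (toℕ (w ⟨$⟩ʳ i) ≤_) (cong toℕ (inverseˡ w)) (increasing-≥ (w ⟨$⟩ˡ_) w⁻¹< (w ⟨$⟩ʳ i)))
  (increasing-≥ (w ⟨$⟩ʳ_) w< i))
  where
  w⁻¹< : ∀ {i j} → i <ᶠ j → (w ⟨$⟩ˡ i) <ᶠ (w ⟨$⟩ˡ j)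
  w⁻¹< {i} {j} i<j with <-cmp (w ⟨$⟩ˡ i) (w ⟨$⟩ˡ j)
  ... | tri< p _ _ = p
  ... | tri≈ _ p _ = contradiction (cong toℕ (trans (sym (inverseʳ w)) (trans (cong (w ⟨$⟩ʳ_) p) (inverseʳ w)))) (ℕ.<⇒≢ i<j)
  ... | tri> _ _ p = contradiction (subst₂ _<ᶠ_ (inverseʳ w) (inverseʳ w) (w< p)) (ℕ.<-asym i<j)

Inversion : Permutation′ n → Fin n → Fin n → Set
Inversion w i j = (i <ᶠ j) × ((w ⟨$⟩ʳ j) <ᶠ (w ⟨$⟩ʳ i))

no-inversion⇒id : (w : Permutation′ n) → (∀ i j → ¬ Inversion w i j) → w ≈ₚ idₚ
no-inversion⇒id w none = increasing⇒id w λ {i} {j} i<j → case i<j (<-cmp (w ⟨$⟩ʳ i) (w ⟨$⟩ʳ j))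
  where
  case : ∀ {i j} → i <ᶠ j → Tri ((w ⟨$⟩ʳ i) <ᶠ (w ⟨$⟩ʳ j)) ((w ⟨$⟩ʳ i) ≡ (w ⟨$⟩ʳ j)) ((w ⟨$⟩ʳ j) <ᶠ (w ⟨$⟩ʳ i)) →
         (w ⟨$⟩ʳ i) <ᶠ (w ⟨$⟩ʳ j)
  case i<j (tri< p _ _) = p
  case i<j (tri≈ _ p _) = contradiction (cong toℕ (injective w p)) (ℕ.<⇒≢ i<j)
  case i<j (tri> _ _ p) = contradiction (i<j , p) (none _ _)

-- Walking from i to j through neighbours, the value must drop at some step.
inversion⇒descent : (w : Permutation′ n) {i j : Fin n} → Inversion w i j →
  ∃₂ λ k l → Consecutive k l × (w ⟨$⟩ʳ l) <ᶠ (w ⟨$⟩ʳ k)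
inversion⇒descent {n} w {i} {j} (i<j , wj<wi) = go _ i (proj₂ (distance i<j)) wj<wi
  where
  go : ∀ d i → toℕ j ≡ suc (d ℕ.+ toℕ i) → (w ⟨$⟩ʳ j) <ᶠ (w ⟨$⟩ʳ i) →
       ∃₂ λ k l → Consecutive k l × (w ⟨$⟩ʳ l) <ᶠ (w ⟨$⟩ʳ k)
  go zero    i j≡ wj<wi = i , j , j≡ , wj<wi
  go (suc d) i j≡ wj<wi with successor i j≡
  ... | i′ , i⋖i′ , j≡′ with (w ⟨$⟩ʳ i′) <ᶠ? (w ⟨$⟩ʳ i)
  ...   | yes p = i , i′ , i⋖i′ , p
  ...   | no ¬p = go d i′ j≡′ (ℕ.<-≤-trans wj<wi (ℕ.≮⇒≥ ¬p))

-- The step goes upwards, from w to a longer ws, because the twisted operator τ of the covering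
-- action has weight 1 at such w and there computes values at ws. `P-resp` is required since
-- permutations are identified only pointwise.
ascent-induction : (P : Permutation′ n → Set) →
  (∀ {u v} → u ≈ₚ v → P u → P v) →
  P idₚ →
  (∀ w {k l} → Consecutive k l → (w ⟨$⟩ʳ k) <ᶠ (w ⟨$⟩ʳ l) → P w → P (w · transpose k l)) →
  ∀ w → P w
ascent-induction {n} P P-resp P-id P-step w = go (suc (ℓ w)) w ℕ.≤-refl
  where
  go : ∀ m w → ℓ w ℕ.< m → P w
  go (suc m) w (s≤s ℓw≤m) with any? (λ i → any? (λ j → (i <ᶠ? j) ×-dec ((w ⟨$⟩ʳ j) <ᶠ? (w ⟨$⟩ʳ i))))
  ... | no none = P-resp {idₚ} {w} (λ i → sym (w≈id i)) P-id
    where w≈id = no-inversion⇒id w λ i j inv → none (i , j , inv)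
  ... | yes (i , j , inv) with inversion⇒descent w inv
  ...   | k , l , k⋖l , wl<wk = P-resp {w · transpose k l · transpose k l} {w} (·-transpose-involutive w k l)
            (P-step (w · transpose k l) k⋖l
              (subst₂ _<ᶠ_ (cong (w ⟨$⟩ʳ_) (sym (transpose-matchˡ k l))) (cong (w ⟨$⟩ʳ_) (sym (transpose-matchʳ k l))) wl<wk)
              (go m (w · transpose k l) (subst (_≤ m) (sym (ℓ-simple-down w k⋖l wl<wk)) ℓw≤m)))

opposite-antitone : {i j : Fin n} → i <ᶠ j → opposite j <ᶠ opposite i
opposite-antitone {i = i} {j} i<j = subst₂ ℕ._<_ (sym (Fin.opposite-prop j)) (sym (Fin.opposite-prop i))
  (ℕ.∸-monoʳ-< (s≤s i<j) (Fin.toℕ<n j))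

-- Every pair is an inversion of `reverse`. If every pair is also an inversion of w, then
-- `reverse · w` is increasing, hence the identity, and w is `reverse`.
ℓ<ℓ-reverse : (w : Permutation′ n) → ¬ w ≈ₚ reverse → ℓ w ℕ.< ℓ {n} reverse
ℓ<ℓ-reverse {n} w w≉ = subst (ℓ w ℕ.<_)
  (cong length (sym (List.filter-all (inv? reverse) (All.map opposite-antitone ordered))))
  (List.filter-notAll (inv? w) (pairs n) (¬All⇒Any¬ (inv? w) (pairs n) (w≉ ∘ reversed)))
  where
  Inv : Permutation′ n → Fin n × Fin n → Set
  Inv u (a , b) = (u ⟨$⟩ʳ b) <ᶠ (u ⟨$⟩ʳ a)
  inv? : (u : Permutation′ n) → Decidable (Inv u)
  inv? u (a , b) = (u ⟨$⟩ʳ b) <ᶠ? (u ⟨$⟩ʳ a)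
  ordered : All (uncurry _<ᶠ_) (pairs n)
  ordered = all-filter (uncurry _<ᶠ?_) (cartesianProduct (allFin n) (allFin n))
  reversed : All (Inv w) (pairs n) → w ≈ₚ reverse
  reversed all i = trans (sym (Fin.opposite-involutive (w ⟨$⟩ʳ i))) (cong opposite
    (increasing⇒id (reverse · w) (λ {a} {b} a<b → opposite-antitone (All.lookup all
      (∈-filter⁺ (uncurry _<ᶠ?_) (∈-cartesianProduct⁺ (∈-allFin a) (∈-allFin b)) a<b))) i))

-- Functions on S_n and the action of terms dual to the Bruhat action

record Functional (n : ℕ) : Set where
  field
    eval : Permutation′ n → ℤ
    resp : ∀ {u v} → u ≈ₚ v → eval u ≡ eval v

open Functional

infix 4 _≗_
_≗_ : Functional n → Functional n → Set
φ ≗ φ′ = ∀ w → eval φ w ≡ eval φ′ w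

_⊞_ : Functional n → Functional n → Functional n
φ ⊞ φ′ = record
  { eval = λ w → eval φ w ℤ.+ eval φ′ w
  ; resp = λ {u} {v} u≈v → cong₂ ℤ._+_ (resp φ {u} {v} u≈v) (resp φ′ {u} {v} u≈v)
  }

-- The sign of j - i. It absorbs the convention [ji] = -[ij] and the dummy value of `bracket i i`,
-- so that θ_i becomes a sum over all positions j.
sg : Fin n → Fin n → ℤ
sg i j = 𝟙 (i <ᶠ? j) ℤ.- 𝟙 (j <ᶠ? i)

sg-< : {i j : Fin n} → i <ᶠ j → sg i j ≡ 1ℤ
sg-< {i = i} {j} i<j = cong₂ ℤ._-_ (𝟙-yes (i <ᶠ? j) i<j) (𝟙-no (j <ᶠ? i) (ℕ.<-asym i<j))

sg-anti : (i j : Fin n) → sg j i ≡ ℤ.- sg i j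
sg-anti i j = anti (𝟙 (i <ᶠ? j)) (𝟙 (j <ᶠ? i))
  where
  anti : ∀ x y → y ℤ.- x ≡ ℤ.- (x ℤ.- y)
  anti = solve-∀

sg-> : {i j : Fin n} → j <ᶠ i → sg i j ≡ -1ℤ
sg-> {i = i} {j} j<i = trans (sg-anti j i) (cong ℤ.-_ (sg-< j<i))

sg-refl : (i : Fin n) → sg i i ≡ 0ℤ
sg-refl i = ℤ.+-inverseʳ (𝟙 (i <ᶠ? i))

-- The Bruhat action and the covering action differ only in the coefficient of the move from w to w
-- t_ij. The sign is kept apart in `sg`, so κ depends on the unordered pair, as `κ-sym` records.
record Kernel (n : ℕ) : Set where
  field
    κ      : Permutation′ n → Fin n → Fin n → ℤ
    κ-resp : ∀ {u v} → u ≈ₚ v → ∀ i j → κ u i j ≡ κ v i j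
    κ-sym  : ∀ w i j → κ w i j ≡ κ w j i

module Action (K : Kernel n) where

  open Kernel K

  infixr 6 _▷_

  -- This is the transpose of a right action on combinations: moving w by a and then by b, and
  -- evaluating φ, is evaluating `a ▷ (b ▷ φ)` at w.
  _▷_ : Term (Generator n) → Functional n → Functional n
  var (gen i j _) ▷ φ = record
    { eval = λ w → κ w i j ℤ.* eval φ (w · transpose i j)
    ; resp = λ {u} {v} u≈v → cong₂ ℤ._*_ (κ-resp {u} {v} u≈v i j)
               (resp φ {u · transpose i j} {v · transpose i j} (·-congˡ {u = u} {v} (transpose i j) u≈v))
    }
  0#      ▷ φ = record { eval = λ _ → 0ℤ ; resp = λ _ → refl }
  1#      ▷ φ = φ
  (a + b) ▷ φ = (a ▷ φ) ⊞ (b ▷ φ)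
  (a * b) ▷ φ = a ▷ (b ▷ φ)
  (- a)   ▷ φ = record
    { eval = λ w → ℤ.- eval (a ▷ φ) w
    ; resp = λ {u} {v} u≈v → cong ℤ.-_ (resp (a ▷ φ) {u} {v} u≈v)
    }

  ▷-cong : ∀ a {φ φ′} → φ ≗ φ′ → a ▷ φ ≗ a ▷ φ′
  ▷-cong (var (gen i j _)) φ≗ w = cong (ℤ._*_ (κ w i j)) (φ≗ (w · transpose i j))
  ▷-cong 0#      φ≗ w = refl
  ▷-cong 1#      φ≗ w = φ≗ w
  ▷-cong (a + b) φ≗ w = cong₂ ℤ._+_ (▷-cong a φ≗ w) (▷-cong b φ≗ w)
  ▷-cong (a * b) φ≗ w = ▷-cong a (▷-cong b φ≗) w
  ▷-cong (- a)   φ≗ w = cong ℤ.-_ (▷-cong a φ≗ w)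

  ▷-⊞ : ∀ a φ φ′ → a ▷ (φ ⊞ φ′) ≗ (a ▷ φ) ⊞ (a ▷ φ′)
  ▷-⊞ (var (gen i j _)) φ φ′ w = ℤ.*-distribˡ-+ (κ w i j) _ _
  ▷-⊞ 0#      φ φ′ w = refl
  ▷-⊞ 1#      φ φ′ w = refl
  ▷-⊞ (a + b) φ φ′ w = trans (cong₂ ℤ._+_ (▷-⊞ a φ φ′ w) (▷-⊞ b φ φ′ w))
    (interchange (eval (a ▷ φ) w) (eval (a ▷ φ′) w) (eval (b ▷ φ) w) (eval (b ▷ φ′) w))
  ▷-⊞ (a * b) φ φ′ w = trans (▷-cong a (▷-⊞ b φ φ′) w) (▷-⊞ a (b ▷ φ) (b ▷ φ′) w)
  ▷-⊞ (- a)   φ φ′ w = trans (cong ℤ.-_ (▷-⊞ a φ φ′ w)) (ℤ.neg-distrib-+ (eval (a ▷ φ) w) _)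

  -- The substitution σ lets one induction serve two presentations: σ = `var` for the relations of
  -- FK_n, and σ = `θ` for those of the polynomial ring.
  ▷-sound : {X : Set} {R : Term X → Term X → Set} (σ : X → Term (Generator n)) →
    (∀ {a b} → R a b → ∀ φ → substitute σ a ▷ φ ≗ substitute σ b ▷ φ) →
    ∀ {a b} → Congruence R a b → ∀ φ → substitute σ a ▷ φ ≗ substitute σ b ▷ φ
  ▷-sound {X} {R} σ R-sound = go
    where
    go : ∀ {a b} → Congruence R a b → ∀ φ → substitute σ a ▷ φ ≗ substitute σ b ▷ φ
    go (rel r) φ w = R-sound r φ w
    go Congruence.refl φ w = refl
    go (Congruence.sym p) φ w = sym (go p φ w)
    go (Congruence.trans p q) φ w = trans (go p φ w) (go q φ w)
    go (+-cong p q) φ w = cong₂ ℤ._+_ (go p φ w) (go q φ w)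
    go (*-cong {b = b} {c} p q) φ w = trans (go p (substitute σ c ▷ φ) w) (▷-cong (substitute σ b) (go q φ) w)
    go (neg-cong p) φ w = cong ℤ.-_ (go p φ w)
    go (+-assoc a b c) φ w = ℤ.+-assoc (eval (substitute σ a ▷ φ) w) _ _
    go (+-comm a b) φ w = ℤ.+-comm (eval (substitute σ a ▷ φ) w) _
    go (+-identityˡ a) φ w = ℤ.+-identityˡ _
    go (+-identityʳ a) φ w = ℤ.+-identityʳ _
    go (+-inverseˡ a) φ w = ℤ.+-inverseˡ (eval (substitute σ a ▷ φ) w)
    go (+-inverseʳ a) φ w = ℤ.+-inverseʳ (eval (substitute σ a ▷ φ) w)
    go (*-assoc a b c) φ w = refl
    go (*-identityˡ a) φ w = refl
    go (*-identityʳ a) φ w = refl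
    go (distribˡ a b c) φ w = ▷-⊞ (substitute σ a) (substitute σ b ▷ φ) (substitute σ c ▷ φ) w
    go (distribʳ a b c) φ w = refl

  bracket-▷ : ∀ i j φ w → eval (bracket i j ▷ φ) w ≡ sg i j ℤ.* κ w i j ℤ.* eval φ (w · transpose i j)
  bracket-▷ i j φ w with <-cmp i j
  ... | tri< i<j _ _ = cong (ℤ._* eval φ (w · transpose i j))
          (sym (trans (cong (ℤ._* κ w i j) (sg-< i<j)) (ℤ.*-identityˡ (κ w i j))))
  ... | tri≈ _ refl _ = sym (cong (λ c → c ℤ.* κ w i i ℤ.* eval φ (w · transpose i i)) (sg-refl i))
  ... | tri> _ _ j<i = begin
          ℤ.- (κ w j i ℤ.* eval φ (w · transpose j i))
            ≡⟨ cong₂ (λ x y → ℤ.- (x ℤ.* y)) (κ-sym w j i)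
                 (resp φ {w · transpose j i} {w · transpose i j} (·-congʳ w {transpose j i} {transpose i j} (transpose-comm j i))) ⟩
          ℤ.- (κ w i j ℤ.* eval φ (w · transpose i j))
            ≡⟨ neg (κ w i j) _ ⟩
          -1ℤ ℤ.* κ w i j ℤ.* eval φ (w · transpose i j)
            ≡⟨ cong (λ c → c ℤ.* κ w i j ℤ.* eval φ (w · transpose i j)) (sg-> j<i) ⟨
          sg i j ℤ.* κ w i j ℤ.* eval φ (w · transpose i j) ∎
    where
    open ≡-Reasoning
    neg : ∀ x y → ℤ.- (x ℤ.* y) ≡ -1ℤ ℤ.* x ℤ.* y
    neg = solve-∀

  ∑-▷ : {A : Set} (xs : List A) (f : A → Term (Generator n)) (φ : Functional n) (w : Permutation′ n) →
        eval (∑ xs f ▷ φ) w ≡ sumᴸ xs (λ x → eval (f x ▷ φ) w)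
  ∑-▷ []       f φ w = refl
  ∑-▷ (x ∷ xs) f φ w = cong (ℤ._+_ (eval (f x ▷ φ) w)) (∑-▷ xs f φ w)

  θ-▷ : ∀ i φ w → eval (θ i ▷ φ) w ≡ ∑[ j < n ] (sg i j ℤ.* κ w i j ℤ.* eval φ (w · transpose i j))
  θ-▷ i φ w = begin
    eval (θ i ▷ φ) w
      ≡⟨ ∑-▷ (filter (λ j → ¬? (j ≟ i)) (allFin n)) (bracket i) φ w ⟩
    sumᴸ (filter (λ j → ¬? (j ≟ i)) (allFin n)) (λ j → eval (bracket i j ▷ φ) w)
      ≡⟨ sumᴸ-filter (λ j → ¬? (j ≟ i)) (allFin n) (λ j → eval (bracket i j ▷ φ) w) ⟩
    sumᴸ (allFin n) (λ j → 𝟙 (¬? (j ≟ i)) ℤ.* eval (bracket i j ▷ φ) w)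
      ≡⟨ sumᴸ-allFin (λ j → 𝟙 (¬? (j ≟ i)) ℤ.* eval (bracket i j ▷ φ) w) ⟩
    ∑[ j < n ] (𝟙 (¬? (j ≟ i)) ℤ.* eval (bracket i j ▷ φ) w)
      ≡⟨ sum-cong-≗ (λ j → trans (cong (ℤ._*_ (𝟙 (¬? (j ≟ i)))) (bracket-▷ i j φ w)) (drop j (j ≟ i))) ⟩
    ∑[ j < n ] (sg i j ℤ.* κ w i j ℤ.* eval φ (w · transpose i j)) ∎
    where
    open ≡-Reasoning
    term : Fin n → ℤ
    term j = sg i j ℤ.* κ w i j ℤ.* eval φ (w · transpose i j)
    drop : ∀ j (d : Dec (j ≡ i)) → 𝟙 (¬? d) ℤ.* term j ≡ term j
    drop j (no  _)    = ℤ.*-identityˡ (term j)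
    drop j (yes refl) = sym (cong (λ c → c ℤ.* κ w i i ℤ.* eval φ (w · transpose i i)) (sg-refl i))

-- Twisted derivations

twisted : {X : Set} → (X → Term X) → (X → Term X) → Term X → Term X
twisted σ d (var x) = d x
twisted σ d 0#      = 0#
twisted σ d 1#      = 0#
twisted σ d (a + b) = twisted σ d a + twisted σ d b
twisted σ d (a * b) = twisted σ d a * b + substitute σ a * twisted σ d b
twisted σ d (- a)   = - twisted σ d a

exchange : Fin n → Fin n → Fin n → Term (Fin n)
exchange k l i = var (transpose k l ⟨$⟩ʳ i)

slope : Fin n → Fin n → Fin n → Term (Fin n)
slope k l i = if does (i ≟ k) then 1# else if does (i ≟ l) then - 1# else 0#

-- The twisted Leibniz rule determines ∂_k from its values 1, -1 and 0 on the variables, without any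
-- division; `difference-∂` identifies the result with the divided difference.
∂ : Fin n → Fin n → Term (Fin n) → Term (Fin n)
∂ k l = twisted (exchange k l) (slope k l)

-- A kernel κ is twisted by χ along s = s_k if right multiplication by s, weighted by χ,
-- carries the action of x_i to that of x_{s i}, up to the action of a derivation.
record Twist (K : Kernel n) (k l : Fin n) : Set where
  open Kernel K
  private s = transpose k l
  field
    consecutive : Consecutive k l
    χ           : Permutation′ n → ℤ
    χ-resp      : ∀ {u v} → u ≈ₚ v → χ u ≡ χ v
    χ-off       : ∀ w {i j} → i ≢ j → ¬ (i ≡ k × j ≡ l) → ¬ (i ≡ l × j ≡ k) →
                  χ w ℤ.* κ (w · s) i j
                    ≡ κ w (s ⟨$⟩ʳ i) (s ⟨$⟩ʳ j) ℤ.* χ (w · transpose (s ⟨$⟩ʳ i) (s ⟨$⟩ʳ j))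
    χ-on        : ∀ w → χ w ℤ.* κ (w · s) k l ℤ.+ κ w k l ℤ.* χ (w · s) ≡ 1ℤ

consecutive-≢ : {k l : Fin n} → Consecutive k l → k ≢ l
consecutive-≢ k⋖l refl = ℕ.<-irrefl refl (ℕ.≤-reflexive (sym k⋖l))

δδ-≢ : {i j k l : Fin n} → ¬ (i ≡ k × j ≡ l) → δ i k ℤ.* δ j l ≡ 0ℤ
δδ-≢ {i = i} {j} {k} {l} ¬p with i ≟ k
... | no  _   = refl
... | yes i≡k = trans (ℤ.*-identityˡ _) (δ-≢ (λ j≡l → ¬p (i≡k , j≡l)))

module TwistedAction {K : Kernel n} {k l : Fin n} (twist : Twist K k l) where

  open Kernel K
  open Twist twist
  open Action K

  private
    s = transpose k l
    k≢l = consecutive-≢ consecutive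

  τ : Functional n → Functional n
  τ φ = record
    { eval = λ w → χ w ℤ.* eval φ (w · s)
    ; resp = λ {u} {v} u≈v → cong₂ ℤ._*_ (χ-resp {u} {v} u≈v) (resp φ {u · s} {v · s} (·-congˡ {u = u} {v} s u≈v))
    }

  slope-▷ : ∀ i φ w → eval (evalθ (slope k l i) ▷ φ) w ≡ (δ i k ℤ.- δ i l) ℤ.* eval φ w
  slope-▷ i φ w = trans (cases (i ≟ k) (i ≟ l)) refl
    where
    cases : (d : Dec (i ≡ k)) (d′ : Dec (i ≡ l)) →
            eval (evalθ (if does d then 1# else if does d′ then - 1# else 0#) ▷ φ) w ≡ (𝟙 d ℤ.- 𝟙 d′) ℤ.* eval φ w
    cases (yes refl) (yes k≡l) = contradiction k≡l k≢l
    cases (yes _) (no _)  = sym (ℤ.*-identityˡ _)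
    cases (no _)  (yes _) = sym (ℤ.-1*i≡-i _)
    cases (no _)  (no _)  = refl

  sg-exchange : ∀ {i j} → ¬ (i ≡ k × j ≡ l) → ¬ (i ≡ l × j ≡ k) → sg (s ⟨$⟩ʳ i) (s ⟨$⟩ʳ j) ≡ sg i j
  sg-exchange {i} {j} ¬kl ¬lk = cong₂ ℤ._-_
    (trans (simple-order consecutive i j) (off (𝟙 (i <ᶠ? j)) (δδ-≢ ¬lk) (δδ-≢ ¬kl)))
    (trans (simple-order consecutive j i) (off (𝟙 (j <ᶠ? i)) (δδ-≢ (λ (p , q) → ¬kl (q , p))) (δδ-≢ (λ (p , q) → ¬lk (q , p)))))
    where
    off : ∀ a {x y} → x ≡ 0ℤ → y ≡ 0ℤ → a ℤ.+ (x ℤ.- y) ≡ a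
    off a refl refl = ℤ.+-identityʳ a

  -- Term j on the left is matched with term s(j) on the right. All terms agree except where i and j
  -- are k and l in some order; that mismatch is a multiple of φ(w), which becomes the derivation
  -- term.
  τθ : ∀ i φ w → eval (τ (θ i ▷ φ)) w ≡ eval (θ (s ⟨$⟩ʳ i) ▷ τ φ) w ℤ.+ (δ i k ℤ.- δ i l) ℤ.* eval φ w
  τθ i φ w = begin
    χ w ℤ.* eval (θ i ▷ φ) (w · s)
      ≡⟨ cong (ℤ._*_ (χ w)) (θ-▷ i φ (w · s)) ⟩
    χ w ℤ.* ∑[ j < n ] f j
      ≡⟨ *-distribˡ-sum (χ w) f ⟩
    ∑[ j < n ] (χ w ℤ.* f j)
      ≡⟨ sum-cong-≗ termwise ⟩
    ∑[ j < n ] (g (s ⟨$⟩ʳ j) ℤ.+ (δ j l ℤ.* (δ i k ℤ.* x) ℤ.- δ j k ℤ.* (δ i l ℤ.* x)))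
      ≡⟨ ∑-distrib-+ (λ j → g (s ⟨$⟩ʳ j)) (λ j → δ j l ℤ.* (δ i k ℤ.* x) ℤ.- δ j k ℤ.* (δ i l ℤ.* x)) ⟩
    ∑[ j < n ] g (s ⟨$⟩ʳ j) ℤ.+ ∑[ j < n ] (δ j l ℤ.* (δ i k ℤ.* x) ℤ.- δ j k ℤ.* (δ i l ℤ.* x))
      ≡⟨ cong₂ ℤ._+_ (sym (trans (θ-▷ (s ⟨$⟩ʳ i) (τ φ) w) (∑-permute g s)))
           (trans (sum-sub (λ j → δ j l ℤ.* (δ i k ℤ.* x)) (λ j → δ j k ℤ.* (δ i l ℤ.* x)))
             (cong₂ ℤ._-_ (sum-δ l (λ _ → δ i k ℤ.* x)) (sum-δ k (λ _ → δ i l ℤ.* x)))) ⟩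
    eval (θ (s ⟨$⟩ʳ i) ▷ τ φ) w ℤ.+ (δ i k ℤ.* x ℤ.- δ i l ℤ.* x)
      ≡⟨ cong (ℤ._+_ (eval (θ (s ⟨$⟩ʳ i) ▷ τ φ) w)) (factor (δ i k) (δ i l) x) ⟩
    eval (θ (s ⟨$⟩ʳ i) ▷ τ φ) w ℤ.+ (δ i k ℤ.- δ i l) ℤ.* x ∎
    where
    open ≡-Reasoning
    x = eval φ w
    f g : Fin n → ℤ
    f j = sg i j ℤ.* κ (w · s) i j ℤ.* eval φ (w · s · transpose i j)
    g j = sg (s ⟨$⟩ʳ i) j ℤ.* κ w (s ⟨$⟩ʳ i) j ℤ.* eval (τ φ) (w · transpose (s ⟨$⟩ʳ i) j)
    factor : ∀ a b c → a ℤ.* c ℤ.- b ℤ.* c ≡ (a ℤ.- b) ℤ.* c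
    factor = solve-∀
    move : ∀ a b c d → a ℤ.* (b ℤ.* c ℤ.* d) ≡ b ℤ.* (a ℤ.* c) ℤ.* d
    move = solve-∀
    move′ : ∀ a b c d → a ℤ.* (b ℤ.* c) ℤ.* d ≡ a ℤ.* b ℤ.* (c ℤ.* d)
    move′ = solve-∀
    Term≡ : Fin n → Set
    Term≡ j = χ w ℤ.* f j ≡ g (s ⟨$⟩ʳ j) ℤ.+ (δ j l ℤ.* (δ i k ℤ.* x) ℤ.- δ j k ℤ.* (δ i l ℤ.* x))
    φ-same : ∀ j → eval φ (w · s · transpose i j) ≡ eval φ (w · transpose (s ⟨$⟩ʳ i) (s ⟨$⟩ʳ j) · s)
    φ-same j = resp φ {w · s · transpose i j} {w · transpose (s ⟨$⟩ʳ i) (s ⟨$⟩ʳ j) · s}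
                 (·-congʳ w {s · transpose i j} {transpose (s ⟨$⟩ʳ i) (s ⟨$⟩ʳ j) · s} (conjugate-transpose s i j))
    correction-0 : ∀ j → ¬ (i ≡ k × j ≡ l) → ¬ (i ≡ l × j ≡ k) → δ j l ℤ.* (δ i k ℤ.* x) ℤ.- δ j k ℤ.* (δ i l ℤ.* x) ≡ 0ℤ
    correction-0 j ¬kl ¬lk = trans (assoc (δ j l) (δ i k) (δ j k) (δ i l) x)
      (cong₂ (λ p q → p ℤ.* x ℤ.- q ℤ.* x) (δδ-≢ ¬kl) (δδ-≢ ¬lk))
      where
      assoc : ∀ a b c d x → a ℤ.* (b ℤ.* x) ℤ.- c ℤ.* (d ℤ.* x) ≡ b ℤ.* a ℤ.* x ℤ.- d ℤ.* c ℤ.* x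
      assoc = solve-∀
    off : ∀ j → i ≢ j → ¬ (i ≡ k × j ≡ l) → ¬ (i ≡ l × j ≡ k) → Term≡ j
    off j i≢j ¬kl ¬lk = begin
      χ w ℤ.* f j
        ≡⟨ move (χ w) (sg i j) (κ (w · s) i j) _ ⟩
      sg i j ℤ.* (χ w ℤ.* κ (w · s) i j) ℤ.* eval φ (w · s · transpose i j)
        ≡⟨ cong₂ ℤ._*_ (cong₂ ℤ._*_ (sym (sg-exchange ¬kl ¬lk)) (χ-off w i≢j ¬kl ¬lk)) (φ-same j) ⟩
      sg (s ⟨$⟩ʳ i) (s ⟨$⟩ʳ j) ℤ.* (κ w (s ⟨$⟩ʳ i) (s ⟨$⟩ʳ j) ℤ.* χ (w · transpose (s ⟨$⟩ʳ i) (s ⟨$⟩ʳ j)))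
        ℤ.* eval φ (w · transpose (s ⟨$⟩ʳ i) (s ⟨$⟩ʳ j) · s)
        ≡⟨ move′ (sg (s ⟨$⟩ʳ i) (s ⟨$⟩ʳ j)) (κ w (s ⟨$⟩ʳ i) (s ⟨$⟩ʳ j)) _ _ ⟩
      g (s ⟨$⟩ʳ j)
        ≡⟨ ℤ.+-identityʳ _ ⟨
      g (s ⟨$⟩ʳ j) ℤ.+ 0ℤ
        ≡⟨ cong (ℤ._+_ (g (s ⟨$⟩ʳ j))) (correction-0 j ¬kl ¬lk) ⟨
      g (s ⟨$⟩ʳ j) ℤ.+ (δ j l ℤ.* (δ i k ℤ.* x) ℤ.- δ j k ℤ.* (δ i l ℤ.* x)) ∎
    diagonal : ∀ j → i ≡ j → Term≡ j
    diagonal j refl = trans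
      (trans (cong (λ c → χ w ℤ.* (c ℤ.* κ (w · s) i i ℤ.* eval φ (w · s · transpose i i))) (sg-refl i)) (ℤ.*-zeroʳ (χ w)))
      (sym (cong₂ ℤ._+_
        (cong (λ c → c ℤ.* κ w (s ⟨$⟩ʳ i) (s ⟨$⟩ʳ i) ℤ.* eval (τ φ) (w · transpose (s ⟨$⟩ʳ i) (s ⟨$⟩ʳ i))) (sg-refl (s ⟨$⟩ʳ i)))
        (correction-0 i (λ (p , q) → k≢l (trans (sym p) q)) (λ (p , q) → k≢l (trans (sym q) p)))))
    φ-back : eval φ (w · s · s) ≡ x
    φ-back = resp φ {w · s · s} {w} (·-transpose-involutive w k l)
    k<l : k <ᶠ l
    k<l = ℕ.≤-reflexive (sym consecutive)
    g-normal : ∀ {j a b} → s ⟨$⟩ʳ i ≡ a → s ⟨$⟩ʳ j ≡ b → eval φ (w · s · transpose i j) ≡ x →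
               χ (w · transpose a b) ≡ χ (w · s) → κ w a b ≡ κ w k l →
               g (s ⟨$⟩ʳ j) ≡ sg a b ℤ.* κ w k l ℤ.* (χ (w · s) ℤ.* x)
    g-normal {j} {a} {b} refl refl φ≡ χ≡ κ≡ = cong₂ ℤ._*_ (cong (ℤ._*_ (sg a b)) κ≡)
      (cong₂ ℤ._*_ χ≡ (trans (sym (φ-same j)) φ≡))
    -- Since s exchanges k and l, the sign of [kl] flips when it is moved past s. The two
    -- contributions therefore add up in the difference of both sides, and `χ-on` says that their
    -- sum is φ(w).
    on-kl : ∀ j → i ≡ k → j ≡ l → Term≡ j
    on-kl j refl refl = begin
      χ w ℤ.* f l
        ≡⟨ cong₂ (λ p q → χ w ℤ.* (p ℤ.* κ (w · s) k l ℤ.* q)) (sg-< k<l) φ-back ⟩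
      χ w ℤ.* (1ℤ ℤ.* κ (w · s) k l ℤ.* x)
        ≡⟨ algebra (χ w) (κ (w · s) k l) (κ w k l) (χ (w · s)) x ⟩
      -1ℤ ℤ.* κ w k l ℤ.* (χ (w · s) ℤ.* x) ℤ.+ (χ w ℤ.* κ (w · s) k l ℤ.+ κ w k l ℤ.* χ (w · s)) ℤ.* x
        ≡⟨ cong₂ ℤ._+_
             (sym (trans (g-normal (transpose-matchˡ k l) (transpose-matchʳ k l) φ-back
                            (χ-resp {w · transpose l k} {w · s} (·-congʳ w {transpose l k} {s} (transpose-comm l k))) (κ-sym w l k))
                         (cong (λ c → c ℤ.* κ w k l ℤ.* (χ (w · s) ℤ.* x)) (sg-> k<l))))
             (trans (cong (ℤ._* x) (χ-on w)) (unit x)) ⟩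
      g (s ⟨$⟩ʳ l) ℤ.+ (1ℤ ℤ.* (1ℤ ℤ.* x) ℤ.- 0ℤ ℤ.* (0ℤ ℤ.* x))
        ≡⟨ cong (ℤ._+_ (g (s ⟨$⟩ʳ l))) (cong₂ ℤ._-_
             (cong₂ (λ p q → p ℤ.* (q ℤ.* x)) (δ-refl l) (δ-refl k))
             (cong₂ (λ p q → p ℤ.* (q ℤ.* x)) (δ-≢ (≢-sym k≢l)) (δ-≢ k≢l))) ⟨
      g (s ⟨$⟩ʳ l) ℤ.+ (δ l l ℤ.* (δ k k ℤ.* x) ℤ.- δ l k ℤ.* (δ k l ℤ.* x)) ∎
      where
      algebra : ∀ c a b d x → c ℤ.* (1ℤ ℤ.* a ℤ.* x) ≡ -1ℤ ℤ.* b ℤ.* (d ℤ.* x) ℤ.+ (c ℤ.* a ℤ.+ b ℤ.* d) ℤ.* x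
      algebra = solve-∀
      unit : ∀ x → 1ℤ ℤ.* x ≡ 1ℤ ℤ.* (1ℤ ℤ.* x) ℤ.- 0ℤ ℤ.* (0ℤ ℤ.* x)
      unit = solve-∀
    on-lk : ∀ j → i ≡ l → j ≡ k → Term≡ j
    on-lk j refl refl = begin
      χ w ℤ.* f k
        ≡⟨ cong (λ c → χ w ℤ.* c) (cong₂ ℤ._*_ (cong₂ ℤ._*_ (sg-> k<l) (κ-sym (w · s) l k)) φ-back′) ⟩
      χ w ℤ.* (-1ℤ ℤ.* κ (w · s) k l ℤ.* x)
        ≡⟨ algebra (χ w) (κ (w · s) k l) (κ w k l) (χ (w · s)) x ⟩
      1ℤ ℤ.* κ w k l ℤ.* (χ (w · s) ℤ.* x) ℤ.- (χ w ℤ.* κ (w · s) k l ℤ.+ κ w k l ℤ.* χ (w · s)) ℤ.* x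
        ≡⟨ cong₂ ℤ._+_
             (sym (trans (g-normal (transpose-matchʳ k l) (transpose-matchˡ k l) φ-back′ refl refl)
                         (cong (λ c → c ℤ.* κ w k l ℤ.* (χ (w · s) ℤ.* x)) (sg-< k<l))))
             (trans (cong (λ c → ℤ.- (c ℤ.* x)) (χ-on w)) (unit x)) ⟩
      g (s ⟨$⟩ʳ k) ℤ.+ (0ℤ ℤ.* (0ℤ ℤ.* x) ℤ.- 1ℤ ℤ.* (1ℤ ℤ.* x))
        ≡⟨ cong (ℤ._+_ (g (s ⟨$⟩ʳ k))) (cong₂ ℤ._-_
             (cong₂ (λ p q → p ℤ.* (q ℤ.* x)) (δ-≢ k≢l) (δ-≢ (≢-sym k≢l)))
             (cong₂ (λ p q → p ℤ.* (q ℤ.* x)) (δ-refl k) (δ-refl l))) ⟨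
      g (s ⟨$⟩ʳ k) ℤ.+ (δ k l ℤ.* (δ l k ℤ.* x) ℤ.- δ k k ℤ.* (δ l l ℤ.* x)) ∎
      where
      φ-back′ : eval φ (w · s · transpose l k) ≡ x
      φ-back′ = trans (resp φ {w · s · transpose l k} {w · s · s} (·-congʳ (w · s) {transpose l k} {s} (transpose-comm l k))) φ-back
      algebra : ∀ c a b d x → c ℤ.* (-1ℤ ℤ.* a ℤ.* x) ≡ 1ℤ ℤ.* b ℤ.* (d ℤ.* x) ℤ.- (c ℤ.* a ℤ.+ b ℤ.* d) ℤ.* x
      algebra = solve-∀
      unit : ∀ x → ℤ.- (1ℤ ℤ.* x) ≡ 0ℤ ℤ.* (0ℤ ℤ.* x) ℤ.- 1ℤ ℤ.* (1ℤ ℤ.* x)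
      unit = solve-∀
    termwise : ∀ j → Term≡ j
    termwise j with i ≟ j | (i ≟ k) ×-dec (j ≟ l) | (i ≟ l) ×-dec (j ≟ k)
    ... | yes i≡j | _             | _             = diagonal j i≡j
    ... | no _    | yes (i≡k , j≡l) | _           = on-kl j i≡k j≡l
    ... | no _    | no _          | yes (i≡l , j≡k) = on-lk j i≡l j≡k
    ... | no i≢j  | no ¬kl        | no ¬lk        = off j i≢j ¬kl ¬lk

  -- f(θ) is moved past τ as in the nil-Hecke (or degenerate Hecke) algebra.
  τ-evalθ : ∀ f φ → τ (evalθ f ▷ φ) ≗ (evalθ (swap k l f) ▷ τ φ) ⊞ (evalθ (∂ k l f) ▷ φ)
  τ-evalθ (var i) φ w = trans (τθ i φ w) (cong (ℤ._+_ (eval (θ (s ⟨$⟩ʳ i) ▷ τ φ) w)) (sym (slope-▷ i φ w)))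
  τ-evalθ 0#      φ w = ℤ.*-zeroʳ (χ w)
  τ-evalθ 1#      φ w = sym (ℤ.+-identityʳ _)
  τ-evalθ (f + g) φ w = trans (ℤ.*-distribˡ-+ (χ w) (eval (evalθ f ▷ φ) (w · s)) _)
    (trans (cong₂ ℤ._+_ (τ-evalθ f φ w) (τ-evalθ g φ w))
      (interchange (eval (evalθ (swap k l f) ▷ τ φ) w) (eval (evalθ (∂ k l f) ▷ φ) w)
                   (eval (evalθ (swap k l g) ▷ τ φ) w) (eval (evalθ (∂ k l g) ▷ φ) w)))
  τ-evalθ (- f)   φ w = trans (sym (ℤ.neg-distribʳ-* (χ w) (eval (evalθ f ▷ φ) (w · s))))
    (trans (cong ℤ.-_ (τ-evalθ f φ w)) (ℤ.neg-distrib-+ (eval (evalθ (swap k l f) ▷ τ φ) w) _))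
  τ-evalθ (f * g) φ w = begin
    eval (τ (evalθ f ▷ (evalθ g ▷ φ))) w
      ≡⟨ τ-evalθ f (evalθ g ▷ φ) w ⟩
    eval (sf ▷ τ (evalθ g ▷ φ)) w ℤ.+ eval (∂f ▷ (evalθ g ▷ φ)) w
      ≡⟨ cong (ℤ._+ eval (∂f ▷ (evalθ g ▷ φ)) w)
           (trans (▷-cong sf (τ-evalθ g φ) w) (▷-⊞ sf (evalθ (swap k l g) ▷ τ φ) (evalθ (∂ k l g) ▷ φ) w)) ⟩
    eval (sf ▷ (evalθ (swap k l g) ▷ τ φ)) w ℤ.+ eval (sf ▷ (evalθ (∂ k l g) ▷ φ)) w ℤ.+ eval (∂f ▷ (evalθ g ▷ φ)) w
      ≡⟨ shuffle (eval (sf ▷ (evalθ (swap k l g) ▷ τ φ)) w) _ _ ⟩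
    eval (sf ▷ (evalθ (swap k l g) ▷ τ φ)) w ℤ.+ (eval (∂f ▷ (evalθ g ▷ φ)) w ℤ.+ eval (sf ▷ (evalθ (∂ k l g) ▷ φ)) w) ∎
    where
    open ≡-Reasoning
    sf ∂f : Term (Generator n)
    sf = evalθ (swap k l f)
    ∂f = evalθ (∂ k l f)
    shuffle : ∀ a b c → a ℤ.+ b ℤ.+ c ≡ a ℤ.+ (c ℤ.+ b)
    shuffle = solve-∀

-- The Bruhat kernel and the covering kernel

drop⇒inverted : (w : Permutation′ n) {i j : Fin n} → i <ᶠ j → ℓ (w · transpose i j) ℕ.< ℓ w → (w ⟨$⟩ʳ j) <ᶠ (w ⟨$⟩ʳ i)
drop⇒inverted w {i} {j} i<j drop with <-cmp (w ⟨$⟩ʳ i) (w ⟨$⟩ʳ j)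
... | tri< p _ _ = contradiction drop (ℕ.<-asym (ℓ-rise w i<j p))
... | tri≈ _ p _ = contradiction (cong toℕ (injective w p)) (ℕ.<⇒≢ i<j)
... | tri> _ _ p = p

ℓ-cong-transpose : (w : Permutation′ n) (i j : Fin n) → ℓ (w · transpose i j) ≡ ℓ (w · transpose j i)
ℓ-cong-transpose w i j = ℓ-cong {u = w · transpose i j} {w · transpose j i}
  (·-congʳ w {transpose i j} {transpose j i} (transpose-comm i j))

bruhat : Kernel n
bruhat = record
  { κ      = λ w i j → 𝟙 (ℓ (w · transpose i j) ℕ.<? ℓ w)
  ; κ-resp = λ {u} {v} u≈v i j → cong₂ (λ x y → 𝟙 (x ℕ.<? y))
               (ℓ-cong {u = u · transpose i j} {v · transpose i j} (·-congˡ {u = u} {v} (transpose i j) u≈v))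
               (ℓ-cong {u = u} {v} u≈v)
  ; κ-sym  = λ w i j → cong (λ x → 𝟙 (x ℕ.<? ℓ w)) (ℓ-cong-transpose w i j)
  }

covering : Kernel n
covering = record
  { κ      = λ w i j → 𝟙 (suc (ℓ (w · transpose i j)) ℕ.≟ ℓ w)
  ; κ-resp = λ {u} {v} u≈v i j → cong₂ (λ x y → 𝟙 (suc x ℕ.≟ y))
               (ℓ-cong {u = u · transpose i j} {v · transpose i j} (·-congˡ {u = u} {v} (transpose i j) u≈v))
               (ℓ-cong {u = u} {v} u≈v)
  ; κ-sym  = λ w i j → cong (λ x → 𝟙 (suc x ℕ.≟ ℓ w)) (ℓ-cong-transpose w i j)
  }

module _ {n : ℕ} where

  open Kernel (bruhat {n})

  bruhat-inverted : ∀ w {i j} → i <ᶠ j → κ w i j ≡ 𝟙 ((w ⟨$⟩ʳ j) <ᶠ? (w ⟨$⟩ʳ i))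
  bruhat-inverted w i<j = 𝟙-cong (_ ℕ.<? _) (_ <ᶠ? _) (drop⇒inverted w i<j) (ℓ-drop w i<j)

  -- The coefficient is half the difference of a sign of positions and a sign of values; doubling
  -- avoids fractions. Identities between products of coefficients thereby become polynomial
  -- identities in signs.
  double-bruhat : ∀ w {i j} → i ≢ j → ℤ.+ 2 ℤ.* (sg i j ℤ.* κ w i j) ≡ sg i j ℤ.- sg (w ⟨$⟩ʳ i) (w ⟨$⟩ʳ j)
  double-bruhat w {i} {j} i≢j with <-cmp i j | <-cmp (w ⟨$⟩ʳ i) (w ⟨$⟩ʳ j)
  ... | tri≈ _ p _   | _          = contradiction p i≢j
  ... | _            | tri≈ _ p _ = contradiction (injective w p) i≢j
  ... | tri< i<j _ _ | tri< p _ _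
    rewrite sg-< i<j | sg-< p | bruhat-inverted w i<j | 𝟙-no ((w ⟨$⟩ʳ j) <ᶠ? (w ⟨$⟩ʳ i)) (ℕ.<-asym p) = refl
  ... | tri< i<j _ _ | tri> _ _ p
    rewrite sg-< i<j | sg-> p | bruhat-inverted w i<j | 𝟙-yes ((w ⟨$⟩ʳ j) <ᶠ? (w ⟨$⟩ʳ i)) p = refl
  ... | tri> _ _ j<i | tri< p _ _
    rewrite sg-> j<i | sg-< p | κ-sym w i j | bruhat-inverted w j<i | 𝟙-yes ((w ⟨$⟩ʳ i) <ᶠ? (w ⟨$⟩ʳ j)) p = refl
  ... | tri> _ _ j<i | tri> _ _ p
    rewrite sg-> j<i | sg-> p | κ-sym w i j | bruhat-inverted w j<i | 𝟙-no ((w ⟨$⟩ʳ i) <ᶠ? (w ⟨$⟩ʳ j)) (ℕ.<-asym p) = refl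

module _ {k l : Fin n} (k⋖l : Consecutive k l) where

  private
    s = transpose k l
    k<l : k <ᶠ l
    k<l = ℕ.≤-reflexive (sym k⋖l)

  exchange-< : ∀ {i j} → i <ᶠ j → ¬ (i ≡ k × j ≡ l) → ¬ (i ≡ l × j ≡ k) → (s ⟨$⟩ʳ i) <ᶠ (s ⟨$⟩ʳ j)
  exchange-< {i} {j} i<j ¬kl ¬lk = 𝟙-holds (_ <ᶠ? _) (trans (simple-order k⋖l i j)
    (cong₂ ℤ._+_ (𝟙-yes (i <ᶠ? j) i<j) (cong₂ ℤ._-_ (δδ-≢ ¬lk) (δδ-≢ ¬kl))))

  -- It suffices to consider the pairs i < j, as both sides of χ-off are symmetric in i and j.
  off-by-symmetry : (K : Kernel n) → let open Kernel K in
    (χ : Permutation′ n → ℤ) → (∀ {u v} → u ≈ₚ v → χ u ≡ χ v) →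
    (∀ w {i j} → i <ᶠ j → (s ⟨$⟩ʳ i) <ᶠ (s ⟨$⟩ʳ j) →
      χ w ℤ.* κ (w · s) i j ≡ κ w (s ⟨$⟩ʳ i) (s ⟨$⟩ʳ j) ℤ.* χ (w · transpose (s ⟨$⟩ʳ i) (s ⟨$⟩ʳ j))) →
    ∀ w {i j} → i ≢ j → ¬ (i ≡ k × j ≡ l) → ¬ (i ≡ l × j ≡ k) →
      χ w ℤ.* κ (w · s) i j ≡ κ w (s ⟨$⟩ʳ i) (s ⟨$⟩ʳ j) ℤ.* χ (w · transpose (s ⟨$⟩ʳ i) (s ⟨$⟩ʳ j))
  off-by-symmetry K χ χ-resp ordered w {i} {j} i≢j ¬kl ¬lk with <-cmp i j
  ... | tri< i<j _ _ = ordered w i<j (exchange-< i<j ¬kl ¬lk)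
  ... | tri≈ _ i≡j _ = contradiction i≡j i≢j
  ... | tri> _ _ j<i = begin
          χ w ℤ.* κ (w · s) i j     ≡⟨ cong (ℤ._*_ (χ w)) (κ-sym (w · s) i j) ⟩
          χ w ℤ.* κ (w · s) j i     ≡⟨ ordered w j<i (exchange-< j<i (λ (p , q) → ¬lk (q , p)) (λ (p , q) → ¬kl (q , p))) ⟩
          κ w sj si ℤ.* χ (w · transpose sj si)
            ≡⟨ cong₂ ℤ._*_ (κ-sym w sj si) (χ-resp {w · transpose sj si} {w · transpose si sj}
                 (·-congʳ w {transpose sj si} {transpose si sj} (transpose-comm sj si))) ⟩
          κ w si sj ℤ.* χ (w · transpose si sj) ∎
    where
    open ≡-Reasoning
    open Kernel K
    si = s ⟨$⟩ʳ i
    sj = s ⟨$⟩ʳ j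

  w·s-k : ∀ (w : Permutation′ n) → (w · s) ⟨$⟩ʳ k ≡ w ⟨$⟩ʳ l
  w·s-k w = cong (w ⟨$⟩ʳ_) (transpose-matchˡ k l)

  w·s-l : ∀ (w : Permutation′ n) → (w · s) ⟨$⟩ʳ l ≡ w ⟨$⟩ʳ k
  w·s-l w = cong (w ⟨$⟩ʳ_) (transpose-matchʳ k l)

  ℓ-w·s·s : ∀ (w : Permutation′ n) → ℓ (w · s · s) ≡ ℓ w
  ℓ-w·s·s w = ℓ-cong {u = w · s · s} {w} (·-transpose-involutive w k l)

  w-k≢w-l : ∀ (w : Permutation′ n) → w ⟨$⟩ʳ k ≢ w ⟨$⟩ʳ l
  w-k≢w-l w = consecutive-≢ k⋖l ∘ injective w

  -- Whether t_ij lowers the length depends only on the order of the values at i and j, and ws has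
  -- at i, j the values of w at s(i), s(j). So the weight 1 works, and at k, l exactly one of w and
  -- ws has an inversion.
  bruhat-twist : Twist bruhat k l
  bruhat-twist = record
    { consecutive = k⋖l
    ; χ           = λ _ → 1ℤ
    ; χ-resp      = λ _ → refl
    ; χ-off       = off-by-symmetry bruhat (λ _ → 1ℤ) (λ _ → refl) λ w i<j si<sj →
        trans (ℤ.*-identityˡ _) (trans
          (trans (bruhat-inverted (w · s) i<j) (sym (bruhat-inverted w si<sj)))
          (sym (ℤ.*-identityʳ _)))
    ; χ-on        = λ w → trans (cong₂ ℤ._+_ (ℤ.*-identityˡ (κ (w · s) k l)) (ℤ.*-identityʳ (κ w k l))) (on w)
    }
    where
    open Kernel bruhat
    total : ∀ {x y : Fin n} → x ≢ y → 𝟙 (x <ᶠ? y) ℤ.+ 𝟙 (y <ᶠ? x) ≡ 1ℤ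
    total {x} {y} x≢y with <-cmp x y
    ... | tri< p _ _ = cong₂ ℤ._+_ (𝟙-yes (x <ᶠ? y) p) (𝟙-no (y <ᶠ? x) (ℕ.<-asym p))
    ... | tri≈ _ p _ = contradiction p x≢y
    ... | tri> _ _ p = cong₂ ℤ._+_ (𝟙-no (x <ᶠ? y) (ℕ.<-asym p)) (𝟙-yes (y <ᶠ? x) p)
    on : ∀ w → κ (w · s) k l ℤ.+ κ w k l ≡ 1ℤ
    on w = trans
      (cong₂ ℤ._+_
        (trans (bruhat-inverted (w · s) k<l) (cong₂ (λ x y → 𝟙 (x <ᶠ? y)) (w·s-l w) (w·s-k w)))
        (bruhat-inverted w k<l))
      (total (w-k≢w-l w))

  ascending : Permutation′ n → ℤ
  ascending w = 𝟙 (ℓ w ℕ.<? ℓ (w · s))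

  ascending-resp : ∀ {u v} → u ≈ₚ v → ascending u ≡ ascending v
  ascending-resp {u} {v} u≈v = cong₂ (λ x y → 𝟙 (x ℕ.<? y)) (ℓ-cong {u = u} {v} u≈v)
    (ℓ-cong {u = u · s} {v · s} (·-congˡ {u = u} {v} s u≈v))

  -- Consider the square w′, w, w′s, ws with w′ = w t for t exchanging s(i) and s(j). The left side
  -- of `χ-off` asserts its two upper covers, the right side its two lower covers. Either pair gives
  -- ℓ(w′s) = ℓ(w); the other pair follows because the transposition strictly lowers the length and
  -- s raises it by at most one.
  covering-twist : Twist covering k l
  covering-twist = record
    { consecutive = k⋖l
    ; χ           = ascending
    ; χ-resp      = λ {u} {v} → ascending-resp {u} {v}
    ; χ-off       = off-by-symmetry covering ascending (λ {u} {v} → ascending-resp {u} {v}) off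
    ; χ-on        = on
    }
    where
    open Kernel covering
    off : ∀ w {i j} → i <ᶠ j → (s ⟨$⟩ʳ i) <ᶠ (s ⟨$⟩ʳ j) →
      ascending w ℤ.* κ (w · s) i j ≡ κ w (s ⟨$⟩ʳ i) (s ⟨$⟩ʳ j) ℤ.* ascending (w · transpose (s ⟨$⟩ʳ i) (s ⟨$⟩ʳ j))
    off w {i} {j} i<j si<sj = 𝟙-×-cong (_ ℕ.<? _) (_ ℕ.≟ _) (_ ℕ.≟ _) (_ ℕ.<? _) to from
      where
      w′ = w · transpose (s ⟨$⟩ʳ i) (s ⟨$⟩ʳ j)
      swap-ℓ : ℓ (w · s · transpose i j) ≡ ℓ (w′ · s)
      swap-ℓ = ℓ-cong {u = w · s · transpose i j} {w′ · s}
        (·-congʳ w {s · transpose i j} {transpose (s ⟨$⟩ʳ i) (s ⟨$⟩ʳ j) · s} (conjugate-transpose s i j))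
      rise : ∀ u → ℓ u ℕ.< ℓ (u · s) → ℓ (u · s) ≡ suc (ℓ u)
      rise u p = ℕ.≤-antisym (ℓ-simple-≤ u k⋖l) p
      to : ℓ w ℕ.< ℓ (w · s) → suc (ℓ (w · s · transpose i j)) ≡ ℓ (w · s) →
           suc (ℓ w′) ≡ ℓ w × ℓ w′ ℕ.< ℓ (w′ · s)
      to up cover = ℕ.≤-antisym w′<w (subst (_≤ suc (ℓ w′)) w′s≡w (ℓ-simple-≤ w′ k⋖l)) , subst (ℓ w′ ℕ.<_) (sym w′s≡w) w′<w
        where
        w′s≡w : ℓ (w′ · s) ≡ ℓ w
        w′s≡w = ℕ.suc-injective (trans (cong suc (sym swap-ℓ)) (trans cover (rise w up)))
        w′<w : ℓ w′ ℕ.< ℓ w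
        w′<w = ℓ-drop w si<sj (drop⇒inverted (w · s) i<j (ℕ.≤-reflexive cover))
      from : suc (ℓ w′) ≡ ℓ w → ℓ w′ ℕ.< ℓ (w′ · s) →
             ℓ w ℕ.< ℓ (w · s) × suc (ℓ (w · s · transpose i j)) ≡ ℓ (w · s)
      from cover up = w<ws , trans (cong suc wst≡w) (sym (rise w w<ws))
        where
        wst≡w : ℓ (w · s · transpose i j) ≡ ℓ w
        wst≡w = trans swap-ℓ (trans (rise w′ up) cover)
        w<ws : ℓ w ℕ.< ℓ (w · s)
        w<ws = subst (ℕ._< ℓ (w · s)) wst≡w (ℓ-drop (w · s) i<j (drop⇒inverted w si<sj (ℕ.≤-reflexive cover)))
    on : ∀ w → ascending w ℤ.* κ (w · s) k l ℤ.+ κ w k l ℤ.* ascending (w · s) ≡ 1ℤ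
    on w = trans (cong (λ a → ascending w ℤ.* 𝟙 (suc a ℕ.≟ ℓ (w · s)) ℤ.+ κ w k l ℤ.* 𝟙 (ℓ (w · s) ℕ.<? a)) (ℓ-w·s·s w))
                 (one (<-cmp (w ⟨$⟩ʳ k) (w ⟨$⟩ʳ l)))
      where
      weight : ℕ → ℕ → ℤ
      weight a b = 𝟙 (a ℕ.<? b) ℤ.* 𝟙 (suc a ℕ.≟ b)
      weight-suc : ∀ a → weight a (suc a) ≡ 1ℤ
      weight-suc a = cong₂ ℤ._*_ (𝟙-yes (a ℕ.<? suc a) ℕ.≤-refl) (𝟙-yes (suc a ℕ.≟ suc a) refl)
      weight-0 : ∀ {a b} → ¬ a ℕ.< b → weight a b ≡ 0ℤ
      weight-0 {a} {b} a≮b = cong (ℤ._* 𝟙 (suc a ℕ.≟ b)) (𝟙-no (a ℕ.<? b) a≮b)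
      up : ∀ a {b} → b ≡ suc a → weight a b ℤ.+ 𝟙 (suc b ℕ.≟ a) ℤ.* 𝟙 (b ℕ.<? a) ≡ 1ℤ
      up a refl = cong₂ ℤ._+_ (weight-suc a)
        (trans (ℤ.*-comm (𝟙 (suc (suc a) ℕ.≟ a)) _) (weight-0 (ℕ.<-asym (ℕ.n<1+n a))))
      down : ∀ b {a} → suc b ≡ a → weight a b ℤ.+ 𝟙 (suc b ℕ.≟ a) ℤ.* 𝟙 (b ℕ.<? a) ≡ 1ℤ
      down b refl = cong₂ ℤ._+_ (weight-0 (ℕ.<-asym (ℕ.n<1+n b))) (trans (ℤ.*-comm (𝟙 (suc b ℕ.≟ suc b)) _) (weight-suc b))
      one : Tri ((w ⟨$⟩ʳ k) <ᶠ (w ⟨$⟩ʳ l)) (w ⟨$⟩ʳ k ≡ w ⟨$⟩ʳ l) ((w ⟨$⟩ʳ l) <ᶠ (w ⟨$⟩ʳ k)) →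
            weight (ℓ w) (ℓ (w · s)) ℤ.+ 𝟙 (suc (ℓ (w · s)) ℕ.≟ ℓ w) ℤ.* 𝟙 (ℓ (w · s) ℕ.<? ℓ w) ≡ 1ℤ
      one (tri< p _ _) = up (ℓ w) (ℓ-simple-up w k⋖l p)
      one (tri≈ _ p _) = contradiction p (w-k≢w-l w)
      one (tri> _ _ p) = down (ℓ (w · s)) (ℓ-simple-down w k⋖l p)

-- The Bruhat kernel respects the Fomin–Kirillov relations

-- As [ij] acts with coefficient (sg i j - sg (w i) (w j)) / 2, the triangle relations follow from
-- this identity for the positions and for the values.
sg-triangle : {a b c : Fin n} → a ≢ b → b ≢ c → a ≢ c →
  sg a b ℤ.* sg b c ℤ.+ 1ℤ ≡ sg b c ℤ.* sg a c ℤ.+ sg a c ℤ.* sg a b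
sg-triangle {a = a} {b} {c} a≢b b≢c a≢c with <-cmp a b | <-cmp b c | <-cmp a c
... | tri≈ _ p _ | _ | _ = contradiction p a≢b
... | _ | tri≈ _ p _ | _ = contradiction p b≢c
... | _ | _ | tri≈ _ p _ = contradiction p a≢c
... | tri< p _ _ | tri< q _ _ | tri< r _ _ rewrite sg-< p | sg-< q | sg-< r = refl
... | tri< p _ _ | tri> _ _ q | tri< r _ _ rewrite sg-< p | sg-> q | sg-< r = refl
... | tri< p _ _ | tri> _ _ q | tri> _ _ r rewrite sg-< p | sg-> q | sg-> r = refl
... | tri> _ _ p | tri< q _ _ | tri< r _ _ rewrite sg-> p | sg-< q | sg-< r = refl
... | tri> _ _ p | tri< q _ _ | tri> _ _ r rewrite sg-> p | sg-< q | sg-> r = refl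
... | tri> _ _ p | tri> _ _ q | tri> _ _ r rewrite sg-> p | sg-> q | sg-> r = refl
... | tri< p _ _ | tri< q _ _ | tri> _ _ r = contradiction (ℕ.<-trans p q) (ℕ.<-asym r)
... | tri> _ _ p | tri> _ _ q | tri< r _ _ = contradiction (ℕ.<-trans q p) (ℕ.<-asym r)

module _ {n : ℕ} where

  open Action (bruhat {n})
  open Kernel (bruhat {n})

  coefficient : Permutation′ n → Fin n → Fin n → ℤ
  coefficient w i j = sg i j ℤ.* κ w i j

  double-coefficient : ∀ w {i j x y} → i ≢ j → w ⟨$⟩ʳ i ≡ x → w ⟨$⟩ʳ j ≡ y →
    ℤ.+ 2 ℤ.* coefficient w i j ≡ sg i j ℤ.- sg x y
  double-coefficient w i≢j refl refl = double-bruhat w i≢j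

  coefficient-local : ∀ u v {i j} → i ≢ j → u ⟨$⟩ʳ i ≡ v ⟨$⟩ʳ i → u ⟨$⟩ʳ j ≡ v ⟨$⟩ʳ j →
    coefficient u i j ≡ coefficient v i j
  coefficient-local u v i≢j ui≡ uj≡ = ℤ.*-cancelˡ-≡ (ℤ.+ 2) _ _
    (trans (double-coefficient u i≢j ui≡ uj≡) (sym (double-coefficient v i≢j refl refl)))

  bracket-bracket : ∀ i j k l φ w → eval ((bracket i j * bracket k l) ▷ φ) w
    ≡ coefficient w i j ℤ.* coefficient (w · transpose i j) k l ℤ.* eval φ (w · transpose i j · transpose k l)
  bracket-bracket i j k l φ w = begin
    eval (bracket i j ▷ (bracket k l ▷ φ)) w
      ≡⟨ bracket-▷ i j (bracket k l ▷ φ) w ⟩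
    coefficient w i j ℤ.* eval (bracket k l ▷ φ) (w · transpose i j)
      ≡⟨ cong (ℤ._*_ (coefficient w i j)) (bracket-▷ k l φ (w · transpose i j)) ⟩
    coefficient w i j ℤ.* (coefficient (w · transpose i j) k l ℤ.* eval φ (w · transpose i j · transpose k l))
      ≡⟨ ℤ.*-assoc (coefficient w i j) _ _ ⟨
    coefficient w i j ℤ.* coefficient (w · transpose i j) k l ℤ.* eval φ (w · transpose i j · transpose k l) ∎
    where open ≡-Reasoning

  module _ (w : Permutation′ n) where

    square-coefficient : ∀ i j → coefficient w i j ℤ.* coefficient (w · transpose i j) i j ≡ 0ℤ
    square-coefficient i j = begin
      sg i j ℤ.* κ w i j ℤ.* (sg i j ℤ.* κ wt i j)
        ≡⟨ collect (sg i j) (κ w i j) (κ wt i j) ⟩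
      sg i j ℤ.* sg i j ℤ.* (κ w i j ℤ.* κ wt i j)
        ≡⟨ cong (ℤ._*_ (sg i j ℤ.* sg i j)) (exclusive (ℓ wt ℕ.<? ℓ w) (ℓ (wt · transpose i j) ℕ.<? ℓ wt)) ⟩
      sg i j ℤ.* sg i j ℤ.* 0ℤ
        ≡⟨ ℤ.*-zeroʳ (sg i j ℤ.* sg i j) ⟩
      0ℤ ∎
      where
      open ≡-Reasoning
      wt = w · transpose i j
      collect : ∀ a b c → a ℤ.* b ℤ.* (a ℤ.* c) ≡ a ℤ.* a ℤ.* (b ℤ.* c)
      collect = solve-∀
      exclusive : (p? : Dec (ℓ wt ℕ.< ℓ w)) (q? : Dec (ℓ (wt · transpose i j) ℕ.< ℓ wt)) → 𝟙 p? ℤ.* 𝟙 q? ≡ 0ℤ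
      exclusive (no _)  _      = refl
      exclusive (yes _) (no _) = refl
      exclusive (yes p) (yes q) = contradiction
        (subst (ℕ._< ℓ wt) (ℓ-cong {u = wt · transpose i j} {w} (·-transpose-involutive w i j)) q) (ℕ.<-asym p)

    module _ {i j k : Fin n} (i≢j : i ≢ j) (i≢k : i ≢ k) (j≢k : j ≢ k) where

      private
        x = w ⟨$⟩ʳ i
        y = w ⟨$⟩ʳ j
        z = w ⟨$⟩ʳ k
        quadruple : ∀ a b c d e f {a′ b′ c′ d′ e′ f′} →
          ℤ.+ 2 ℤ.* a ≡ a′ → ℤ.+ 2 ℤ.* b ≡ b′ → ℤ.+ 2 ℤ.* c ≡ c′ → ℤ.+ 2 ℤ.* d ≡ d′ → ℤ.+ 2 ℤ.* e ≡ e′ → ℤ.+ 2 ℤ.* f ≡ f′ →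
          a′ ℤ.* b′ ≡ c′ ℤ.* d′ ℤ.+ e′ ℤ.* f′ → a ℤ.* b ≡ c ℤ.* d ℤ.+ e ℤ.* f
        quadruple a b c d e f refl refl refl refl refl refl eq = ℤ.*-cancelˡ-≡ (ℤ.+ 4) _ _ (trans (l a b) (trans eq (r c d e f)))
          where
          l : ∀ a b → ℤ.+ 4 ℤ.* (a ℤ.* b) ≡ (ℤ.+ 2 ℤ.* a) ℤ.* (ℤ.+ 2 ℤ.* b)
          l = solve-∀
          r : ∀ c d e f → (ℤ.+ 2 ℤ.* c) ℤ.* (ℤ.+ 2 ℤ.* d) ℤ.+ (ℤ.+ 2 ℤ.* e) ℤ.* (ℤ.+ 2 ℤ.* f)
                        ≡ ℤ.+ 4 ℤ.* (c ℤ.* d ℤ.+ e ℤ.* f)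
          r = solve-∀
        xyz : sg x y ℤ.* sg y z ℤ.+ 1ℤ ≡ sg y z ℤ.* sg x z ℤ.+ sg x z ℤ.* sg x y
        xyz = sg-triangle (i≢j ∘ injective w) (j≢k ∘ injective w) (i≢k ∘ injective w)
        ijk : sg i j ℤ.* sg j k ℤ.+ 1ℤ ≡ sg j k ℤ.* sg i k ℤ.+ sg i k ℤ.* sg i j
        ijk = sg-triangle i≢j j≢k i≢k
        cancel : ∀ l r a b a′ b′ → a ≡ a′ → b ≡ b′ → l ℤ.- r ≡ (a ℤ.- a′) ℤ.+ (b ℤ.- b′) → l ≡ r
        cancel l r a b a′ b′ refl refl eq = ℤ.i-j≡0⇒i≡j l r
          (trans eq (cong₂ ℤ._+_ (ℤ.+-inverseʳ a) (ℤ.+-inverseʳ b)))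

      -- Each product of two doubled coefficients carries the factor 4. On expansion all products of
      -- a position sign with a value sign cancel, leaving `sg-triangle` for i, j, k minus
      -- `sg-triangle` for their values.
      triangle₁-coefficient :
        coefficient w i j ℤ.* coefficient (w · transpose i j) j k
          ≡ coefficient w j k ℤ.* coefficient (w · transpose j k) i k
              ℤ.+ coefficient w i k ℤ.* coefficient (w · transpose i k) i j
      triangle₁-coefficient = quadruple _ _ _ _ _ _
        (double-coefficient w i≢j refl refl)
        (double-coefficient (w · transpose i j) j≢k
          (cong (w ⟨$⟩ʳ_) (transpose-matchʳ i j)) (cong (w ⟨$⟩ʳ_) (transpose-mismatch (≢-sym i≢k) (≢-sym j≢k))))
        (double-coefficient w j≢k refl refl)
        (double-coefficient (w · transpose j k) i≢k
          (cong (w ⟨$⟩ʳ_) (transpose-mismatch i≢j i≢k)) (cong (w ⟨$⟩ʳ_) (transpose-matchʳ j k)))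
        (double-coefficient w i≢k refl refl)
        (double-coefficient (w · transpose i k) i≢j
          (cong (w ⟨$⟩ʳ_) (transpose-matchˡ i k)) (cong (w ⟨$⟩ʳ_) (transpose-mismatch (≢-sym i≢j) j≢k)))
        (trans (cancel _ _ _ _ _ _ ijk (sym xyz) (identity (sg i j) (sg j k) (sg i k) (sg x y) (sg y z) (sg x z)))
          (cong (λ c → (sg j k ℤ.- sg y z) ℤ.* (sg i k ℤ.- sg x y) ℤ.+ (sg i k ℤ.- sg x z) ℤ.* (sg i j ℤ.- c)) (sym (sg-anti y z))))
        where
        identity : ∀ p q r X Y Z →
          (p ℤ.- X) ℤ.* (q ℤ.- Z) ℤ.- ((q ℤ.- Y) ℤ.* (r ℤ.- X) ℤ.+ (r ℤ.- Z) ℤ.* (p ℤ.- ℤ.- Y))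
            ≡ ((p ℤ.* q ℤ.+ 1ℤ) ℤ.- (q ℤ.* r ℤ.+ r ℤ.* p)) ℤ.+ ((Y ℤ.* Z ℤ.+ Z ℤ.* X) ℤ.- (X ℤ.* Y ℤ.+ 1ℤ))
        identity = solve-∀

      triangle₂-coefficient :
        coefficient w j k ℤ.* coefficient (w · transpose j k) i j
          ≡ coefficient w i k ℤ.* coefficient (w · transpose i k) j k
              ℤ.+ coefficient w i j ℤ.* coefficient (w · transpose i j) i k
      triangle₂-coefficient = quadruple _ _ _ _ _ _
        (double-coefficient w j≢k refl refl)
        (double-coefficient (w · transpose j k) i≢j
          (cong (w ⟨$⟩ʳ_) (transpose-mismatch i≢j i≢k)) (cong (w ⟨$⟩ʳ_) (transpose-matchˡ j k)))
        (double-coefficient w i≢k refl refl)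
        (double-coefficient (w · transpose i k) j≢k
          (cong (w ⟨$⟩ʳ_) (transpose-mismatch (≢-sym i≢j) j≢k)) (cong (w ⟨$⟩ʳ_) (transpose-matchʳ i k)))
        (double-coefficient w i≢j refl refl)
        (double-coefficient (w · transpose i j) i≢k
          (cong (w ⟨$⟩ʳ_) (transpose-matchˡ i j)) (cong (w ⟨$⟩ʳ_) (transpose-mismatch (≢-sym i≢k) (≢-sym j≢k))))
        (trans (cancel _ _ _ _ _ _ ijk (sym xyz) (identity (sg i j) (sg j k) (sg i k) (sg x y) (sg y z) (sg x z)))
          (cong (λ c → (sg i k ℤ.- sg x z) ℤ.* (sg j k ℤ.- c) ℤ.+ (sg i j ℤ.- sg x y) ℤ.* (sg i k ℤ.- sg y z)) (sym (sg-anti x y))))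
        where
        identity : ∀ p q r X Y Z →
          (q ℤ.- Y) ℤ.* (p ℤ.- Z) ℤ.- ((r ℤ.- Z) ℤ.* (q ℤ.- ℤ.- X) ℤ.+ (p ℤ.- X) ℤ.* (r ℤ.- Y))
            ≡ ((p ℤ.* q ℤ.+ 1ℤ) ℤ.- (q ℤ.* r ℤ.+ r ℤ.* p)) ℤ.+ ((Y ℤ.* Z ℤ.+ Z ℤ.* X) ℤ.- (X ℤ.* Y ℤ.+ 1ℤ))
        identity = solve-∀

  conjugate-eval : ∀ (φ : Functional n) w σ {i j a b} → σ ⟨$⟩ʳ i ≡ a → σ ⟨$⟩ʳ j ≡ b →
    eval φ (w · σ · transpose i j) ≡ eval φ (w · transpose a b · σ)
  conjugate-eval φ w σ {i} {j} refl refl =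
    resp φ {w · σ · transpose i j} {w · transpose (σ ⟨$⟩ʳ i) (σ ⟨$⟩ʳ j) · σ}
      (·-congʳ w {σ · transpose i j} {transpose (σ ⟨$⟩ʳ i) (σ ⟨$⟩ʳ j) · σ} (conjugate-transpose σ i j))

  -- For the triangle relations: all three products move w to the same permutation, so φ takes one
  -- common value and only the coefficients have to be compared.
  add-terms : ∀ {a} b c {x y z : ℤ} → a ≡ b ℤ.+ c → x ≡ y → x ≡ z → a ℤ.* x ≡ b ℤ.* y ℤ.+ c ℤ.* z
  add-terms b c {x} refl refl refl = ℤ.*-distribʳ-+ x b c

  FKRelation-sound : ∀ {a b} → FKRelation a b → ∀ φ → a ▷ φ ≗ b ▷ φ
  FKRelation-sound (square {i} {j} _) φ w =
    trans (bracket-bracket i j i j φ w)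
      (cong (ℤ._* eval φ (w · transpose i j · transpose i j)) (square-coefficient w i j))
  FKRelation-sound (commute {i} {j} {k} {l}
      ((i≢j ∷ i≢k ∷ i≢l ∷ []) ∷ (j≢k ∷ j≢l ∷ []) ∷ (k≢l ∷ []) ∷ [] ∷ [])) φ w = begin
    eval ((bracket i j * bracket k l) ▷ φ) w
      ≡⟨ bracket-bracket i j k l φ w ⟩
    coefficient w i j ℤ.* coefficient (w · transpose i j) k l ℤ.* eval φ (w · transpose i j · transpose k l)
      ≡⟨ cong₂ ℤ._*_
           (trans (cong₂ ℤ._*_
             (coefficient-local w (w · transpose k l) i≢j
               (cong (w ⟨$⟩ʳ_) (sym (transpose-mismatch i≢k i≢l))) (cong (w ⟨$⟩ʳ_) (sym (transpose-mismatch j≢k j≢l))))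
             (coefficient-local (w · transpose i j) w k≢l (cong (w ⟨$⟩ʳ_) fix-k) (cong (w ⟨$⟩ʳ_) fix-l)))
             (ℤ.*-comm (coefficient (w · transpose k l) i j) _))
           (conjugate-eval φ w (transpose i j) fix-k fix-l) ⟩
    coefficient w k l ℤ.* coefficient (w · transpose k l) i j ℤ.* eval φ (w · transpose k l · transpose i j)
      ≡⟨ bracket-bracket k l i j φ w ⟨
    eval ((bracket k l * bracket i j) ▷ φ) w ∎
    where
    open ≡-Reasoning
    fix-k = transpose-mismatch (≢-sym i≢k) (≢-sym j≢k)
    fix-l = transpose-mismatch (≢-sym i≢l) (≢-sym j≢l)
  FKRelation-sound (triangle₁ {i} {j} {k} ((i≢j ∷ i≢k ∷ []) ∷ (j≢k ∷ []) ∷ [] ∷ [])) φ w =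
    trans (bracket-bracket i j j k φ w)
      (trans (add-terms (coefficient w j k ℤ.* coefficient (w · transpose j k) i k) (coefficient w i k ℤ.* coefficient (w · transpose i k) i j)
               (triangle₁-coefficient w i≢j i≢k j≢k)
               (sym (conjugate-eval φ w (transpose j k) (transpose-mismatch i≢j i≢k) (transpose-matchʳ j k)))
               (conjugate-eval φ w (transpose i j) (transpose-matchʳ i j) (transpose-mismatch (≢-sym i≢k) (≢-sym j≢k))))
        (sym (cong₂ ℤ._+_ (bracket-bracket j k i k φ w) (bracket-bracket i k i j φ w))))
  FKRelation-sound (triangle₂ {i} {j} {k} ((i≢j ∷ i≢k ∷ []) ∷ (j≢k ∷ []) ∷ [] ∷ [])) φ w =
    trans (bracket-bracket j k i j φ w)
      (trans (add-terms (coefficient w i k ℤ.* coefficient (w · transpose i k) j k) (coefficient w i j ℤ.* coefficient (w · transpose i j) i k)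
               (triangle₂-coefficient w i≢j i≢k j≢k)
               (conjugate-eval φ w (transpose j k) (transpose-mismatch i≢j i≢k) (transpose-matchˡ j k))
               (sym (conjugate-eval φ w (transpose i j) (transpose-matchˡ i j) (transpose-mismatch (≢-sym i≢k) (≢-sym j≢k)))))
        (sym (cong₂ ℤ._+_ (bracket-bracket i k j k φ w) (bracket-bracket i j i k φ w))))

substitute-var : {X : Set} (a : Term X) → substitute var a ≡ a
substitute-var (var x) = refl
substitute-var 0#      = refl
substitute-var 1#      = refl
substitute-var (a + b) = cong₂ _+_ (substitute-var a) (substitute-var b)
substitute-var (a * b) = cong₂ _*_ (substitute-var a) (substitute-var b)
substitute-var (- a)   = cong -_ (substitute-var a)

FK-sound : {a b : Term (Generator n)} → a FK.≈ b → let open Action (bruhat {n}) in ∀ φ → a ▷ φ ≗ b ▷ φ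
FK-sound {n} {a} {b} a≈b φ w = subst₂ (λ a b → eval (a ▷ φ) w ≡ eval (b ▷ φ) w) (substitute-var a) (substitute-var b)
  (▷-sound var (λ {a} {b} r φ → subst₂ (λ a b → a ▷ φ ≗ b ▷ φ) (sym (substitute-var a)) (sym (substitute-var b))
    (FKRelation-sound r φ)) a≈b φ w)
  where open Action (bruhat {n})

-- Divided differences

module _ {X : Set} {R : Term X → Term X → Set} (comm-var : ∀ x y → Congruence R (var x * var y) (var y * var x)) where

  private
    infix 4 _≈_
    _≈_ = Congruence R
    module R = Ring ⟨ X ∣ R ⟩
    open import Algebra.Properties.Ring ⟨ X ∣ R ⟩ using (-‿distribˡ-*; -‿distribʳ-*)

  centralise : ∀ b → (∀ x → var x * b ≈ b * var x) → ∀ a → a * b ≈ b * a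
  centralise b central (var x) = central x
  centralise b central 0#      = R.trans (R.zeroˡ b) (R.sym (R.zeroʳ b))
  centralise b central 1#      = R.trans (R.*-identityˡ b) (R.sym (R.*-identityʳ b))
  centralise b central (a + c) = R.trans (R.distribʳ b a c)
    (R.trans (R.+-cong (centralise b central a) (centralise b central c)) (R.sym (R.distribˡ b a c)))
  centralise b central (a * c) = R.trans (R.*-assoc a c b) (R.trans (R.*-congˡ (centralise b central c))
    (R.trans (R.sym (R.*-assoc a b c)) (R.trans (R.*-congʳ (centralise b central a)) (R.*-assoc b a c))))
  centralise b central (- a)   = R.trans (R.sym (-‿distribˡ-* a b))
    (R.trans (R.-‿cong (centralise b central a)) (-‿distribʳ-* b a))

  -- `centralise` is applied twice: variables commute with every term, and therefore every term
  -- commutes with every other.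
  comm-term : ∀ a b → a * b ≈ b * a
  comm-term a b = centralise b (λ x → R.sym (centralise (var x) (λ y → comm-var y x) b)) a

ℤ[x]-commutativeRing : ℕ → CommutativeRing 0ℓ 0ℓ
ℤ[x]-commutativeRing n = record
  { isCommutativeRing = record
    { isRing = Ring.isRing (ℤ[x] n)
    ; *-comm = comm-term λ i j → rel (comm i j)
    }
  }

module _ {n : ℕ} where

  open CommutativeRing (ℤ[x]-commutativeRing n) using (_≈_)
  open import Algebra.Solver.Ring.NaturalCoefficients.Default
    (CommutativeRing.commutativeSemiring (ℤ[x]-commutativeRing n)) using (solve; _:+_; _:*_; _:=_)
  open import Algebra.Properties.Ring (ℤ[x] n) using (-‿+-comm; -‿distribʳ-*; -0#≈0#)
  private module R = CommutativeRing (ℤ[x]-commutativeRing n)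
  open import Relation.Binary.Reasoning.Setoid R.setoid

  substitute-cong : (σ : Fin n → Term (Fin n)) → ∀ {a b} → a ≈ b → substitute σ a ≈ substitute σ b
  substitute-cong σ (rel (comm i j))       = R.*-comm (σ i) (σ j)
  substitute-cong σ Congruence.refl        = R.refl
  substitute-cong σ (Congruence.sym p)     = R.sym (substitute-cong σ p)
  substitute-cong σ (Congruence.trans p q) = R.trans (substitute-cong σ p) (substitute-cong σ q)
  substitute-cong σ (+-cong p q)           = +-cong (substitute-cong σ p) (substitute-cong σ q)
  substitute-cong σ (*-cong p q)           = *-cong (substitute-cong σ p) (substitute-cong σ q)
  substitute-cong σ (neg-cong p)           = neg-cong (substitute-cong σ p)
  substitute-cong σ (+-assoc a b c)        = +-assoc _ _ _
  substitute-cong σ (+-comm a b)           = +-comm _ _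
  substitute-cong σ (+-identityˡ a)        = +-identityˡ _
  substitute-cong σ (+-identityʳ a)        = +-identityʳ _
  substitute-cong σ (+-inverseˡ a)         = +-inverseˡ _
  substitute-cong σ (+-inverseʳ a)         = +-inverseʳ _
  substitute-cong σ (*-assoc a b c)        = *-assoc _ _ _
  substitute-cong σ (*-identityˡ a)        = *-identityˡ _
  substitute-cong σ (*-identityʳ a)        = *-identityʳ _
  substitute-cong σ (distribˡ a b c)       = distribˡ _ _ _
  substitute-cong σ (distribʳ a b c)       = distribʳ _ _ _

  -- The hypothesis on variables says that d is (x - σ x)/π, and `decompose` extends this to all
  -- terms. There are two instances with π = x_k - x_l: the exchange of x_k and x_l, which gives
  -- ∂_k, and the substitution of x_l for x_k, which gives a left inverse of multiplication by π.
  module Twisted (σ d : Fin n → Term (Fin n)) (π : Term (Fin n)) (split : ∀ i → var i ≈ σ i + π * d i) where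

    private
      S D : Term (Fin n) → Term (Fin n)
      S = substitute σ
      D = twisted σ d

    decompose : ∀ f → f ≈ S f + π * D f
    decompose (var i) = split i
    decompose 0#      = R.sym (R.trans (+-identityˡ (π * 0#)) (R.zeroʳ π))
    decompose 1#      = R.sym (R.trans (R.+-congˡ (R.zeroʳ π)) (+-identityʳ 1#))
    decompose (f + g) = R.trans (+-cong (decompose f) (decompose g))
      (solve 5 (λ p a b c e → (a :+ p :* b) :+ (c :+ p :* e) := (a :+ c) :+ p :* (b :+ e)) R.refl π (S f) (D f) (S g) (D g))
    decompose (- f)   = R.trans (neg-cong (decompose f))
      (R.trans (R.sym (-‿+-comm (S f) (π * D f))) (R.+-congˡ (-‿distribʳ-* π (D f))))
    decompose (f * g) = begin
      f * g
        ≈⟨ *-cong (decompose f) R.refl ⟩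
      (S f + π * D f) * g
        ≈⟨ solve 4 (λ p a b c → (a :+ p :* b) :* c := a :* c :+ p :* (b :* c)) R.refl π (S f) (D f) g ⟩
      S f * g + π * (D f * g)
        ≈⟨ R.+-congʳ (R.*-congˡ (decompose g)) ⟩
      S f * (S g + π * D g) + π * (D f * g)
        ≈⟨ solve 5 (λ p a b c e → a :* (b :+ p :* c) :+ p :* e := a :* b :+ p :* (e :+ a :* c)) R.refl π (S f) (S g) (D g) (D f * g) ⟩
      S f * S g + π * (D f * g + S f * D g) ∎

    -- The Leibniz rule treats the two factors asymmetrically, so the relation x_i x_j = x_j x_i is
    -- the critical case. It becomes symmetric once the untwisted variable is rewritten by `split`.
    twisted-cong : ∀ {a b} → a ≈ b → D a ≈ D b
    twisted-cong (rel (comm i j)) = begin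
      d i * var j + σ i * d j
        ≈⟨ R.+-congʳ (R.*-congˡ (split j)) ⟩
      d i * (σ j + π * d j) + σ i * d j
        ≈⟨ solve 5 (λ p a b c e → a :* (b :+ p :* c) :+ e :* c := c :* (e :+ p :* a) :+ b :* a) R.refl π (d i) (σ j) (d j) (σ i) ⟩
      d j * (σ i + π * d i) + σ j * d i
        ≈⟨ R.+-congʳ (R.*-congˡ (split i)) ⟨
      d j * var i + σ j * d i ∎
    twisted-cong Congruence.refl        = R.refl
    twisted-cong (Congruence.sym p)     = R.sym (twisted-cong p)
    twisted-cong (Congruence.trans p q) = R.trans (twisted-cong p) (twisted-cong q)
    twisted-cong (+-cong p q)           = +-cong (twisted-cong p) (twisted-cong q)
    twisted-cong (*-cong p q)           = +-cong (*-cong (twisted-cong p) q) (*-cong (substitute-cong σ p) (twisted-cong q))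
    twisted-cong (neg-cong p)           = neg-cong (twisted-cong p)
    twisted-cong (+-assoc a b c)        = +-assoc _ _ _
    twisted-cong (+-comm a b)           = +-comm _ _
    twisted-cong (+-identityˡ a)        = +-identityˡ _
    twisted-cong (+-identityʳ a)        = +-identityʳ _
    twisted-cong (+-inverseˡ a)         = +-inverseˡ _
    twisted-cong (+-inverseʳ a)         = +-inverseʳ _
    twisted-cong (*-assoc a b c)        =
      solve 7 (λ a b c sa sb db dc → (a :* b :+ sa :* db) :* c :+ (sa :* sb) :* dc := a :* (b :* c) :+ sa :* (db :* c :+ sb :* dc)) R.refl (D a) b c (S a) (S b) (D b) (D c)
    twisted-cong (*-identityˡ a)        = R.trans (R.+-cong (R.zeroˡ a) (*-identityˡ (D a))) (+-identityˡ (D a))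
    twisted-cong (*-identityʳ a)        = R.trans (R.+-cong (*-identityʳ (D a)) (R.zeroʳ (S a))) (+-identityʳ (D a))
    twisted-cong (distribˡ a b c)       =
      solve 6 (λ a b c sa db dc → a :* (b :+ c) :+ sa :* (db :+ dc) := (a :* b :+ sa :* db) :+ (a :* c :+ sa :* dc)) R.refl
        (D a) b c (S a) (D b) (D c)
    twisted-cong (distribʳ a b c)       =
      solve 6 (λ a db dc da sb sc → (db :+ dc) :* a :+ (sb :+ sc) :* da := (db :* a :+ sb :* da) :+ (dc :* a :+ sc :* da)) R.refl
        a (D b) (D c) (D a) (S b) (S c)

  open import Algebra.Properties.AbelianGroup R.+-abelianGroup using (xyx⁻¹≈y; ⁻¹-anti-homo-//)

  restore : ∀ a b → a ≈ b + (a - b)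
  restore a b = R.sym (R.trans (R.sym (+-assoc b a (- b))) (xyx⁻¹≈y b a))

  restore-neg : ∀ a b → b ≈ a + (a - b) * - 1#
  restore-neg a b = R.trans (restore b a) (R.+-congˡ (R.sym (R.trans (R.sym (-‿distribʳ-* (a - b) 1#))
    (R.trans (neg-cong (*-identityʳ (a - b))) (⁻¹-anti-homo-// a b)))))

  no-change : ∀ a b → a ≈ a + b * 0#
  no-change a b = R.sym (R.trans (R.+-congˡ (R.zeroʳ b)) (+-identityʳ a))

  module _ {k l : Fin n} (k≢l : k ≢ l) where

    private
      π : Term (Fin n)
      π = var k - var l

    exchange-split : ∀ i → var i ≈ exchange k l i + π * slope k l i
    exchange-split i = cases (i ≟ k) (i ≟ l)
      where
      s = transpose k l
      cases : (p : Dec (i ≡ k)) (q : Dec (i ≡ l)) →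
              var i ≈ var (s ⟨$⟩ʳ i) + π * (if does p then 1# else if does q then - 1# else 0#)
      cases (yes refl) _ rewrite transpose-matchˡ k l = R.trans (restore (var k) (var l)) (R.+-congˡ (R.sym (*-identityʳ π)))
      cases (no _) (yes refl) rewrite transpose-matchʳ k l = restore-neg (var k) (var l)
      cases (no i≢k) (no i≢l) rewrite transpose-mismatch i≢k i≢l = no-change (var i) π

    module ∂ = Twisted (exchange k l) (slope k l) π exchange-split

    -- Since R((x_k - x_l) g) = g for the derivation R of f ↦ (f - f|_{x_k = x_l}) / (x_k - x_l),
    -- multiplication by x_k - x_l is injective.
    private
      merge unit : Fin n → Term (Fin n)
      merge i = if does (i ≟ k) then var l else var i
      unit  i = if does (i ≟ k) then 1# else 0#
      merge-split : ∀ i → var i ≈ merge i + π * unit i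
      merge-split i with i ≟ k
      ... | yes refl = R.trans (restore (var k) (var l)) (R.+-congˡ (R.sym (*-identityʳ π)))
      ... | no  _    = no-change (var i) π
      module R′ = Twisted merge unit π merge-split
      R-cancel : ∀ g → twisted merge unit (π * g) ≈ g
      R-cancel g = R.trans (R.+-cong
        (R.trans (R.*-congʳ (R.trans (R.+-cong unit-k (neg-cong unit-l)) (R.trans (R.+-congˡ -0#≈0#) (+-identityʳ 1#)))) (*-identityˡ g))
        (R.trans (R.*-congʳ (R.trans (R.+-cong merge-k (neg-cong merge-l)) (+-inverseʳ (var l)))) (R.zeroˡ _)))
        (+-identityʳ g)
        where
        unit-k : unit k ≈ 1#
        unit-k rewrite dec-true (k ≟ k) refl = R.refl
        unit-l : unit l ≈ 0#
        unit-l rewrite dec-false (l ≟ k) (≢-sym k≢l) = R.refl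
        merge-k : merge k ≈ var l
        merge-k rewrite dec-true (k ≟ k) refl = R.refl
        merge-l : merge l ≈ var l
        merge-l rewrite dec-false (l ≟ k) (≢-sym k≢l) = R.refl

    cancel-difference : ∀ g h → π * g ≈ π * h → g ≈ h
    cancel-difference g h eq = R.trans (R.sym (R-cancel g)) (R.trans (R′.twisted-cong eq) (R-cancel h))

    difference-∂ : ∀ f → π * ∂ k l f ≈ f - swap k l f
    difference-∂ f = R.sym (R.trans (R.+-congʳ (∂.decompose f)) (xyx⁻¹≈y (swap k l f) (π * ∂ k l f)))

    divided-difference-unique : ∀ f g → IsDividedDifference k l f g → g ≈ ∂ k l f
    divided-difference-unique f g div = cancel-difference g (∂ k l f) (R.trans div (R.sym (difference-∂ f)))

-- The covering action

infixr 7 _⊙_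
_⊙_ : ℤ → Functional n → Functional n
c ⊙ φ = record
  { eval = λ w → c ℤ.* eval φ w
  ; resp = λ {u} {v} u≈v → cong (ℤ._*_ c) (resp φ {u} {v} u≈v)
  }

ℓ-id : ℓ {n} idₚ ≡ 0
ℓ-id {n} = cong length (List.filter-none (λ (a , b) → b <ᶠ? a)
  (All.map ℕ.<-asym (all-filter (uncurry _<ᶠ?_) (cartesianProduct (allFin n) (allFin n)))))

constant : Term (Fin n) → ℤ
constant (var _) = 0ℤ
constant 0#      = 0ℤ
constant 1#      = 1ℤ
constant (f + g) = constant f ℤ.+ constant g
constant (f * g) = constant f ℤ.* constant g
constant (- f)   = ℤ.- constant f

module _ (K : Kernel n) where

  open Kernel K
  open Action K

  ▷-⊙ : ∀ a c φ → a ▷ (c ⊙ φ) ≗ c ⊙ (a ▷ φ)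
  ▷-⊙ (var (gen i j _)) c φ w = exchange-factors (κ w i j) c _
    where
    exchange-factors : ∀ a b x → a ℤ.* (b ℤ.* x) ≡ b ℤ.* (a ℤ.* x)
    exchange-factors = solve-∀
  ▷-⊙ 0#      c φ w = sym (ℤ.*-zeroʳ c)
  ▷-⊙ 1#      c φ w = refl
  ▷-⊙ (a + b) c φ w = trans (cong₂ ℤ._+_ (▷-⊙ a c φ w) (▷-⊙ b c φ w)) (sym (ℤ.*-distribˡ-+ c (eval (a ▷ φ) w) _))
  ▷-⊙ (a * b) c φ w = trans (▷-cong a (▷-⊙ b c φ) w) (▷-⊙ a c (b ▷ φ) w)
  ▷-⊙ (- a)   c φ w = trans (cong ℤ.-_ (▷-⊙ a c φ w)) (ℤ.neg-distribʳ-* c (eval (a ▷ φ) w))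

  module _ (κ-id : ∀ i j → κ idₚ i j ≡ 0ℤ) where

    θ-▷-id : ∀ i φ → eval (θ i ▷ φ) idₚ ≡ 0ℤ
    θ-▷-id i φ = trans (θ-▷ i φ idₚ) (sum-0 (λ j → sg i j ℤ.* κ idₚ i j ℤ.* eval φ (idₚ · transpose i j)) λ j →
      cong (ℤ._* eval φ (idₚ · transpose i j)) (trans (cong (ℤ._*_ (sg i j)) (κ-id i j)) (ℤ.*-zeroʳ (sg i j))))

    -- No transposition lowers the identity, so each θ_i acts by zero there and only the constant
    -- term survives. This holds for both kernels and gives the base case in which G and H agree.
    evalθ-▷-id : ∀ f φ → eval (evalθ f ▷ φ) idₚ ≡ constant f ℤ.* eval φ idₚ
    evalθ-▷-id (var i) φ = θ-▷-id i φ
    evalθ-▷-id 0#      φ = refl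
    evalθ-▷-id 1#      φ = sym (ℤ.*-identityˡ _)
    evalθ-▷-id (f + g) φ = trans (cong₂ ℤ._+_ (evalθ-▷-id f φ) (evalθ-▷-id g φ))
      (sym (ℤ.*-distribʳ-+ (eval φ idₚ) (constant f) (constant g)))
    evalθ-▷-id (f * g) φ = trans (evalθ-▷-id f (evalθ g ▷ φ))
      (trans (cong (ℤ._*_ (constant f)) (evalθ-▷-id g φ)) (sym (ℤ.*-assoc (constant f) _ _)))
    evalθ-▷-id (- f)   φ = trans (cong ℤ.-_ (evalθ-▷-id f φ)) (ℤ.neg-distribˡ-* (constant f) _)

bruhat-id : ∀ i j → Kernel.κ (bruhat {n}) idₚ i j ≡ 0ℤ
bruhat-id {n} i j = 𝟙-no (ℓ (idₚ · transpose i j) ℕ.<? ℓ {n} idₚ)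
  λ p → ℕ.n≮0 (subst (ℓ (idₚ · transpose i j) ℕ.<_) (ℓ-id {n}) p)

covering-id : ∀ i j → Kernel.κ (covering {n}) idₚ i j ≡ 0ℤ
covering-id {n} i j = 𝟙-no (suc (ℓ (idₚ · transpose i j)) ℕ.≟ ℓ {n} idₚ)
  λ p → contradiction (trans p (ℓ-id {n})) λ ()

-- Commutativity of the Dunkl elements in the covering action, and the pairing with Schubert classes

module _ {n : ℕ} where

  open Action (covering {n})

  Commute-at : Permutation′ n → Set
  Commute-at w = ∀ i j φ → eval (θ i ▷ θ j ▷ φ) w ≡ eval (θ j ▷ θ i ▷ φ) w

  -- The commutation rule is applied to x_i x_j. Its second-order part is symmetric in i and j by
  -- the hypothesis at w. Its first-order part e_i A_j + e_j A_(s i) is symmetric because A_(s i) =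
  -- A_i - e_i (A_k - A_l), which is `reflect`.
  commute-step : ∀ w {k l} → Consecutive k l → (w ⟨$⟩ʳ k) <ᶠ (w ⟨$⟩ʳ l) → Commute-at w → Commute-at (w · transpose k l)
  commute-step w {k} {l} k⋖l wk<wl comm-w i j φ = begin
    eval (θ i ▷ θ j ▷ φ) (w · s)
      ≡⟨ expand i j ⟩
    eval (θ (s ⟨$⟩ʳ i) ▷ θ (s ⟨$⟩ʳ j) ▷ τ φ) w ℤ.+ (e i ℤ.* A j ℤ.+ e j ℤ.* A (s ⟨$⟩ʳ i))
      ≡⟨ cong₂ ℤ._+_ (comm-w (s ⟨$⟩ʳ i) (s ⟨$⟩ʳ j) (τ φ)) symmetric ⟩
    eval (θ (s ⟨$⟩ʳ j) ▷ θ (s ⟨$⟩ʳ i) ▷ τ φ) w ℤ.+ (e j ℤ.* A i ℤ.+ e i ℤ.* A (s ⟨$⟩ʳ j))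
      ≡⟨ expand j i ⟨
    eval (θ j ▷ θ i ▷ φ) (w · s) ∎
    where
    open ≡-Reasoning
    open TwistedAction (covering-twist k⋖l)
    s = transpose k l
    k≢l = consecutive-≢ k⋖l
    e A : Fin n → ℤ
    e i = δ i k ℤ.- δ i l
    A i = eval (θ i ▷ φ) w
    expand : ∀ i j → eval (θ i ▷ θ j ▷ φ) (w · s)
      ≡ eval (θ (s ⟨$⟩ʳ i) ▷ θ (s ⟨$⟩ʳ j) ▷ τ φ) w ℤ.+ (e i ℤ.* A j ℤ.+ e j ℤ.* A (s ⟨$⟩ʳ i))
    expand i j = begin
      eval (θ i ▷ θ j ▷ φ) (w · s)
        ≡⟨ ℤ.*-identityˡ (eval (θ i ▷ θ j ▷ φ) (w · s)) ⟨
      1ℤ ℤ.* eval (θ i ▷ θ j ▷ φ) (w · s)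
        ≡⟨ cong (ℤ._* eval (θ i ▷ θ j ▷ φ) (w · s)) (𝟙-yes (ℓ w ℕ.<? ℓ (w · s)) (ℕ.≤-reflexive (sym (ℓ-simple-up w k⋖l wk<wl)))) ⟨
      eval (τ (θ i ▷ θ j ▷ φ)) w
        ≡⟨ τ-evalθ (var i * var j) φ w ⟩
      eval (θ (s ⟨$⟩ʳ i) ▷ θ (s ⟨$⟩ʳ j) ▷ τ φ) w ℤ.+
        (eval (evalθ (slope k l i) ▷ θ j ▷ φ) w ℤ.+ eval (θ (s ⟨$⟩ʳ i) ▷ evalθ (slope k l j) ▷ φ) w)
        ≡⟨ cong (ℤ._+_ (eval (θ (s ⟨$⟩ʳ i) ▷ θ (s ⟨$⟩ʳ j) ▷ τ φ) w)) (cong₂ ℤ._+_ (slope-▷ i (θ j ▷ φ) w)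
             (trans (▷-cong (θ (s ⟨$⟩ʳ i)) {evalθ (slope k l j) ▷ φ} {e j ⊙ φ} (slope-▷ j φ) w)
                    (▷-⊙ covering (θ (s ⟨$⟩ʳ i)) (e j) φ w))) ⟩
      eval (θ (s ⟨$⟩ʳ i) ▷ θ (s ⟨$⟩ʳ j) ▷ τ φ) w ℤ.+ (e i ℤ.* A j ℤ.+ e j ℤ.* A (s ⟨$⟩ʳ i)) ∎
    reflect : ∀ i → A (s ⟨$⟩ʳ i) ≡ A i ℤ.- e i ℤ.* (A k ℤ.- A l)
    reflect i = cases (i ≟ k) (i ≟ l)
      where
      cases : (p : Dec (i ≡ k)) (q : Dec (i ≡ l)) → A (s ⟨$⟩ʳ i) ≡ A i ℤ.- (𝟙 p ℤ.- 𝟙 q) ℤ.* (A k ℤ.- A l)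
      cases (yes refl) (yes k≡l) = contradiction k≡l k≢l
      cases (yes refl) (no _) = trans (cong A (transpose-matchˡ k l)) (at-k (A k) (A l))
        where
        at-k : ∀ a b → b ≡ a ℤ.- 1ℤ ℤ.* (a ℤ.- b)
        at-k = solve-∀
      cases (no _) (yes refl) = trans (cong A (transpose-matchʳ k l)) (at-l (A k) (A l))
        where
        at-l : ∀ a b → a ≡ b ℤ.- -1ℤ ℤ.* (a ℤ.- b)
        at-l = solve-∀
      cases (no i≢k) (no i≢l) = trans (cong A (transpose-mismatch i≢k i≢l)) (sym (ℤ.+-identityʳ (A i)))
    symmetric : e i ℤ.* A j ℤ.+ e j ℤ.* A (s ⟨$⟩ʳ i) ≡ e j ℤ.* A i ℤ.+ e i ℤ.* A (s ⟨$⟩ʳ j)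
    symmetric rewrite reflect i | reflect j = identity (e i) (e j) (A i) (A j) (A k ℤ.- A l)
      where
      identity : ∀ x y a b c → x ℤ.* b ℤ.+ y ℤ.* (a ℤ.- x ℤ.* c) ≡ y ℤ.* a ℤ.+ x ℤ.* (b ℤ.- y ℤ.* c)
      identity = solve-∀

  θ-commute : ∀ w → Commute-at w
  θ-commute = ascent-induction Commute-at
    (λ {u} {v} u≈v comm-u i j φ → trans (sym (resp (θ i ▷ θ j ▷ φ) {u} {v} u≈v))
      (trans (comm-u i j φ) (resp (θ j ▷ θ i ▷ φ) {u} {v} u≈v)))
    (λ i j φ → trans (θ-▷-id covering covering-id i (θ j ▷ φ)) (sym (θ-▷-id covering covering-id j (θ i ▷ φ))))
    (λ w → commute-step w)

  indicator : Permutation′ n → Functional n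
  indicator v = record
    { eval = λ w → 𝟙 (w ≈ₚ? v)
    ; resp = λ {u} {u′} u≈u′ → 𝟙-cong (u ≈ₚ? v) (u′ ≈ₚ? v)
        (λ u≈v i → trans (sym (u≈u′ i)) (u≈v i)) (λ u′≈v i → trans (u≈u′ i) (u′≈v i))
    }

  -- h f w is the pairing of the cohomology class of f with [X(w)].
  h : Term (Fin n) → Functional n
  h f = evalθ f ▷ indicator idₚ

  h-sound : ∀ {f g} → f ℤ[x].≈ g → h f ≗ h g
  h-sound f≈g = ▷-sound θ (λ { (comm i j) φ w → θ-commute w i j φ }) f≈g (indicator idₚ)

  module _ {k l : Fin n} (k⋖l : Consecutive k l) where

    open TwistedAction (covering-twist k⋖l)

    -- The term with s f in the commutation rule disappears: τ applied to the indicator of the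
    -- identity is nonzero at u only if us is the identity and u is shorter than us, which is
    -- impossible.
    h-∂ : ∀ f w → eval (h (∂ k l f)) w ≡ ascending k⋖l w ℤ.* eval (h f) (w · transpose k l)
    h-∂ f w = sym (trans (τ-evalθ f (indicator idₚ) w)
      (trans (cong (ℤ._+ eval (h (∂ k l f)) w) (trans
        (▷-cong (evalθ (swap k l f)) {τ (indicator idₚ)} {0ℤ ⊙ indicator idₚ} vanish w)
        (▷-⊙ covering (evalθ (swap k l f)) 0ℤ (indicator idₚ) w)))
        (ℤ.+-identityˡ _)))
      where
      vanish : ∀ u → ascending k⋖l u ℤ.* 𝟙 ((u · transpose k l) ≈ₚ? idₚ) ≡ 0ℤ
      vanish u = cases ((u · transpose k l) ≈ₚ? idₚ)
        where
        cases : (p? : Dec (u · transpose k l ≈ₚ idₚ)) → ascending k⋖l u ℤ.* 𝟙 p? ≡ 0ℤ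
        cases (no _)  = ℤ.*-zeroʳ (ascending k⋖l u)
        cases (yes p) = cong (ℤ._* 1ℤ) (𝟙-no (ℓ u ℕ.<? ℓ (u · transpose k l)) λ up →
          ℕ.n≮0 (subst (ℓ u ℕ.<_) (trans (ℓ-cong {u = u · transpose k l} {idₚ} p) (ℓ-id {n})) up))

-- Evaluation on formal combinations

extend : Functional n → Comb n → ℤ
extend φ x = sumᴸ x λ (c , u) → c ℤ.* eval φ u

module _ {n : ℕ} (φ : Functional n) where

  extend-basis : ∀ u → extend φ (basis u) ≡ eval φ u
  extend-basis u = trans (ℤ.+-identityʳ _) (ℤ.*-identityˡ (eval φ u))

  extend-scale : ∀ c x → extend φ (scale c x) ≡ c ℤ.* extend φ x
  extend-scale c x = trans (sumᴸ-map (λ (d , u) → (c ℤ.* d , u)) x (λ (d , u) → d ℤ.* eval φ u))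
    (trans (sumᴸ-cong x (λ (d , u) → ℤ.*-assoc c d (eval φ u))) (sumᴸ-scale c x (λ (d , u) → d ℤ.* eval φ u)))

  extend-++ : ∀ x y → extend φ (x ++ y) ≡ extend φ x ℤ.+ extend φ y
  extend-++ x y = sumᴸ-++ x y (λ (c , u) → c ℤ.* eval φ u)

  extend-neg : ∀ x → extend φ (scale -1ℤ x) ≡ ℤ.- extend φ x
  extend-neg x = trans (extend-scale -1ℤ x) (ℤ.-1*i≡-i (extend φ x))

  extend-⊖ : ∀ x y → extend φ (x ⊖ y) ≡ extend φ x ℤ.- extend φ y
  extend-⊖ x y = trans (extend-++ x (scale -1ℤ y)) (cong (ℤ._+_ (extend φ x)) (extend-neg y))

  extend-linear : ∀ F x {φ′ : Functional n} → (∀ u → extend φ (F u) ≡ eval φ′ u) → extend φ (linear F x) ≡ extend φ′ x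
  extend-linear F x F≡ = trans
    (sumᴸ-concatMap (λ (c , u) → scale c (F u)) x (λ (c , u) → c ℤ.* eval φ u))
    (sumᴸ-cong x λ (c , u) → trans (extend-scale c (F u)) (cong (ℤ._*_ c) (F≡ u)))

  extend-if : {P : Set} (p? : Dec P) (x : Comb n) → extend φ (if does p? then x else []) ≡ 𝟙 p? ℤ.* extend φ x
  extend-if (yes _) x = sym (ℤ.*-identityˡ (extend φ x))
  extend-if (no  _) x = refl

extend-cong : {φ φ′ : Functional n} → φ ≗ φ′ → ∀ x → extend φ x ≡ extend φ′ x
extend-cong φ≗ x = sumᴸ-cong x λ (c , u) → cong (ℤ._*_ c) (φ≗ u)

one : Functional n
one = record { eval = λ _ → 1ℤ ; resp = λ _ → refl }

ψ-extend : (x : Comb n) → ψ x ≡ extend one x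
ψ-extend []            = refl
ψ-extend ((c , u) ∷ x) = cong₂ ℤ._+_ (sym (ℤ.*-identityʳ c)) (ψ-extend x)

coeff-extend : (v : Permutation′ n) (x : Comb n) → coeff v x ≡ extend (indicator v) x
coeff-extend v []            = refl
coeff-extend v ((c , u) ∷ x) = cases (u ≈ₚ? v)
  where
  cases : {P : Set} (p? : Dec P) →
          (if does p? then c ℤ.+ coeff v x else coeff v x) ≡ c ℤ.* 𝟙 p? ℤ.+ extend (indicator v) x
  cases (yes _) = cong₂ ℤ._+_ (sym (ℤ.*-identityʳ c)) (coeff-extend v x)
  cases (no  _) = trans (coeff-extend v x)
    (sym (trans (cong (ℤ._+ extend (indicator v) x) (ℤ.*-zeroʳ c)) (ℤ.+-identityˡ _)))

module _ {n : ℕ} where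

  open Action (bruhat {n})

  extend-⋆ : ∀ a φ x → extend φ (x ⋆ a) ≡ extend (a ▷ φ) x
  extend-⋆ (var (gen i j i<j)) φ x = extend-linear φ _ x {var (gen i j i<j) ▷ φ} λ u →
    trans (extend-if φ (ℓ (u · transpose i j) ℕ.<? ℓ u) (basis (u · transpose i j)))
      (cong (ℤ._*_ (𝟙 (ℓ (u · transpose i j) ℕ.<? ℓ u))) (extend-basis φ (u · transpose i j)))
  extend-⋆ 0#      φ x = sym (trans (sumᴸ-cong x λ (c , u) → ℤ.*-zeroʳ c) (zeros x))
    where
    zeros : {A : Set} (xs : List A) → sumᴸ xs (λ _ → 0ℤ) ≡ 0ℤ
    zeros []       = refl
    zeros (_ ∷ xs) = trans (ℤ.+-identityˡ _) (zeros xs)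
  extend-⋆ 1#      φ x = refl
  extend-⋆ (a + b) φ x = trans (extend-++ φ (x ⋆ a) (x ⋆ b)) (trans (cong₂ ℤ._+_ (extend-⋆ a φ x) (extend-⋆ b φ x))
    (sym (trans (sumᴸ-cong x λ (c , u) → ℤ.*-distribˡ-+ c (eval (a ▷ φ) u) (eval (b ▷ φ) u))
                (sumᴸ-+ x (λ (c , u) → c ℤ.* eval (a ▷ φ) u) (λ (c , u) → c ℤ.* eval (b ▷ φ) u)))))
  extend-⋆ (a * b) φ x = trans (extend-⋆ b φ (x ⋆ a)) (extend-⋆ a (b ▷ φ) x)
  extend-⋆ (- a)   φ x = trans (extend-neg φ (x ⋆ a)) (trans (cong ℤ.-_ (extend-⋆ a φ x))
    (sym (trans (sumᴸ-cong x λ (c , u) → negate c (eval (a ▷ φ) u))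
      (trans (sumᴸ-scale -1ℤ x (λ (c , u) → c ℤ.* eval (a ▷ φ) u)) (ℤ.-1*i≡-i _)))))
    where
    negate : ∀ c y → c ℤ.* (ℤ.- y) ≡ -1ℤ ℤ.* (c ℤ.* y)
    negate = solve-∀

-- CSM classes

module _ {n : ℕ} where

  open Action (covering {n})
  open Kernel (covering {n})

  -- In the sum over a < b, the pairing e_a - e_b is split and the names a, b are exchanged in the
  -- second half. Both halves combine to a sum over all a, b with sign `sg a b`, that is, to the sum
  -- of e_a θ_a, and e = `root k l` selects θ_k - θ_l.
  extend-c₁ : ∀ k l φ c → extend φ (c₁ (root k l) c) ≡ extend (evalθ (var k - var l) ▷ φ) c
  extend-c₁ k l φ c = extend-linear φ _ c {evalθ (var k - var l) ▷ φ} λ u → begin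
    extend φ (concatMap (chevalley u) (pairs n))
      ≡⟨ sumᴸ-concatMap (chevalley u) (pairs n) (λ (c , u) → c ℤ.* eval φ u) ⟩
    sumᴸ (pairs n) (λ p → extend φ (chevalley u p))
      ≡⟨ sumᴸ-cong (pairs n) (λ (a , b) → weigh u a b) ⟩
    sumᴸ (pairs n) (λ (a , b) → (e a ℤ.- e b) ℤ.* F u a b)
      ≡⟨ sumᴸ-pairs (λ (a , b) → (e a ℤ.- e b) ℤ.* F u a b) ⟩
    ∑[ a < n ] ∑[ b < n ] (𝟙 (a <ᶠ? b) ℤ.* ((e a ℤ.- e b) ℤ.* F u a b))
      ≡⟨ sum-cong-≗ (λ a → trans
           (sum-cong-≗ (λ b → split-root (𝟙 (a <ᶠ? b)) (e a) (e b) (F u a b)))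
           (sum-sub (λ b → e a ℤ.* (𝟙 (a <ᶠ? b) ℤ.* F u a b)) (λ b → e b ℤ.* (𝟙 (a <ᶠ? b) ℤ.* F u a b)))) ⟩
    ∑[ a < n ] (∑[ b < n ] (e a ℤ.* (𝟙 (a <ᶠ? b) ℤ.* F u a b)) ℤ.- ∑[ b < n ] (e b ℤ.* (𝟙 (a <ᶠ? b) ℤ.* F u a b)))
      ≡⟨ sum-sub (λ a → ∑[ b < n ] (e a ℤ.* (𝟙 (a <ᶠ? b) ℤ.* F u a b))) (λ a → ∑[ b < n ] (e b ℤ.* (𝟙 (a <ᶠ? b) ℤ.* F u a b))) ⟩
    L u ℤ.- ∑[ a < n ] ∑[ b < n ] (e b ℤ.* (𝟙 (a <ᶠ? b) ℤ.* F u a b))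
      ≡⟨ cong (ℤ._-_ (L u)) (trans (∑-comm (λ a b → e b ℤ.* (𝟙 (a <ᶠ? b) ℤ.* F u a b)))
           (sum-cong-≗ λ a → sum-cong-≗ λ b → cong (λ x → e a ℤ.* (𝟙 (b <ᶠ? a) ℤ.* x)) (F-sym u b a))) ⟩
    L u ℤ.- ∑[ a < n ] ∑[ b < n ] (e a ℤ.* (𝟙 (b <ᶠ? a) ℤ.* F u a b))
      ≡⟨ sum-sub (λ a → ∑[ b < n ] (e a ℤ.* (𝟙 (a <ᶠ? b) ℤ.* F u a b))) (λ a → ∑[ b < n ] (e a ℤ.* (𝟙 (b <ᶠ? a) ℤ.* F u a b))) ⟨
    ∑[ a < n ] (∑[ b < n ] (e a ℤ.* (𝟙 (a <ᶠ? b) ℤ.* F u a b)) ℤ.- ∑[ b < n ] (e a ℤ.* (𝟙 (b <ᶠ? a) ℤ.* F u a b)))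
      ≡⟨ sum-cong-≗ (λ a → begin
           ∑[ b < n ] (e a ℤ.* (𝟙 (a <ᶠ? b) ℤ.* F u a b)) ℤ.- ∑[ b < n ] (e a ℤ.* (𝟙 (b <ᶠ? a) ℤ.* F u a b))
             ≡⟨ sum-sub (λ b → e a ℤ.* (𝟙 (a <ᶠ? b) ℤ.* F u a b)) (λ b → e a ℤ.* (𝟙 (b <ᶠ? a) ℤ.* F u a b)) ⟨
           ∑[ b < n ] (e a ℤ.* (𝟙 (a <ᶠ? b) ℤ.* F u a b) ℤ.- e a ℤ.* (𝟙 (b <ᶠ? a) ℤ.* F u a b))
             ≡⟨ sum-cong-≗ (λ b → collect (e a) (𝟙 (a <ᶠ? b)) (𝟙 (b <ᶠ? a)) (κ u a b) (eval φ (u · transpose a b))) ⟩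
           ∑[ b < n ] (e a ℤ.* (sg a b ℤ.* κ u a b ℤ.* eval φ (u · transpose a b)))
             ≡⟨ *-distribˡ-sum (e a) (λ b → sg a b ℤ.* κ u a b ℤ.* eval φ (u · transpose a b)) ⟨
           e a ℤ.* ∑[ b < n ] (sg a b ℤ.* κ u a b ℤ.* eval φ (u · transpose a b))
             ≡⟨ cong (ℤ._*_ (e a)) (θ-▷ a φ u) ⟨
           e a ℤ.* Θ u a
             ≡⟨ spread (δ a k) (δ a l) (Θ u a) ⟩
           δ a k ℤ.* Θ u a ℤ.- δ a l ℤ.* Θ u a ∎) ⟩
    ∑[ a < n ] (δ a k ℤ.* Θ u a ℤ.- δ a l ℤ.* Θ u a)
      ≡⟨ sum-sub (λ a → δ a k ℤ.* Θ u a) (λ a → δ a l ℤ.* Θ u a) ⟩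
    ∑[ a < n ] (δ a k ℤ.* Θ u a) ℤ.- ∑[ a < n ] (δ a l ℤ.* Θ u a)
      ≡⟨ cong₂ ℤ._-_ (sum-δ k (Θ u)) (sum-δ l (Θ u)) ⟩
    Θ u k ℤ.- Θ u l ∎
    where
    open ≡-Reasoning
    e : Weight n
    e = root k l
    chevalley : Permutation′ n → Fin n × Fin n → Comb n
    chevalley u (a , b) = if does (suc (ℓ (u · transpose a b)) ℕ.≟ ℓ u)
                          then scale (pairing e a b) (basis (u · transpose a b)) else []
    F : Permutation′ n → Fin n → Fin n → ℤ
    F u a b = κ u a b ℤ.* eval φ (u · transpose a b)
    F-sym : ∀ u a b → F u a b ≡ F u b a
    F-sym u a b = cong₂ ℤ._*_ (κ-sym u a b) (resp φ {u · transpose a b} {u · transpose b a}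
      (·-congʳ u {transpose a b} {transpose b a} (transpose-comm a b)))
    L : Permutation′ n → ℤ
    L u = ∑[ a < n ] ∑[ b < n ] (e a ℤ.* (𝟙 (a <ᶠ? b) ℤ.* F u a b))
    Θ : Permutation′ n → Fin n → ℤ
    Θ u a = eval (θ a ▷ φ) u
    weigh : ∀ u a b → extend φ (chevalley u (a , b)) ≡ (e a ℤ.- e b) ℤ.* F u a b
    weigh u a b = trans (extend-if φ (suc (ℓ (u · transpose a b)) ℕ.≟ ℓ u) _)
      (trans (cong (ℤ._*_ (κ u a b)) (trans (extend-scale φ (pairing e a b) (basis (u · transpose a b)))
               (cong (ℤ._*_ (pairing e a b)) (extend-basis φ (u · transpose a b)))))
        (exchange-factors (κ u a b) (e a ℤ.- e b) (eval φ (u · transpose a b))))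
      where
      exchange-factors : ∀ x y z → x ℤ.* (y ℤ.* z) ≡ y ℤ.* (x ℤ.* z)
      exchange-factors = solve-∀
    split-root : ∀ p x y f → p ℤ.* ((x ℤ.- y) ℤ.* f) ≡ x ℤ.* (p ℤ.* f) ℤ.- y ℤ.* (p ℤ.* f)
    split-root = solve-∀
    collect : ∀ x p q f g → x ℤ.* (p ℤ.* (f ℤ.* g)) ℤ.- x ℤ.* (q ℤ.* (f ℤ.* g)) ≡ x ℤ.* ((p ℤ.- q) ℤ.* f ℤ.* g)
    collect = solve-∀
    spread : ∀ p q x → (p ℤ.- q) ℤ.* x ≡ p ℤ.* x ℤ.- q ℤ.* x
    spread = solve-∀

  module _ {k l : Fin n} (k⋖l : Consecutive k l) where

    private
      s = transpose k l
      k≢l = consecutive-≢ k⋖l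
    open TwistedAction (covering-twist k⋖l) using (slope-▷)

    extend-∂ᴴ : ∀ f c → extend (h f) (∂ᴴ k l c) ≡ extend (h (∂ k l f)) c
    extend-∂ᴴ f c = extend-linear (h f) _ c {h (∂ k l f)} λ u →
      trans (extend-if (h f) (ℓ u ℕ.<? ℓ (u · s)) (basis (u · s)))
        (trans (cong (ℤ._*_ (ascending k⋖l u)) (extend-basis (h f) (u · s))) (sym (h-∂ k⋖l f u)))

    -- By the Leibniz rule, ∂_k takes x_k - x_l to 2 and s_k changes its sign, which leaves 2f -
    -- (x_k - x_l) ∂_k f.
    h-∂-difference : ∀ f u → eval (h (∂ k l ((var k - var l) * f))) u ≡ eval (h f) u ℤ.+ eval (h (swap k l f)) u
    h-∂-difference f u = begin
      (eval (evalθ (slope k l k) ▷ h f) u ℤ.- eval (evalθ (slope k l l) ▷ h f) u)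
        ℤ.+ (eval (θ (s ⟨$⟩ʳ k) ▷ h (∂ k l f)) u ℤ.- eval (θ (s ⟨$⟩ʳ l) ▷ h (∂ k l f)) u)
        ≡⟨ cong₂ ℤ._+_
             (cong₂ ℤ._-_
               (trans (slope-▷ k (h f) u) (cong (ℤ._* eval (h f) u) (cong₂ ℤ._-_ (δ-refl k) (δ-≢ k≢l))))
               (trans (slope-▷ l (h f) u) (cong (ℤ._* eval (h f) u) (cong₂ ℤ._-_ (δ-≢ (≢-sym k≢l)) (δ-refl l)))))
             (cong₂ (λ a b → eval (θ a ▷ h (∂ k l f)) u ℤ.- eval (θ b ▷ h (∂ k l f)) u) (transpose-matchˡ k l) (transpose-matchʳ k l)) ⟩
      (1ℤ ℤ.* x ℤ.- -1ℤ ℤ.* x) ℤ.+ (y ℤ.- z)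
        ≡⟨ regroup x y z ⟩
      x ℤ.+ x ℤ.- (z ℤ.- y)
        ≡⟨ cong (ℤ._-_ (x ℤ.+ x)) (h-sound (difference-∂ k≢l f) u) ⟩
      x ℤ.+ x ℤ.- (x ℤ.- eval (h (swap k l f)) u)
        ≡⟨ simplify x (eval (h (swap k l f)) u) ⟩
      x ℤ.+ eval (h (swap k l f)) u ∎
      where
      open ≡-Reasoning
      x = eval (h f) u
      y = eval (θ l ▷ h (∂ k l f)) u
      z = eval (θ k ▷ h (∂ k l f)) u
      regroup : ∀ x y z → (1ℤ ℤ.* x ℤ.- -1ℤ ℤ.* x) ℤ.+ (y ℤ.- z) ≡ x ℤ.+ x ℤ.- (z ℤ.- y)
      regroup = solve-∀
      simplify : ∀ x y → x ℤ.+ x ℤ.- (x ℤ.- y) ≡ x ℤ.+ y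
      simplify = solve-∀

    -- On homology T_k is ∂_k - id + c₁ ∂_k. Dualising reverses the order of composition, so the
    -- last summand contributes ∂_k((x_k - x_l) f) = f + s_k f, whose f cancels against the
    -- identity.
    extend-T : ∀ f c → extend (h f) (T k l c) ≡ extend (h (swap k l f)) c ℤ.+ extend (h (∂ k l f)) c
    extend-T f c = begin
      extend (h f) (∂ᴴ k l c ⊖ sᴴ k l c)
        ≡⟨ extend-⊖ (h f) (∂ᴴ k l c) (sᴴ k l c) ⟩
      extend (h f) (∂ᴴ k l c) ℤ.- extend (h f) (c ⊖ c₁ (root k l) (∂ᴴ k l c))
        ≡⟨ cong₂ ℤ._-_ (extend-∂ᴴ f c) (trans (extend-⊖ (h f) c (c₁ (root k l) (∂ᴴ k l c)))
             (cong (ℤ._-_ (extend (h f) c)) (trans (extend-c₁ k l (h f) (∂ᴴ k l c)) (extend-∂ᴴ ((var k - var l) * f) c)))) ⟩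
      extend (h (∂ k l f)) c ℤ.- (extend (h f) c ℤ.- extend (h (∂ k l ((var k - var l) * f))) c)
        ≡⟨ cong (λ a → extend (h (∂ k l f)) c ℤ.- (extend (h f) c ℤ.- a))
             (trans (extend-cong {φ = h (∂ k l ((var k - var l) * f))} {h f ⊞ h (swap k l f)} (h-∂-difference f) c)
               (trans (sumᴸ-cong c (λ (d , u) → ℤ.*-distribˡ-+ d (eval (h f) u) (eval (h (swap k l f)) u)))
                      (sumᴸ-+ c (λ (d , u) → d ℤ.* eval (h f) u) (λ (d , u) → d ℤ.* eval (h (swap k l f)) u)))) ⟩
      extend (h (∂ k l f)) c ℤ.- (extend (h f) c ℤ.- (extend (h f) c ℤ.+ extend (h (swap k l f)) c))
        ≡⟨ simplify (extend (h (∂ k l f)) c) (extend (h f) c) (extend (h (swap k l f)) c) ⟩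
      extend (h (swap k l f)) c ℤ.+ extend (h (∂ k l f)) c ∎
      where
      open ≡-Reasoning
      simplify : ∀ d x y → d ℤ.- (x ℤ.- (x ℤ.+ y)) ≡ y ℤ.+ d
      simplify = solve-∀

-- The CSM recursion read off from the Bruhat action

module _ {n : ℕ} where

  private
    module Bruhat = Action (bruhat {n})

  -- ψθ f w = ψ (w ⋆ f(θ))
  ψθ : Term (Fin n) → Functional n
  ψθ f = evalθ f Bruhat.▷ one

  ψθ-step : ∀ {k l} → Consecutive k l → ∀ f w →
    eval (ψθ f) (w · transpose k l) ≡ eval (ψθ (swap k l f)) w ℤ.+ eval (ψθ (∂ k l f)) w
  ψθ-step {k} {l} k⋖l f w = trans (sym (ℤ.*-identityˡ _)) (TwistedAction.τ-evalθ (bruhat-twist k⋖l) f one w)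

  -- The claim is made for every term f and not just for Schubert polynomials, since a step of the
  -- recursion replaces f by s_k f and ∂_k f.
  CSM-pairing : ∀ {w c} → IsCSM w c → ∀ f → eval (ψθ f) w ≡ extend (h f) c
  CSM-pairing (point {w} w≈id) f = begin
    eval (ψθ f) w                               ≡⟨ resp (ψθ f) {w} {idₚ} w≈id ⟩
    eval (ψθ f) idₚ                             ≡⟨ evalθ-▷-id bruhat bruhat-id f one ⟩
    constant f ℤ.* 1ℤ                          ≡⟨ cong (ℤ._*_ (constant f)) (𝟙-yes (idₚ {n} ≈ₚ? idₚ) (λ _ → refl)) ⟨
    constant f ℤ.* eval (indicator idₚ) (idₚ {n}) ≡⟨ evalθ-▷-id covering covering-id f (indicator idₚ) ⟨
    eval (h f) idₚ                             ≡⟨ extend-basis (h f) idₚ ⟨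
    extend (h f) (basis idₚ)                   ∎
    where open ≡-Reasoning
  CSM-pairing (step {w} {v} {c} k l k⋖l csm v≈ws) f = begin
    eval (ψθ f) v                                              ≡⟨ resp (ψθ f) {v} {w · transpose k l} v≈ws ⟩
    eval (ψθ f) (w · transpose k l)                            ≡⟨ ψθ-step k⋖l f w ⟩
    eval (ψθ (swap k l f)) w ℤ.+ eval (ψθ (∂ k l f)) w          ≡⟨ cong₂ ℤ._+_ (CSM-pairing csm (swap k l f)) (CSM-pairing csm (∂ k l f)) ⟩
    extend (h (swap k l f)) c ℤ.+ extend (h (∂ k l f)) c      ≡⟨ extend-T k⋖l f c ⟨
    extend (h f) (T k l c)                                    ∎
    where open ≡-Reasoning

-- Schubert polynomials are dual to Schubert classes

module _ {n : ℕ} where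

  open Action (covering {n})
  open Kernel (covering {n})

  Supported : ℕ → Functional n → Set
  Supported m φ = ∀ w → ℓ w ≢ m → eval φ w ≡ 0ℤ

  θ-Supported : ∀ i {m φ} → Supported m φ → Supported (suc m) (θ i ▷ φ)
  θ-Supported i {m} {φ} supp w ℓw≢ = trans (θ-▷ i φ w)
    (sum-0 (λ j → sg i j ℤ.* κ w i j ℤ.* eval φ (w · transpose i j)) λ j →
      vanish j (suc (ℓ (w · transpose i j)) ℕ.≟ ℓ w))
    where
    vanish : ∀ j (d : Dec (suc (ℓ (w · transpose i j)) ≡ ℓ w)) → sg i j ℤ.* 𝟙 d ℤ.* eval φ (w · transpose i j) ≡ 0ℤ
    vanish j (no _)  = cong (ℤ._* eval φ (w · transpose i j)) (ℤ.*-zeroʳ (sg i j))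
    vanish j (yes p) = trans (cong (ℤ._*_ (sg i j ℤ.* 1ℤ)) (supp (w · transpose i j) λ eq → ℓw≢ (trans (sym p) (cong suc eq))))
                             (ℤ.*-zeroʳ (sg i j ℤ.* 1ℤ))

  power-Supported : ∀ i p {m φ} → Supported m φ → ∃ λ d → Supported d (evalθ (var i ^ p) ▷ φ)
  power-Supported i zero    {m} supp = m , supp
  power-Supported i (suc p) {φ = φ} supp with power-Supported i p {φ = φ} supp
  ... | d , supp′ = suc d , θ-Supported i {φ = evalθ (var i ^ p) ▷ φ} supp′

  -- The degree d is kept as an unspecified witness. The value 1 of the staircase monomial at
  -- `reverse` later forces d to be the length of `reverse`, without adding up exponents.
  monomial-Supported : ∀ (is : List (Fin n)) (p : Fin n → ℕ) {m φ} → Supported m φ →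
    ∃ λ d → Supported d (evalθ (∏ is (λ i → var i ^ p i)) ▷ φ)
  monomial-Supported []       p {m} supp = m , supp
  monomial-Supported (i ∷ is) p {φ = φ} supp with monomial-Supported is p {φ = φ} supp
  ... | d , supp′ = power-Supported i (p i) {φ = evalθ (∏ is (λ i → var i ^ p i)) ▷ φ} supp′

  indicator-Supported : Supported 0 (indicator idₚ)
  indicator-Supported w ℓw≢0 = 𝟙-no (w ≈ₚ? idₚ) λ w≈id → ℓw≢0 (trans (ℓ-cong {u = w} {idₚ} w≈id) (ℓ-id {n}))

  -- The staircase monomial at the longest element

  Fixes : ℕ → Permutation′ n → Set
  Fixes r w = ∀ i → toℕ i ℕ.< r → w ⟨$⟩ʳ i ≡ i

  Fixes-≥ : ∀ {r w} → Fixes r w → ∀ i → r ≤ toℕ i → r ≤ toℕ (w ⟨$⟩ʳ i)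
  Fixes-≥ {r} {w} fixes i r≤i with toℕ (w ⟨$⟩ʳ i) ℕ.<? r
  ... | no ¬p = ℕ.≮⇒≥ ¬p
  ... | yes p = contradiction (subst (ℕ._< r) (cong toℕ (injective w (fixes (w ⟨$⟩ʳ i) p))) p) (ℕ.≤⇒≯ r≤i)

  Fixes-transpose : ∀ {w i j} → Fixes (toℕ i) w → i <ᶠ j → Fixes (toℕ i) (w · transpose i j)
  Fixes-transpose {w} {i} {j} fixes i<j m m<i = trans
    (cong (w ⟨$⟩ʳ_) (transpose-mismatch (λ m≡i → ℕ.<⇒≢ m<i (cong toℕ m≡i)) (λ m≡j → ℕ.<⇒≢ (ℕ.<-trans m<i i<j) (cong toℕ m≡j))))
    (fixes m m<i)

  term : Fin n → Functional n → Permutation′ n → Fin n → ℤ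
  term i φ w j = sg i j ℤ.* κ w i j ℤ.* eval φ (w · transpose i j)

  -- A position j < i holds the value j, which is below w(i), so exchanging the two would raise the
  -- length. Only a later position with a smaller value can contribute.
  term-vanishes : ∀ i φ w → Fixes (toℕ i) w → ∀ j →
    (i <ᶠ j → (w ⟨$⟩ʳ j) <ᶠ (w ⟨$⟩ʳ i) → eval φ (w · transpose i j) ≡ 0ℤ) → term i φ w j ≡ 0ℤ
  term-vanishes i φ w fixes j φ≡0 = cases (<-cmp i j) (suc (ℓ (w · transpose i j)) ℕ.≟ ℓ w)
    where
    x = eval φ (w · transpose i j)
    cases : Tri (i <ᶠ j) (i ≡ j) (j <ᶠ i) → (d : Dec (suc (ℓ (w · transpose i j)) ≡ ℓ w)) → sg i j ℤ.* 𝟙 d ℤ.* x ≡ 0ℤ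
    cases _              (no _)  = cong (ℤ._* x) (ℤ.*-zeroʳ (sg i j))
    cases (tri< i<j _ _) (yes p) = trans
      (cong (ℤ._*_ (sg i j ℤ.* 1ℤ)) (φ≡0 i<j (drop⇒inverted w i<j (ℕ.≤-reflexive p)))) (ℤ.*-zeroʳ (sg i j ℤ.* 1ℤ))
    cases (tri≈ _ refl _) (yes p) = cong (λ a → a ℤ.* 1ℤ ℤ.* x) (sg-refl i)
    cases (tri> _ _ j<i) (yes p) = contradiction
      (drop⇒inverted w j<i (ℕ.≤-reflexive (trans (cong suc (ℓ-cong-transpose w j i)) p)))
      (ℕ.≤⇒≯ (ℕ.≤-trans (ℕ.≤-reflexive (cong toℕ (fixes j j<i)))
        (ℕ.≤-trans (ℕ.<⇒≤ j<i) (Fixes-≥ {w = w} fixes i ℕ.≤-refl))))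

  -- Each factor x_i lowers w(i), which cannot fall below i.
  power-vanishes : ∀ i m φ w → Fixes (toℕ i) w → toℕ (w ⟨$⟩ʳ i) ℕ.< toℕ i ℕ.+ m → eval (evalθ (var i ^ m) ▷ φ) w ≡ 0ℤ
  power-vanishes i zero    φ w fixes wi< = contradiction (subst (toℕ (w ⟨$⟩ʳ i) ℕ.<_) (ℕ.+-identityʳ (toℕ i)) wi<)
    (ℕ.≤⇒≯ (Fixes-≥ {w = w} fixes i ℕ.≤-refl))
  power-vanishes i (suc m) φ w fixes wi< = trans (θ-▷ i φ′ w) (sum-0 (term i φ′ w) λ j →
    term-vanishes i φ′ w fixes j λ i<j wj<wi →
      power-vanishes i m φ (w · transpose i j) (Fixes-transpose {w} fixes i<j)
        (ℕ.≤-trans (ℕ.≤-reflexive (cong (suc ∘ toℕ ∘ (w ⟨$⟩ʳ_)) (transpose-matchˡ i j)))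
          (ℕ.≤-trans wj<wi (ℕ.s≤s⁻¹ (subst (toℕ (w ⟨$⟩ʳ i) ℕ.<_) (ℕ.+-suc (toℕ i) m) wi<)))))
    where φ′ = evalθ (var i ^ m) ▷ φ

  -- `Reversing 0` describes the longest element and `Reversing n` the identity. Applying x_i
  -- exactly n - 1 - i times, with i counted from 0, leads from stage i to stage i + 1.
  Reversing : ℕ → Permutation′ n → Set
  Reversing r w = Fixes r w × (∀ j → r ≤ toℕ j → suc (toℕ (w ⟨$⟩ʳ j) ℕ.+ toℕ j) ≡ n ℕ.+ r)

  -- The intermediate permutations between those of Reversing i and of Reversing (i + 1):
  -- position i holds the value i + m, and the values above i + m have already moved up by one.
  Between : Fin n → ℕ → Permutation′ n → Set
  Between i m w = Fixes (toℕ i) w × toℕ (w ⟨$⟩ʳ i) ≡ toℕ i ℕ.+ m ×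
    (∀ j → i <ᶠ j → (toℕ (w ⟨$⟩ʳ j) ℕ.< toℕ i ℕ.+ m × suc (toℕ (w ⟨$⟩ʳ j) ℕ.+ toℕ j) ≡ n ℕ.+ toℕ i)
                  ⊎ (toℕ i ℕ.+ m ℕ.< toℕ (w ⟨$⟩ʳ j) × toℕ (w ⟨$⟩ʳ j) ℕ.+ toℕ j ≡ n ℕ.+ toℕ i))

  between-0 : ∀ i w → Between i 0 w → Reversing (suc (toℕ i)) w
  between-0 i w (fixes , wi≡ , rest) = fixes′ , reversed
    where
    fixes′ : Fixes (suc (toℕ i)) w
    fixes′ j j<1+i with ℕ.m<1+n⇒m<n∨m≡n j<1+i
    ... | inj₁ j<i = fixes j j<i
    ... | inj₂ j≡i with refl ← toℕ-injective j≡i = toℕ-injective (trans wi≡ (ℕ.+-identityʳ (toℕ i)))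
    reversed : ∀ j → i <ᶠ j → suc (toℕ (w ⟨$⟩ʳ j) ℕ.+ toℕ j) ≡ n ℕ.+ suc (toℕ i)
    reversed j i<j with rest j i<j
    ... | inj₁ (p , _) = contradiction (subst (toℕ (w ⟨$⟩ʳ j) ℕ.<_) (ℕ.+-identityʳ (toℕ i)) p)
                           (ℕ.≤⇒≯ (Fixes-≥ {w = w} fixes j (ℕ.<⇒≤ i<j)))
    ... | inj₂ (_ , p) = trans (cong suc p) (sym (ℕ.+-suc n (toℕ i)))

  reversing-between : ∀ i w → Reversing (toℕ i) w → Between i (n ∸ suc (toℕ i)) w
  reversing-between i w (fixes , reversed) = fixes , wi≡ , λ j i<j → inj₁ (below j i<j , reversed j (ℕ.<⇒≤ i<j))
    where
    wi+1≡n : suc (toℕ (w ⟨$⟩ʳ i)) ≡ n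
    wi+1≡n = ℕ.+-cancelʳ-≡ (toℕ i) _ _ (reversed i ℕ.≤-refl)
    wi≡ : toℕ (w ⟨$⟩ʳ i) ≡ toℕ i ℕ.+ (n ∸ suc (toℕ i))
    wi≡ = ℕ.suc-injective (trans wi+1≡n (sym (ℕ.m+[n∸m]≡n (Fin.toℕ<n i))))
    below : ∀ j → i <ᶠ j → toℕ (w ⟨$⟩ʳ j) ℕ.< toℕ i ℕ.+ (n ∸ suc (toℕ i))
    below j i<j = subst (toℕ (w ⟨$⟩ʳ j) ℕ.<_) wi≡ (ℕ.≤∧≢⇒<
      (ℕ.s≤s⁻¹ (subst (suc (toℕ (w ⟨$⟩ʳ j)) ≤_) (sym wi+1≡n) (Fin.toℕ<n (w ⟨$⟩ʳ j))))
      (λ eq → ℕ.<⇒≢ i<j (sym (cong toℕ (injective w (toℕ-injective eq))))))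

  -- With as many factors x_i left as w(i) exceeds i, each one may lower w(i) by exactly one. A
  -- larger drop leaves more factors than room, and that term is zero by `power-vanishes`.
  between-step : ∀ i m φ w → (∀ u → Reversing (suc (toℕ i)) u → eval φ u ≡ 1ℤ) → Between i m w →
    eval (evalθ (var i ^ m) ▷ φ) w ≡ 1ℤ
  between-step i zero    φ w φ≡1 between = φ≡1 w (between-0 i w between)
  between-step i (suc m) φ w φ≡1 (fixes , wi≡ , rest) = begin
    eval (θ i ▷ φ′) w
      ≡⟨ θ-▷ i φ′ w ⟩
    sum (term i φ′ w)
      ≡⟨ sum-single (term i φ′ w) j others ⟩
    sg i j ℤ.* κ w i j ℤ.* eval φ′ w′
      ≡⟨ cong₂ ℤ._*_ (cong₂ ℤ._*_ (sg-< i<j) (𝟙-yes (suc (ℓ w′) ℕ.≟ ℓ w) (ℓ-drop-adjacent w i<j wi≡1+wj)))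
           (between-step i m φ w′ φ≡1 (Fixes-transpose {w} fixes i<j , trans (cong toℕ w′i) wj≡ , rest′)) ⟩
    1ℤ ∎
    where
    open ≡-Reasoning
    φ′ = evalθ (var i ^ m) ▷ φ
    wi≡1+ : toℕ (w ⟨$⟩ʳ i) ≡ suc (toℕ i ℕ.+ m)
    wi≡1+ = trans wi≡ (ℕ.+-suc (toℕ i) m)
    i+m<n : toℕ i ℕ.+ m ℕ.< n
    i+m<n = ℕ.<-trans (ℕ.n<1+n _) (subst (ℕ._< n) wi≡1+ (Fin.toℕ<n (w ⟨$⟩ʳ i)))
    j : Fin n
    -- The position of the value just below w(i) = i + m + 1. The value i + m + 1 then moves up to
    -- this position, which turns the first alternative of `Between` into the second there.
    j = w ⟨$⟩ˡ fromℕ< i+m<n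
    w′ = w · transpose i j
    wj≡ : toℕ (w ⟨$⟩ʳ j) ≡ toℕ i ℕ.+ m
    wj≡ = trans (cong toℕ (inverseʳ w)) (Fin.toℕ-fromℕ< i+m<n)
    wi≡1+wj : toℕ (w ⟨$⟩ʳ i) ≡ suc (toℕ (w ⟨$⟩ʳ j))
    wi≡1+wj = trans wi≡1+ (cong suc (sym wj≡))
    i<j : i <ᶠ j
    i<j with <-cmp i j
    ... | tri< p _ _ = p
    ... | tri≈ _ p _ = contradiction (trans (cong (toℕ ∘ (w ⟨$⟩ʳ_)) (sym p)) wi≡1+wj) (ℕ.<⇒≢ (ℕ.n<1+n _))
    ... | tri> _ _ p = contradiction p (ℕ.≤⇒≯ (ℕ.≤-trans (ℕ.m≤m+n (toℕ i) m)
                         (ℕ.≤-reflexive (trans (sym wj≡) (cong toℕ (fixes j p))))))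
    w′i : w′ ⟨$⟩ʳ i ≡ w ⟨$⟩ʳ j
    w′i = cong (w ⟨$⟩ʳ_) (transpose-matchˡ i j)
    w′j : w′ ⟨$⟩ʳ j ≡ w ⟨$⟩ʳ i
    w′j = cong (w ⟨$⟩ʳ_) (transpose-matchʳ i j)
    others : ∀ a → a ≢ j → term i φ′ w a ≡ 0ℤ
    others a a≢j = term-vanishes i φ′ w fixes a λ i<a wa<wi →
      power-vanishes i m φ (w · transpose i a) (Fixes-transpose {w} fixes i<a)
        (subst (ℕ._< toℕ i ℕ.+ m) (cong (toℕ ∘ (w ⟨$⟩ʳ_)) (sym (transpose-matchˡ i a)))
          (ℕ.≤∧≢⇒< (ℕ.s≤s⁻¹ (subst (toℕ (w ⟨$⟩ʳ a) ℕ.<_) wi≡1+ wa<wi))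
            (λ eq → a≢j (injective w (toℕ-injective (trans eq (sym wj≡)))))))
    Rest : ℕ → ℕ → Fin n → Set
    Rest m x a = (x ℕ.< toℕ i ℕ.+ m × suc (x ℕ.+ toℕ a) ≡ n ℕ.+ toℕ i)
               ⊎ (toℕ i ℕ.+ m ℕ.< x × x ℕ.+ toℕ a ≡ n ℕ.+ toℕ i)
    rest′ : ∀ a → i <ᶠ a → Rest m (toℕ (w′ ⟨$⟩ʳ a)) a
    rest′ a i<a with a ≟ j
    ... | yes refl = subst (λ x → Rest m x a) (cong toℕ (sym w′j)) (inj₂ (moved (rest a i<a)))
      where
      moved : Rest (suc m) (toℕ (w ⟨$⟩ʳ a)) a → toℕ i ℕ.+ m ℕ.< toℕ (w ⟨$⟩ʳ i) × toℕ (w ⟨$⟩ʳ i) ℕ.+ toℕ a ≡ n ℕ.+ toℕ i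
      moved (inj₁ (_ , p)) = ℕ.≤-reflexive (sym wi≡1+) , trans (cong (ℕ._+ toℕ a) wi≡1+wj) p
      moved (inj₂ (p , _)) = contradiction (subst (toℕ i ℕ.+ suc m ℕ.<_) wj≡ p) (ℕ.≤⇒≯ (ℕ.+-monoʳ-≤ (toℕ i) (ℕ.n≤1+n m)))
    ... | no a≢j = subst (λ x → Rest m x a)
        (cong (toℕ ∘ (w ⟨$⟩ʳ_)) (sym (transpose-mismatch (λ a≡i → ℕ.<⇒≢ i<a (cong toℕ (sym a≡i))) a≢j))) (kept (rest a i<a))
      where
      kept : Rest (suc m) (toℕ (w ⟨$⟩ʳ a)) a → Rest m (toℕ (w ⟨$⟩ʳ a)) a
      kept (inj₁ (p , q)) = inj₁ (ℕ.≤∧≢⇒< (ℕ.s≤s⁻¹ (subst (toℕ (w ⟨$⟩ʳ a) ℕ.<_) (ℕ.+-suc (toℕ i) m) p))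
                                   (λ eq → a≢j (injective w (toℕ-injective (trans eq (sym wj≡))))) , q)
      kept (inj₂ (p , q)) = inj₂ (ℕ.≤-<-trans (ℕ.+-monoʳ-≤ (toℕ i) (ℕ.n≤1+n m)) p , q)

  -- The list r, r + 1, ..., n - 1: the factors still to be applied at stage r, so that the
  -- remaining product and `Reversing r` advance together.
  data Interval : ℕ → List (Fin n) → Set where
    []  : Interval n []
    _∷_ : ∀ {r i is} → toℕ i ≡ r → Interval (suc r) is → Interval r (i ∷ is)

  tabulate-Interval : ∀ m r (f : Fin m → Fin n) → (∀ i → toℕ (f i) ≡ r ℕ.+ toℕ i) → r ℕ.+ m ≡ n → Interval r (tabulate f)
  tabulate-Interval zero    r f f≡ r+m≡n = subst (λ r → Interval r []) (trans (sym r+m≡n) (ℕ.+-identityʳ r)) []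
  tabulate-Interval (suc m) r f f≡ r+m≡n = trans (f≡ zero) (ℕ.+-identityʳ r) ∷
    tabulate-Interval m (suc r) (f ∘ suc) (λ i → trans (f≡ (suc i)) (ℕ.+-suc r (toℕ i))) (trans (sym (ℕ.+-suc r m)) r+m≡n)

  staircase : List (Fin n) → Term (Fin n)
  staircase is = ∏ is (λ i → var i ^ (n ∸ suc (toℕ i)))

  h-staircase : ∀ {r is} → Interval r is → ∀ w → Reversing r w → eval (h (staircase is)) w ≡ 1ℤ
  h-staircase [] w (fixes , _) = 𝟙-yes (w ≈ₚ? idₚ) λ i → fixes i (Fin.toℕ<n i)
  h-staircase (_∷_ {i = i} {is} refl interval) w reversing = between-step i (n ∸ suc (toℕ i)) (h (staircase is)) w
    (h-staircase interval) (reversing-between i w reversing)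

  h-longest : eval (h (staircase (allFin n))) reverse ≡ 1ℤ
  h-longest = h-staircase (tabulate-Interval n 0 (λ i → i) (λ _ → refl) refl) reverse
    ((λ _ ()) , λ j _ → trans (cong (λ x → suc (x ℕ.+ toℕ j)) (Fin.opposite-prop j))
      (trans (sym (ℕ.+-suc (n ∸ suc (toℕ j)) (toℕ j))) (trans (ℕ.m∸n+n≡m (Fin.toℕ<n j)) (sym (ℕ.+-identityʳ n)))))

  h-staircase-indicator : h (staircase (allFin n)) ≗ indicator reverse
  h-staircase-indicator u = cases (u ≈ₚ? reverse)
    where
    cases : (p? : Dec (u ≈ₚ reverse)) → eval (h (staircase (allFin n))) u ≡ 𝟙 p?
    cases (yes u≈) = trans (resp (h (staircase (allFin n))) {u} {reverse} u≈) h-longest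
    cases (no u≉) with monomial-Supported (allFin n) (λ i → n ∸ suc (toℕ i)) {φ = indicator idₚ} indicator-Supported
    ... | d , supp with ℓ {n} reverse ℕ.≟ d
    ...   | yes ℓ≡d = supp u (λ ℓu≡d → ℕ.<⇒≢ (ℓ<ℓ-reverse u u≉) (trans ℓu≡d (sym ℓ≡d)))
    ...   | no ℓ≢d  = contradiction (trans (sym h-longest) (supp reverse ℓ≢d)) λ ()

  -- For a descent from w to v = ws, `h-∂` turns the indicator of w into the condition that us = w
  -- and u is shorter than us. As ws is shorter than w, this says precisely that u = v.
  Schubert-dual : ∀ {v : Permutation′ n} {f} → IsSchubert v f → h f ≗ indicator v
  Schubert-dual (longest {w} {f} w≈ f≈) u = trans (h-sound f≈ u) (trans (h-staircase-indicator u)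
    (𝟙-cong (u ≈ₚ? reverse) (u ≈ₚ? w) (λ p i → trans (p i) (sym (w≈ i))) (λ p i → trans (p i) (w≈ i))))
  Schubert-dual (descend {w} {v} {f} {g} k l k⋖l schubert ws<w v≈ws divided) u = begin
    eval (h g) u
      ≡⟨ h-sound (divided-difference-unique (consecutive-≢ k⋖l) f g divided) u ⟩
    eval (h (∂ k l f)) u
      ≡⟨ h-∂ k⋖l f u ⟩
    ascending k⋖l u ℤ.* eval (h f) (u · s)
      ≡⟨ cong (ℤ._*_ (ascending k⋖l u)) (Schubert-dual schubert (u · s)) ⟩
    𝟙 (ℓ u ℕ.<? ℓ (u · s)) ℤ.* 𝟙 ((u · s) ≈ₚ? w)
      -- The trivial second condition `0 ≡ 0` only supplies the factor 1 that the shape of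
      -- `𝟙-×-cong` asks for.
      ≡⟨ 𝟙-×-cong (ℓ u ℕ.<? ℓ (u · s)) ((u · s) ≈ₚ? w) (u ≈ₚ? v) (yes refl) to from ⟩
    𝟙 (u ≈ₚ? v) ℤ.* 1ℤ
      ≡⟨ ℤ.*-identityʳ _ ⟩
    𝟙 (u ≈ₚ? v) ∎
    where
    open ≡-Reasoning
    s = transpose k l
    to : ℓ u ℕ.< ℓ (u · s) → u · s ≈ₚ w → u ≈ₚ v × 0 ≡ 0
    to _ us≈w = (λ i → trans (sym (·-transpose-involutive u k l i)) (trans (us≈w (s ⟨$⟩ʳ i)) (sym (v≈ws i)))) , refl
    from : u ≈ₚ v → 0 ≡ 0 → ℓ u ℕ.< ℓ (u · s) × u · s ≈ₚ w
    from u≈v _ = subst₂ ℕ._<_ (ℓ-cong {u = w · s} {u} (λ i → sym (u≈ws i))) (ℓ-cong {u = w} {u · s} (λ i → sym (us≈w i))) ws<w , us≈w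
      where
      u≈ws : u ≈ₚ w · s
      u≈ws i = trans (u≈v i) (v≈ws i)
      us≈w : u · s ≈ₚ w
      us≈w i = trans (u≈ws (s ⟨$⟩ʳ i)) (·-transpose-involutive w k l i)

-- Comparison of the coefficient at [X(v)] with the augmentation

theorem4p1 : (n : ℕ) → 2 ≤ n → (w v : Permutation′ n) →
    (c : Comb n) → IsCSM w c →
    (𝔖ᵥ : ℤ[x].Carrier {n}) → IsSchubert v 𝔖ᵥ →
    (a : FK.Carrier {n}) → a FK.≈ evalθ 𝔖ᵥ →
    coeff v c ≡ ψ (basis w ⋆ a)
theorem4p1 n _ w v c csm 𝔖ᵥ schubert a a≈ = begin
  coeff v c                       ≡⟨ coeff-extend v c ⟩
  extend (indicator v) c          ≡⟨ extend-cong {φ = h 𝔖ᵥ} {indicator v} (Schubert-dual schubert) c ⟨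
  extend (h 𝔖ᵥ) c                 ≡⟨ CSM-pairing csm 𝔖ᵥ ⟨
  eval (ψθ 𝔖ᵥ) w                  ≡⟨ FK-sound a≈ one w ⟨
  eval (a ▷ one) w                ≡⟨ extend-basis (a ▷ one) w ⟨
  extend (a ▷ one) (basis w)      ≡⟨ extend-⋆ a one (basis w) ⟨
  extend one (basis w ⋆ a)        ≡⟨ ψ-extend (basis w ⋆ a) ⟨
  ψ (basis w ⋆ a)                 ∎
  where
  open ≡-Reasoning
  open Action (bruhat {n})
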